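{- There is an algorithm that, given a path metric $(V,\mathrm{d})$ with $|V|=n$, a set of terminals $\mathcal{X}\subseteq V$, a root $r\in\mathcal{X}$ and an integer $k\ge 1$ (where $k$ is part of the input), computes a minimum-cost $k$-hop Steiner tree exactly in time $O(kn^5)$.
   Context: A graph $G=(V,E)$ with a positive edge-weight function induces the finite metric space $(V,\mathrm{d})$ if for all $u,v\in V$ the length of a shortest $u$-$v$ path in $G$ equals $\mathrm{d}(u,v)$. The metric $(V,\mathrm{d})$ is a path metric if some weighted path on vertex set $V$ induces it. The metric is assumed to be given by a graph inducing it. Given a finite metric space $(V,\mathrm{d})$ with $\mathrm{d}:V\times V\to\mathbb{Q}_+$, terminals $\mathcal{X}\subseteq V$, a root $r\in\mathcal{X}$ and an integer $k\ge1$, a $k$-hop Steiner tree is a tree $S=(V_S,E_S)$ rooted at $r$ with $\mathcal{X}\subseteq V_S\subseteq V$ whose edges are arbitrary pairs of points of $V_S$ (not necessarily edges of a graph inducing the metric), such that for every $v\in V_S$ the $r$-$v$ path in $S$ has at most $k$ edges. Its cost is $\sum_{\{u,v\}\in E_S}\mathrm{d}(u,v)$. A minimum-cost $k$-hop Steiner tree is a $k$-hop Steiner tree of minimum cost. -}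

module Defs where

open import Algebra.Properties.CommutativeMonoid.Sum using (sum)
open import Data.Bool using (Bool; true; false; T; not; _∧_; if_then_else_)
open import Data.Fin using (Fin; toℕ; fromℕ<; combine; remQuot) renaming (_<?_ to _<ᶠ?_)
open import Data.Fin.Permutation using (Permutation′; _⟨$⟩ʳ_)
open import Data.Fin.Subset using (Subset; _∈_; _⊆_)
open import Data.List using (List; []; _∷_)
open import Data.List.Relation.Unary.Unique.Propositional using (Unique)
open import Data.Maybe using (Maybe; just; nothing; fromMaybe)
open import Data.Nat using (ℕ; zero; suc; _+_; _*_; _∸_; _≤_; _<ᵇ_; _≡ᵇ_; _<?_)
open import Data.Product using (Σ; ∃; _×_; _,_; proj₁; uncurry)
open import Data.Rational as ℚ using (ℚ; 0ℚ)
open import Data.Rational.Properties using (+-0-commutativeMonoid)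
open import Data.Sum using (_⊎_)
open import Data.Vec using (lookup)
open import Function using (_⇔_)
open import Function.Metric.Rational using (DistanceFunction; IsMetric)
open import Relation.Binary.Construct.Closure.ReflexiveTransitive using (Star; ε; _◅_)
open import Relation.Binary.PropositionalEquality using (_≡_)
open import Relation.Nullary using (¬_; does; yes; no)

------------------------------------------------------------------------
-- Paths.  `Star E u v` is the type of u-v walks along E.

module _ {V : Set} {E : V → V → Set} where

  visited : ∀ {u v} → Star E u v → List V
  visited {u} ε       = u ∷ []
  visited {u} (_ ◅ p) = u ∷ visited p

  hops : ∀ {u v} → Star E u v → ℕ
  hops ε       = 0
  hops (_ ◅ p) = suc (hops p)

record Path {V : Set} (E : V → V → Set) (u v : V) : Set where
  field
    walk   : Star E u v
    simple : Unique (visited walk)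

open Path public

------------------------------------------------------------------------
-- Weighted graphs on the vertex set Fin n

-- `weight u v` is `nothing` when {u,v} is not an edge.
record Graph (n : ℕ) : Set where
  field
    weight    : Fin n → Fin n → Maybe ℚ
    symmetric : ∀ u v → weight u v ≡ weight v u
    loopless  : ∀ u → weight u u ≡ nothing
    positive  : ∀ {u v w} → weight u v ≡ just w → 0ℚ ℚ.< w

  Edge : Fin n → Fin n → Set
  Edge u v = ∃ λ w → weight u v ≡ just w

  length : ∀ {u v} → Star Edge u v → ℚ
  length ε       = 0ℚ
  length (e ◅ p) = proj₁ e ℚ.+ length p

open Graph public

Induces : ∀ {n} → Graph n → DistanceFunction (Fin n) → Set
Induces G d = ∀ u v →
    (∃ λ (p : Path (Edge G) u v) → length G (walk p) ≡ d u v)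
  × (∀ (p : Path (Edge G) u v) → d u v ℚ.≤ length G (walk p))

-- The position of v along the path is π ⟨$⟩ʳ v.
IsPathGraph : ∀ {n} → Graph n → Set
IsPathGraph {n} G = Σ (Permutation′ n) λ π →
  let pos : Fin n → ℕ
      pos v = toℕ (π ⟨$⟩ʳ v)
  in  ∀ u v → Edge G u v ⇔ (suc (pos u) ≡ pos v ⊎ suc (pos v) ≡ pos u)

record IsPathMetric {n : ℕ} (d : DistanceFunction (Fin n)) : Set where
  field
    isMetric : IsMetric _≡_ d
    induced  : ∃ λ (P : Graph n) → IsPathGraph P × Induces P d

------------------------------------------------------------------------
-- k-hop Steiner trees

-- A graph (V_S , E_S) with V_S ⊆ Fin n; its edges are arbitrary pairs.
record Subgraph (n : ℕ) : Set where
  field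
    vertices  : Subset n
    edge      : Fin n → Fin n → Bool

  Adj : Fin n → Fin n → Set
  Adj u v = T (edge u v)

  field
    endpoints   : ∀ {u v} → Adj u v → u ∈ vertices
    symmetric   : ∀ {u v} → Adj u v → Adj v u
    irreflexive : ∀ {u} → ¬ Adj u u

open Subgraph public using (vertices; edge; Adj)

-- An edge {u,v} together with a v-u path of at least two edges is a cycle.
record IsTree {n : ℕ} (S : Subgraph n) : Set where
  field
    connected : ∀ {u v} → u ∈ vertices S → v ∈ vertices S → Path (Adj S) u v
    acyclic   : ∀ {u v} → Adj S u v → (p : Path (Adj S) v u) → hops (walk p) ≤ 1

-- In a tree the r-v path is unique, so `hop` may ask for some r-v path.
record IsKHopSteinerTree {n : ℕ} (X : Subset n) (r : Fin n) (k : ℕ)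
                         (S : Subgraph n) : Set where
  field
    isTree    : IsTree S
    root      : r ∈ vertices S
    terminals : X ⊆ vertices S
    hop       : ∀ {v} → v ∈ vertices S → ∃ λ (p : Path (Adj S) r v) → hops (walk p) ≤ k

cost : ∀ {n} → DistanceFunction (Fin n) → Subgraph n → ℚ
cost d S = ∑ λ u → ∑ λ v → if edge S u v ∧ does (u <ᶠ? v) then d u v else 0ℚ
  where
  ∑ : ∀ {n} → (Fin n → ℚ) → ℚ
  ∑ = sum +-0-commutativeMonoid

IsMinimumKHopSteinerTree : ∀ {n} → DistanceFunction (Fin n) →
                           Subset n → Fin n → ℕ → Subgraph n → Set
IsMinimumKHopSteinerTree d X r k S =
    IsKHopSteinerTree X r k S
  × (∀ S′ → IsKHopSteinerTree X r k S′ → cost d S ℚ.≤ cost d S′)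

------------------------------------------------------------------------
-- The machine model: a unit-cost random access machine, programmed in
-- a structured language.  The memory consists of arrays of naturals and
-- arrays of rationals; a program can name only finitely many of them,
-- and a scalar variable is an array of which only one cell is used.
-- Every constant, memory access, addition, subtraction, comparison and
-- Boolean connective costs one step, and so does every assignment and
-- every branch.  There is deliberately no unit-cost multiplication,
-- since on unbounded numbers it would make the machine unrealistically
-- powerful.

data Sort : Set where
  nat rat : Sort

Val : Sort → Set
Val nat = ℕ
Val rat = ℚ

-- σ s A i is the content of cell i of the array of sort s named A.
State : Set
State = (s : Sort) → ℕ → ℕ → Val s

update : State → (s : Sort) → ℕ → ℕ → Val s → State
update σ nat A i x nat B j = if (A ≡ᵇ B) ∧ (i ≡ᵇ j) then x else σ nat B j
update σ nat A i x rat B j = σ rat B j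
update σ rat A i x nat B j = σ nat B j
update σ rat A i x rat B j = if (A ≡ᵇ B) ∧ (i ≡ᵇ j) then x else σ rat B j

data Expr : Sort → Set where
  const   : ∀ {s} → Val s → Expr s
  read    : ∀ {s} → ℕ → Expr nat → Expr s
  add sub : ∀ {s} → Expr s → Expr s → Expr s

data Test : Set where
  less : ∀ {s} → Expr s → Expr s → Test
  neg  : Test → Test
  conj : Test → Test → Test

data Cmd : Set where
  skip  : Cmd
  write : (s : Sort) → ℕ → Expr nat → Expr s → Cmd
  _⨾_   : Cmd → Cmd → Cmd
  cond  : Test → Cmd → Cmd → Cmd
  while : Test → Cmd → Cmd

infixr 5 _⨾_

plus : (s : Sort) → Val s → Val s → Val s
plus nat = _+_
plus rat = ℚ._+_

-- Subtraction of naturals is truncated.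
minus : (s : Sort) → Val s → Val s → Val s
minus nat = _∸_
minus rat = ℚ._-_

lessThan : (s : Sort) → Val s → Val s → Bool
lessThan nat m n = m <ᵇ n
lessThan rat p q = does (p ℚ.<? q)

eval : ∀ {s} → State → Expr s → Val s
eval     σ (const x)   = x
eval {s} σ (read A i)  = σ s A (eval σ i)
eval {s} σ (add e₁ e₂) = plus s (eval σ e₁) (eval σ e₂)
eval {s} σ (sub e₁ e₂) = minus s (eval σ e₁) (eval σ e₂)

test : State → Test → Bool
test σ (less {s} e₁ e₂) = lessThan s (eval σ e₁) (eval σ e₂)
test σ (neg b)          = not (test σ b)
test σ (conj b₁ b₂)     = test σ b₁ ∧ test σ b₂

∣_∣ᵉ : ∀ {s} → Expr s → ℕ
∣ const _   ∣ᵉ = 1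
∣ read _ i  ∣ᵉ = suc ∣ i ∣ᵉ
∣ add e₁ e₂ ∣ᵉ = suc (∣ e₁ ∣ᵉ + ∣ e₂ ∣ᵉ)
∣ sub e₁ e₂ ∣ᵉ = suc (∣ e₁ ∣ᵉ + ∣ e₂ ∣ᵉ)

∣_∣ᵗ : Test → ℕ
∣ less e₁ e₂ ∣ᵗ = suc (∣ e₁ ∣ᵉ + ∣ e₂ ∣ᵉ)
∣ neg b      ∣ᵗ = suc ∣ b ∣ᵗ
∣ conj b₁ b₂ ∣ᵗ = suc (∣ b₁ ∣ᵗ + ∣ b₂ ∣ᵗ)

-- Exec c σ τ t : started in σ, the program c halts in τ after t steps.
data Exec : Cmd → State → State → ℕ → Set where
  skip : ∀ {σ} → Exec skip σ σ 1
  write : ∀ {σ s A i e} →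
    Exec (write s A i e) σ (update σ s A (eval σ i) (eval σ e))
         (suc (∣ i ∣ᵉ + ∣ e ∣ᵉ))
  _⨾_ : ∀ {c₁ c₂ σ₁ σ₂ σ₃ t₁ t₂} →
    Exec c₁ σ₁ σ₂ t₁ → Exec c₂ σ₂ σ₃ t₂ → Exec (c₁ ⨾ c₂) σ₁ σ₃ (t₁ + t₂)
  cond-true : ∀ {b c₁ c₂ σ τ t} → test σ b ≡ true →
    Exec c₁ σ τ t → Exec (cond b c₁ c₂) σ τ (suc (∣ b ∣ᵗ + t))
  cond-false : ∀ {b c₁ c₂ σ τ t} → test σ b ≡ false →
    Exec c₂ σ τ t → Exec (cond b c₁ c₂) σ τ (suc (∣ b ∣ᵗ + t))
  while-false : ∀ {b c σ} → test σ b ≡ false →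
    Exec (while b c) σ σ (suc ∣ b ∣ᵗ)
  while-true : ∀ {b c σ₁ σ₂ σ₃ t₁ t₂} → test σ₁ b ≡ true →
    Exec c σ₁ σ₂ t₁ → Exec (while b c) σ₂ σ₃ t₂ →
    Exec (while b c) σ₁ σ₃ (suc (∣ b ∣ᵗ + (t₁ + t₂)))

------------------------------------------------------------------------
-- Input and output conventions

flag : Bool → ℕ
flag b = if b then 1 else 0

fill : ∀ {A : Set} {m} → A → (Fin m → A) → ℕ → A
fill {m = m} a f i with i <? m
... | yes i<m = f (fromℕ< i<m)
... | no _    = a

-- Natural array 0 holds n, k and the root; natural array 1 flags the
-- terminals; rational array 0 is the row-major weight matrix of the
-- graph, in which 0 marks a non-edge.  All other cells are 0.
input : ∀ {n} → Graph n → Subset n → Fin n → ℕ → State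
input {n} G X r k = σ
  where
  σ : State
  σ nat 0 0 = n
  σ nat 0 1 = k
  σ nat 0 2 = toℕ r
  σ nat 1 i = fill 0 (λ v → flag (lookup X v)) i
  σ nat _ _ = 0
  σ rat 0 i = fill 0ℚ (λ uv → fromMaybe 0ℚ (uncurry (weight G) (remQuot {n} n uv))) i
  σ rat _ _ = 0ℚ

-- Natural array 2 flags the vertices of S; natural array 3 is its
-- row-major adjacency matrix.
Outputs : ∀ {n} → State → Subgraph n → Set
Outputs {n} σ S =
    (∀ v → σ nat 2 (toℕ v) ≡ flag (lookup (vertices S) v))
  × (∀ (u v : Fin n) → σ nat 3 (toℕ (combine u v)) ≡ flag (edge S u v))

{-# OPTIONS --safe #-}
-- In a k-hop tree every vertex other than the root is joined to a vertex of smaller depth.  Conversely, give some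
-- vertices, among them the terminals, labels in {1 , … , k} and join each to the nearest vertex of smaller label, the
-- root having label 0: this is a k-hop tree.  So a minimum tree is a cheapest labelling, in any metric.  On a line
-- the nearest vertex of smaller label is the nearest such vertex on the left or on the right.  Hence in an open interval
-- (l , r) whose ends have labels ≤ q and whose interior labels exceed q, each vertex a labelled q + 1 pays
-- min (d l a , d a r), and between consecutive such vertices the same problem arises with q + 1.  With G q l r the
-- optimum for (l , r), this gives the recursion
--   H l = 0 ,  H b = min over l ≤ a < b of H a + min (d l a , d a r) + G (q + 1) a b ,  G q l r = H r
-- (the end l pays nothing), starting from q = k - 1, where every terminal of the interval pays for itself.  There are
-- k layers, n² intervals and n² pairs (a , b), and the optimal parents are carried along as vectors of length n.  A
-- copy of the root is put at either end of the line, so that the whole line is the interval (0 , n + 1).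
--
-- The metric is recovered by n rounds of Bellman–Ford relaxation.  A vertex farthest from the root is an end of the
-- path, and the order of the vertices is that of their distances from it.
module Submission where

open import Defs
open import Algebra.Bundles using (CommutativeMonoid)
import Algebra.Properties.CommutativeMonoid.Sum
open import Data.Bool using (Bool; true; false; T; not; _∧_; _∨_; if_then_else_)
open import Data.Bool.Properties using (T-∧; T-∨; T?; ∧-zeroʳ)
open import Data.Empty using (⊥-elim)
open import Data.Fin using (Fin; toℕ; fromℕ<; opposite; combine; remQuot) renaming (zero to fzero; suc to fsuc; _<?_ to _<ᶠ?_)
open import Data.Fin.Permutation using (Permutation′; _⟨$⟩ʳ_; _⟨$⟩ˡ_; inverseˡ; inverseʳ; reverse; flip; _∘ₚ_)
open import Data.Fin.Properties using (toℕ-injective; toℕ<n; toℕ-fromℕ; toℕ-fromℕ<; fromℕ<-toℕ; toℕ-inject₁; toℕ-combine; remQuot-combine; opposite-prop; injective⇒≤; any?) renaming (_≟_ to _≟ᶠ_)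
open import Data.Fin.Subset using (Subset; _∈_)
open import Data.List as List using ([]; _∷_)
open import Data.List.Membership.Propositional using () renaming (_∈_ to _∈ˡ_; _∉_ to _∉ˡ_)
open import Data.List.Membership.Propositional.Properties using (∈-lookup)
open import Data.List.Relation.Unary.All as All using ([]; _∷_)
open import Data.List.Relation.Unary.All.Properties using (¬Any⇒All¬; All¬⇒¬Any)
open import Data.List.Relation.Unary.AllPairs using ([]; _∷_)
open import Data.List.Relation.Unary.Any using (here; there)
open import Data.List.Relation.Unary.Unique.Propositional using (Unique)
open import Data.Maybe using (just; nothing; fromMaybe)
open import Data.Nat using (ℕ; zero; suc; _+_; _*_; _^_; _∸_; _⊔_; _⊓_; _≤_; _<_; _<?_; _<ᵇ_; _≤ᵇ_; _≡ᵇ_; z≤n; s≤s; s≤s⁻¹; >-nonZero)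
open import Data.Nat.Properties
open import Data.Product using (∃; _×_; _,_; proj₁; proj₂; uncurry)
open import Data.Rational as ℚ using (ℚ; 0ℚ)
import Data.Rational.Properties as ℚ
open import Data.Sum using (_⊎_; inj₁; inj₂)
open import Data.Unit using (⊤; tt)
open import Data.Vec using (lookup; tabulate)
open import Data.Vec.Properties using (lookup∘tabulate; lookup⇒[]=; []=⇒lookup)
open import Function using (Equivalence; _∘_)
open import Function.Metric.Rational using (DistanceFunction; IsMetric)
open import Relation.Binary using (tri<; tri≈; tri>)
open import Relation.Binary.Construct.Closure.ReflexiveTransitive using (Star; ε; _◅_; _◅◅_)
open import Relation.Binary.PropositionalEquality
open import Relation.Nullary using (¬_; Dec; does; yes; no; contradiction)
open import Relation.Nullary.Decidable using (_×-dec_; dec-true; dec-false)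
open Algebra.Properties.CommutativeMonoid.Sum ℚ.+-0-commutativeMonoid using (sum; sum-cong-≗; ∑-distrib-+; ∑-comm; sum-permute; sum-replicate-zero)

-- `Exec` is a relation for programs with unbounded loops. Programs are therefore written in a
-- language of bounded loops with a total interpreter `run`: correctness is proved for `run` alone,
-- time is bounded from the syntax, and `exec` ties both to `Exec`.
--
-- Optimality is proved in two halves that never share a notion of labelling. A computed plan
-- records parents but no labels, so its feasibility is expressed by hop budgets that shrink along
-- chains of parents (`Served`). A competing tree contributes only labels and payments (`Rival`),
-- and every tabulated value is a lower bound for what it pays. No competitor has to be brought into
-- the form of the plans that the program builds.
--
-- The given graph may be any graph inducing the metric, so neither distances nor the order of the
-- line can be read off its edges. The line is determined only up to reversal; which of the two
-- orientations is meant is settled by the farthest vertex.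

module ℕΣ = Algebra.Properties.CommutativeMonoid.Sum +-0-commutativeMonoid

-- Bounded-loop programs: semantics, frame conditions and running time.

-- Programs whose only loops are bounded.  The loop `for x y p` counts in cell 0 of the natural array x up
-- to the value in cell 0 of the array y; since p writes to neither, `run` can unfold it by recursion.
data Prog : Set where
  asg  : (s : Sort) → ℕ → Expr nat → Expr s → Prog
  _∙_  : Prog → Prog → Prog
  cond : Test → Prog → Prog → Prog
  for  : ℕ → ℕ → Prog → Prog
  nop  : Prog

infixr 5 _∙_

var : ℕ → Expr nat
var x = read x (const 0)

incr : ℕ → Expr nat
incr x = add (const 1) (var x)

compile : Prog → Cmd
compile (asg s A i e)  = write s A i e
compile (p ∙ q)        = compile p ⨾ compile q
compile (cond b p q)   = cond b (compile p) (compile q)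
compile (for x y p)    =
  write nat x (const 0) (const 0) ⨾
  while (less (var x) (var y)) (compile p ⨾ write nat x (const 0) (incr x))
compile nop            = skip

-- The last round is peeled off in `iterate`, so that the state after `m` rounds occurs in that
-- after `m + 1` and induction runs forwards. `run` reads the loop bound once, `compile` before
-- every round; the two agree because `wf` forbids writing to it.
run : Prog → State → State
iterate : ℕ → Prog → ℕ → State → State

run (asg s A i e) σ = update σ s A (eval σ i) (eval σ e)
run (p ∙ q)       σ = run q (run p σ)
run (cond b p q)  σ = if test σ b then run p σ else run q σ
run (for x y p)   σ = iterate x p (σ nat y 0) (update σ nat x 0 0)
run nop           σ = σ

iterate x p zero    σ = σ
iterate x p (suc m) σ =
  update (run p (iterate x p m σ)) nat x 0 (suc (run p (iterate x p m σ) nat x 0))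

same : Sort → ℕ → Sort → ℕ → Bool
same nat A nat B = A ≡ᵇ B
same rat A rat B = A ≡ᵇ B
same nat _ rat _ = false
same rat _ nat _ = false

-- Arrays are tracked as a whole, not cell by cell. The answer computes for a concrete program,
-- which is why frame conditions are discharged by `refl`.
writesTo : Prog → Sort → ℕ → Bool
writesTo (asg s A _ _) s′ B = same s A s′ B
writesTo (p ∙ q)       s′ B = if writesTo p s′ B then true else writesTo q s′ B
writesTo (cond _ p q)  s′ B = if writesTo p s′ B then true else writesTo q s′ B
writesTo (for x _ p)   s′ B = if same nat x s′ B then true else writesTo p s′ B
writesTo nop           s′ B = false

update-frame : ∀ σ s A i x s′ B j → same s A s′ B ≡ false → update σ s A i x s′ B j ≡ σ s′ B j
update-frame σ nat A i x nat B j eq rewrite eq = refl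
update-frame σ nat A i x rat B j eq = refl
update-frame σ rat A i x nat B j eq = refl
update-frame σ rat A i x rat B j eq rewrite eq = refl

run-frame : ∀ p σ s A j → writesTo p s A ≡ false → run p σ s A j ≡ σ s A j
iterate-frame : ∀ x p m σ s A j → same nat x s A ≡ false → writesTo p s A ≡ false →
                iterate x p m σ s A j ≡ σ s A j

run-frame (asg s′ B i e) σ s A j eq = update-frame σ s′ B (eval σ i) (eval σ e) s A j eq
run-frame (p ∙ q) σ s A j eq with writesTo p s A in eq₁
... | false = trans (run-frame q (run p σ) s A j eq) (run-frame p σ s A j eq₁)
run-frame (cond b p q) σ s A j eq with writesTo p s A in eq₁
... | false with test σ b
...   | true  = run-frame p σ s A j eq₁
...   | false = run-frame q σ s A j eq
run-frame (for x y p) σ s A j eq with same nat x s A in eq₁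
... | false = trans (iterate-frame x p (σ nat y 0) _ s A j eq₁ eq)
                    (update-frame σ nat x 0 0 s A j eq₁)
run-frame nop σ s A j eq = refl

iterate-frame x p zero    σ s A j eq₁ eq = refl
iterate-frame x p (suc m) σ s A j eq₁ eq =
  trans (update-frame (run p (iterate x p m σ)) nat x 0 _ s A j eq₁)
        (trans (run-frame p (iterate x p m σ) s A j eq) (iterate-frame x p m σ s A j eq₁ eq))

≡ᵇ-refl : ∀ n → (n ≡ᵇ n) ≡ true
≡ᵇ-refl zero    = refl
≡ᵇ-refl (suc n) = ≡ᵇ-refl n

≡ᵇ-≢ : ∀ {m n} → m ≢ n → (m ≡ᵇ n) ≡ false
≡ᵇ-≢ {zero}  {zero}  ne = ⊥-elim (ne refl)
≡ᵇ-≢ {zero}  {suc n} ne = refl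
≡ᵇ-≢ {suc m} {zero}  ne = refl
≡ᵇ-≢ {suc m} {suc n} ne = ≡ᵇ-≢ (λ e → ne (cong suc e))

update-same : ∀ σ x v → update σ nat x 0 v nat x 0 ≡ v
update-same σ x v rewrite ≡ᵇ-refl x = refl

-- `prot` marks the arrays that hold loop bounds.
wf : (ℕ → Bool) → Prog → Bool
wf prot (asg nat A _ _) = not (prot A)
wf prot (asg rat _ _ _) = true
wf prot (p ∙ q)         = wf prot p ∧ wf prot q
wf prot (cond _ p q)    = wf prot p ∧ wf prot q
wf prot (for x y p)     = prot y ∧ (not (prot x) ∧ (not (writesTo p nat x) ∧ wf prot p))
wf prot nop             = true

T-∧⁻ : ∀ {a b} → T (a ∧ b) → T a × T b
T-∧⁻ = Equivalence.to T-∧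

T-not : ∀ {a} → T (not a) → a ≡ false
T-not {false} _ = refl

T⇒≡ : ∀ {a} → T a → a ≡ true
T⇒≡ {true} _ = refl

wf-for : ∀ prot x y p → T (wf prot (for x y p)) →
         T (prot y) × prot x ≡ false × writesTo p nat x ≡ false × T (wf prot p)
wf-for prot x y p w with T-∧⁻ {prot y} w
... | wy , w₁ with T-∧⁻ {not (prot x)} w₁
...   | wx , w₂ with T-∧⁻ {not (writesTo p nat x)} w₂
...     | wp , w₃ = wy , T-not wx , T-not wp , w₃

-- For this reason every loop bound keeps its initial value, and iterations can be counted in the
-- starting state.
prot-frame : ∀ prot p A → T (wf prot p) → T (prot A) → writesTo p nat A ≡ false
prot-frame prot (asg nat B i e) A w t with B ≡ᵇ A in eq
... | false = refl
... | true rewrite ≡ᵇ⇒≡ B A (subst T (sym eq) tt) | T⇒≡ t = ⊥-elim w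
prot-frame prot (asg rat B i e) A w t = refl
prot-frame prot (p ∙ q) A w t
  rewrite prot-frame prot p A (proj₁ (T-∧⁻ w)) t = prot-frame prot q A (proj₂ (T-∧⁻ w)) t
prot-frame prot (cond b p q) A w t
  rewrite prot-frame prot p A (proj₁ (T-∧⁻ w)) t = prot-frame prot q A (proj₂ (T-∧⁻ w)) t
prot-frame prot (for x y p) A w t with x ≡ᵇ A in eq
... | false = prot-frame prot p A (proj₂ (proj₂ (proj₂ (wf-for prot x y p w)))) t
... | true rewrite sym (≡ᵇ⇒≡ x A (subst T (sym eq) tt)) =
  ⊥-elim (subst T (proj₁ (proj₂ (wf-for prot x y p w))) t)
prot-frame prot nop A w t = refl

-- A program runs for at most `size` steps per innermost iteration, and `mono` bounds the iterations.
size : Prog → ℕ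
size (asg _ _ i e) = suc (∣ i ∣ᵉ + ∣ e ∣ᵉ)
size (p ∙ q)       = size p + size q
size (cond b p q)  = suc (∣ b ∣ᵗ + (size p + size q))
size (for x y p)   = 13 + size p
size nop           = 1

mono : Prog → State → ℕ
mono (asg _ _ _ _) σ = 1
mono (p ∙ q)       σ = mono p σ ⊔ mono q σ
mono (cond _ p q)  σ = mono p σ ⊔ mono q σ
mono (for x y p)   σ = suc (σ nat y 0) * mono p σ
mono nop           σ = 1

mono≥1 : ∀ p σ → 1 ≤ mono p σ
mono≥1 (asg s A i e) σ = ≤-refl
mono≥1 (p ∙ q)       σ = ≤-trans (mono≥1 p σ) (m≤m⊔n _ _)
mono≥1 (cond b p q)  σ = ≤-trans (mono≥1 p σ) (m≤m⊔n _ _)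
mono≥1 (for x y p)   σ = *-mono-≤ {1} {suc (σ nat y 0)} {1} (s≤s z≤n) (mono≥1 p σ)
mono≥1 nop           σ = ≤-refl

mono-cong : ∀ prot p {σ τ} → T (wf prot p) → (∀ A → T (prot A) → σ nat A 0 ≡ τ nat A 0) →
            mono p σ ≡ mono p τ
mono-cong prot (asg s A i e) w h = refl
mono-cong prot (p ∙ q) w h =
  cong₂ _⊔_ (mono-cong prot p (proj₁ (T-∧⁻ w)) h) (mono-cong prot q (proj₂ (T-∧⁻ w)) h)
mono-cong prot (cond b p q) w h =
  cong₂ _⊔_ (mono-cong prot p (proj₁ (T-∧⁻ w)) h) (mono-cong prot q (proj₂ (T-∧⁻ w)) h)
mono-cong prot (for x y p) w h with wf-for prot x y p w
... | wy , _ , _ , wp = cong₂ (λ a b → suc a * b) (h y wy) (mono-cong prot p wp h)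
mono-cong prot nop w h = refl

-- Resetting the counter costs 3 and the failing test 6; each round costs 6 for its test and 6 for
-- the increment. The additional round in `suc d` absorbs the 9.
loop-time : ∀ s d μ → 1 ≤ μ → 3 + (6 + d * (12 + s * μ)) ≤ (13 + s) * (suc d * μ)
loop-time s d μ@(suc _) _ = begin
  9 + d * (12 + s * μ)                 ≤⟨ +-mono-≤ nine (*-monoʳ-≤ d iteration) ⟩
  (13 + s) * μ + d * ((13 + s) * μ)    ≡⟨⟩
  suc d * ((13 + s) * μ)               ≡⟨ *-assoc (suc d) (13 + s) μ ⟨
  suc d * (13 + s) * μ                 ≡⟨ cong (_* μ) (*-comm (suc d) (13 + s)) ⟩
  (13 + s) * suc d * μ                 ≡⟨ *-assoc (13 + s) (suc d) μ ⟩
  (13 + s) * (suc d * μ)               ∎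
  where
  open ≤-Reasoning
  iteration : 12 + s * μ ≤ (13 + s) * μ
  iteration = begin
    12 + s * μ       ≤⟨ +-monoˡ-≤ (s * μ) (≤-trans (m≤m*n 12 μ) (*-monoˡ-≤ μ (n≤1+n 12))) ⟩
    13 * μ + s * μ   ≡⟨ *-distribʳ-+ μ 13 s ⟨
    (13 + s) * μ     ∎
  nine : 9 ≤ (13 + s) * μ
  nine = ≤-trans (m≤m+n 9 (3 + s * μ)) iteration

Runs : Cmd → State → State → ℕ → Set
Runs c σ τ b = ∃ λ t → Exec c σ τ t × t ≤ b

-- Sizes add up while `mono` takes maxima, so the product dominates the sum over consecutive parts;
-- only nesting of loops multiplies.
exec : ∀ prot p σ → T (wf prot p) → Runs (compile p) σ (run p σ) (size p * mono p σ)

-- Induction on the number `d` of rounds to come, with `m` rounds done: the counter is `m`, so the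
-- bound `m + d` decides every test.
exec-while : ∀ prot x y p σ → T (wf prot (for x y p)) → σ nat x 0 ≡ 0 →
             ∀ d m → m + d ≡ σ nat y 0 →
             Runs (while (less (var x) (var y)) (compile p ⨾ write nat x (const 0) (incr x)))
                  (iterate x p m σ) (iterate x p (m + d) σ) (6 + d * (12 + size p * mono p σ))

iterate-counter : ∀ x p σ → writesTo p nat x ≡ false → σ nat x 0 ≡ 0 →
                  ∀ m → iterate x p m σ nat x 0 ≡ m
iterate-counter x p σ fr z zero    = z
iterate-counter x p σ fr z (suc m) =
  trans (update-same (run p (iterate x p m σ)) x _)
        (cong suc (trans (run-frame p (iterate x p m σ) nat x 0 fr) (iterate-counter x p σ fr z m)))

≢⇒false : ∀ (prot : ℕ → Bool) x y → T (prot y) → prot x ≡ false → (x ≡ᵇ y) ≡ false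
≢⇒false prot x y wy wx = ≡ᵇ-≢ {x} {y} λ { refl → subst T wx wy }

iterate-prot : ∀ prot x y p σ → T (wf prot (for x y p)) → ∀ m A → T (prot A) →
               iterate x p m σ nat A 0 ≡ σ nat A 0
iterate-prot prot x y p σ w m A t with wf-for prot x y p w
... | wy , wx , fr , wp =
  iterate-frame x p m σ nat A 0 (≢⇒false prot x A t wx) (prot-frame prot p A wp t)

<ᵇ-true : ∀ {m n} → m < n → (m <ᵇ n) ≡ true
<ᵇ-true lt = T⇒≡ (<⇒<ᵇ lt)

<ᵇ-true⁻ : ∀ {m n} → (m <ᵇ n) ≡ true → m < n
<ᵇ-true⁻ {m} {n} e = <ᵇ⇒< m n (subst T (sym e) tt)

<ᵇ-false⁻ : ∀ {m n} → (m <ᵇ n) ≡ false → n ≤ m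
<ᵇ-false⁻ e = ≮⇒≥ λ lt → subst T e (<⇒<ᵇ lt)

∧-true : ∀ {a b} → (a ∧ b) ≡ true → a ≡ true × b ≡ true
∧-true {true} {true} refl = refl , refl

<ᵇ-false : ∀ {m n} → n ≤ m → (m <ᵇ n) ≡ false
<ᵇ-false {m} {n} le with m <ᵇ n in eq
... | false = refl
... | true  = ⊥-elim (<-irrefl refl (<-≤-trans (<ᵇ⇒< m n (subst T (sym eq) tt)) le))

exec-while prot x y p σ w z zero m e rewrite +-identityʳ m
  with wf-for prot x y p w
... | wy , wx , fr , wp =
  6 , while-false (<ᵇ-false (≤-reflexive
        (trans (iterate-prot prot x y p σ w m y wy) (trans (sym e) (sym (iterate-counter x p σ fr z m)))))) ,
  ≤-refl
exec-while prot x y p σ w z (suc d) m e with wf-for prot x y p w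
... | wy , wx , fr , wp
  with exec prot p (iterate x p m σ) wp
     | exec-while prot x y p σ w z d (suc m) (trans (sym (+-suc m d)) e)
...  | t₁ , ex₁ , le₁ | t₂ , ex₂ , le₂ =
  _ ,
  while-true (<ᵇ-true (subst₂ _<_ (sym (iterate-counter x p σ fr z m))
                (sym (iterate-prot prot x y p σ w m y wy)) (subst (m <_) e (m<m+n m (s≤s z≤n)))))
    (ex₁ ⨾ write)
    (subst (λ j → Exec (while (less (var x) (var y)) (compile p ⨾ write nat x (const 0) (incr x)))
                 (iterate x p (suc m) σ) (iterate x p j σ) t₂) (sym (+-suc m d)) ex₂) ,
  time
  where
  open ≤-Reasoning
  B = size p * mono p σ
  le₁′ : t₁ ≤ B
  le₁′ = ≤-trans le₁ (≤-reflexive (cong (size p *_)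
           (mono-cong prot p wp (λ A t → iterate-prot prot x y p σ w m A t))))
  time : 6 + ((t₁ + 6) + t₂) ≤ 6 + suc d * (12 + B)
  time = +-monoʳ-≤ 6 (begin
    (t₁ + 6) + t₂                 ≤⟨ +-mono-≤ (+-monoˡ-≤ 6 le₁′) le₂ ⟩
    (B + 6) + (6 + d * (12 + B))  ≡⟨ +-assoc (B + 6) 6 _ ⟨
    (B + 6 + 6) + d * (12 + B)    ≡⟨ cong (_+ d * (12 + B)) (trans (+-assoc B 6 6) (+-comm B 12)) ⟩
    (12 + B) + d * (12 + B)       ∎)

exec prot (asg s A i e) σ w = _ , write , ≤-reflexive (sym (*-identityʳ _))
exec prot (p ∙ q) σ w
  with exec prot p σ (proj₁ (T-∧⁻ w)) | exec prot q (run p σ) (proj₂ (T-∧⁻ {wf prot p} w))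
... | t₁ , ex₁ , le₁ | t₂ , ex₂ , le₂ = _ , ex₁ ⨾ ex₂ , (begin
  t₁ + t₂                                             ≤⟨ +-mono-≤ le₁ le₂ ⟩
  size p * mono p σ + size q * mono q (run p σ)
    ≡⟨ cong (λ a → size p * mono p σ + size q * a) (mono-cong prot q (proj₂ (T-∧⁻ {wf prot p} w))
         (λ A t → run-frame p σ nat A 0 (prot-frame prot p A (proj₁ (T-∧⁻ w)) t))) ⟩
  size p * mono p σ + size q * mono q σ
    ≤⟨ +-mono-≤ (*-monoʳ-≤ (size p) (m≤m⊔n _ _)) (*-monoʳ-≤ (size q) (m≤n⊔m _ _)) ⟩
  size p * M + size q * M                             ≡⟨ *-distribʳ-+ M (size p) (size q) ⟨
  (size p + size q) * M                               ∎)
  where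
  open ≤-Reasoning
  M = mono p σ ⊔ mono q σ
exec prot (cond b p q) σ w with test σ b in eq
... | true with exec prot p σ (proj₁ (T-∧⁻ w))
...   | t , ex , le = _ , cond-true eq ex , (begin
  suc (∣ b ∣ᵗ + t)                        ≤⟨ s≤s (+-monoʳ-≤ ∣ b ∣ᵗ le) ⟩
  suc ∣ b ∣ᵗ + size p * mono p σ          ≤⟨ +-mono-≤ (m≤m*n (suc ∣ b ∣ᵗ) M {{>-nonZero M≥1}}) (*-mono-≤ (m≤m+n (size p) (size q)) (m≤m⊔n _ _)) ⟩
  suc ∣ b ∣ᵗ * M + (size p + size q) * M  ≡⟨ *-distribʳ-+ M (suc ∣ b ∣ᵗ) (size p + size q) ⟨
  suc (∣ b ∣ᵗ + (size p + size q)) * M    ∎)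
  where
  open ≤-Reasoning
  M = mono p σ ⊔ mono q σ
  M≥1 : 1 ≤ M
  M≥1 = ≤-trans (mono≥1 p σ) (m≤m⊔n _ _)
exec prot (cond b p q) σ w | false with exec prot q σ (proj₂ (T-∧⁻ {wf prot p} w))
...   | t , ex , le = _ , cond-false eq ex , (begin
  suc (∣ b ∣ᵗ + t)                        ≤⟨ s≤s (+-monoʳ-≤ ∣ b ∣ᵗ le) ⟩
  suc ∣ b ∣ᵗ + size q * mono q σ          ≤⟨ +-mono-≤ (m≤m*n (suc ∣ b ∣ᵗ) M {{>-nonZero M≥1}}) (*-mono-≤ (m≤n+m (size q) (size p)) (m≤n⊔m _ _)) ⟩
  suc ∣ b ∣ᵗ * M + (size p + size q) * M  ≡⟨ *-distribʳ-+ M (suc ∣ b ∣ᵗ) (size p + size q) ⟨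
  suc (∣ b ∣ᵗ + (size p + size q)) * M    ∎)
  where
  open ≤-Reasoning
  M = mono p σ ⊔ mono q σ
  M≥1 : 1 ≤ M
  M≥1 = ≤-trans (mono≥1 p σ) (m≤m⊔n _ _)
exec prot (for x y p) σ w with wf-for prot x y p w
... | wy , wx , fr , wp
  with exec-while prot x y p (update σ nat x 0 0) w (update-same σ x 0) (σ nat y 0) 0
                  (sym (update-frame σ nat x 0 0 nat y 0 (≢⇒false prot x y wy wx)))
...  | t , ex , le =
  _ , write ⨾ ex ,
  ≤-trans (+-monoʳ-≤ 3 (≤-trans le (≤-reflexive (cong (λ a → 6 + σ nat y 0 * (12 + size p * a))
             (mono-cong prot p wp (λ A t → update-frame σ nat x 0 0 nat A 0 (≢⇒false prot x A t wx)))))))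
          (loop-time (size p) (σ nat y 0) (mono p σ) (mono≥1 p σ))
exec prot nop σ w = 1 , skip , ≤-refl

-- Proof rules for runs.

update-hit : ∀ σ s A {i j} v → i ≡ j → update σ s A i v s A j ≡ v
update-hit σ nat A {i} v refl rewrite ≡ᵇ-refl A | ≡ᵇ-refl i = refl
update-hit σ rat A {i} v refl rewrite ≡ᵇ-refl A | ≡ᵇ-refl i = refl

update-miss : ∀ σ s A {i j} v → i ≢ j → update σ s A i v s A j ≡ σ s A j
update-miss σ nat A v ne rewrite ≡ᵇ-refl A | ≡ᵇ-≢ ne = refl
update-miss σ rat A v ne rewrite ≡ᵇ-refl A | ≡ᵇ-≢ ne = refl

-- Holds for `run p σ` by `run-frame`. Taken as a hypothesis on an arbitrary `τ`, it lets later
-- steps treat an intermediate state as a variable about which only this and an explicit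
-- postcondition are known.
Agree : Prog → State → State → Set
Agree p σ τ = ∀ s A j → writesTo p s A ≡ false → τ s A j ≡ σ s A j

cond-rule : ∀ (P : State → Set) b p q σ → (test σ b ≡ true → P (run p σ)) →
            (test σ b ≡ false → P (run q σ)) → P (run (cond b p q) σ)
cond-rule P b p q σ onTrue onFalse with test σ b
... | true  = onTrue refl
... | false = onFalse refl

-- The second premise makes `I` blind to the counter, which is reset before the first round and
-- advanced after each. The step may use that the counter is `m` and that whatever the loop does not
-- write is as at the start.
for-rule : ∀ x y p (I : ℕ → State → Set) {M} →
           writesTo p nat x ≡ false →
           (∀ m τ v → I m τ → I m (update τ nat x 0 v)) →
           ∀ σ → σ nat y 0 ≡ M → I 0 σ →
           (∀ m τ → m < M → τ nat x 0 ≡ m → Agree (for x y p) σ τ → I m τ → I (suc m) (run p τ)) →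
           I M (run (for x y p) σ)
for-rule x y p I {M} fr stable σ refl base step = go M ≤-refl
  where
  σ₀ = update σ nat x 0 0
  agree : ∀ m → Agree (for x y p) σ (iterate x p m σ₀)
  agree m s A j e with same nat x s A in eq
  ... | false = trans (iterate-frame x p m σ₀ s A j eq e) (update-frame σ nat x 0 0 s A j eq)
  go : ∀ m → m ≤ M → I m (iterate x p m σ₀)
  go zero    _  = stable 0 σ 0 base
  go (suc m) lt = stable (suc m) _ _
    (step m (iterate x p m σ₀) lt (iterate-counter x p σ₀ fr (update-same σ x 0) m) (agree m) (go m (<⇒≤ lt)))

does-true : ∀ {A : Set} (a? : Dec A) → does a? ≡ true → A
does-true (yes a) _ = a

does-false : ∀ {A : Set} (a? : Dec A) → does a? ≡ false → ¬ A
does-false (no ¬a) _ = ¬a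

less⇒< : ∀ {p q} → does (p ℚ.<? q) ≡ true → p ℚ.< q
less⇒< {p} {q} = does-true (p ℚ.<? q)

¬less⇒≥ : ∀ {p q} → does (p ℚ.<? q) ≡ false → q ℚ.≤ p
¬less⇒≥ {p} {q} e = ℚ.≮⇒≥ (does-false (p ℚ.<? q) e)

-- Interval sums and chains of parents.

-- Sums over the open interval l < i < r; the DP never counts the ends of an interval.
between : (ℕ → ℚ) → ℕ → ℕ → ℚ
between f l zero    = 0ℚ
between f l (suc r) = if l <ᵇ r then between f l r ℚ.+ f r else 0ℚ

between-step : ∀ f {l r} → l < r → between f l (suc r) ≡ between f l r ℚ.+ f r
between-step f l<r rewrite <ᵇ-true l<r = refl

between-empty : ∀ f {l r} → r ≤ suc l → between f l r ≡ 0ℚ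
between-empty f {r = zero}  _  = refl
between-empty f {r = suc r} le rewrite <ᵇ-false (s≤s⁻¹ le) = refl

between-split : ∀ f {a c b} → a < c → c < b →
                between f a b ≡ (between f a c ℚ.+ f c) ℚ.+ between f c b
between-split f {a} {c} {suc b} a<c c<b with m≤n⇒m<n∨m≡n (s≤s⁻¹ c<b)
... | inj₂ refl = begin
  between f a (suc c)                               ≡⟨ between-step f a<c ⟩
  between f a c ℚ.+ f c                             ≡⟨ ℚ.+-identityʳ _ ⟨
  (between f a c ℚ.+ f c) ℚ.+ 0ℚ                     ≡⟨ cong (between f a c ℚ.+ f c ℚ.+_) (between-empty f {c} ≤-refl) ⟨
  (between f a c ℚ.+ f c) ℚ.+ between f c (suc c)   ∎
  where open ≡-Reasoning
... | inj₁ c<b′ = begin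
  between f a (suc b)                                        ≡⟨ between-step f (<-trans a<c c<b′) ⟩
  between f a b ℚ.+ f b                                      ≡⟨ cong (ℚ._+ f b) (between-split f a<c c<b′) ⟩
  (between f a c ℚ.+ f c) ℚ.+ between f c b ℚ.+ f b           ≡⟨ ℚ.+-assoc (between f a c ℚ.+ f c) _ _ ⟩
  (between f a c ℚ.+ f c) ℚ.+ (between f c b ℚ.+ f b)         ≡⟨ cong (between f a c ℚ.+ f c ℚ.+_) (between-step f c<b′) ⟨
  (between f a c ℚ.+ f c) ℚ.+ between f c (suc b)            ∎
  where open ≡-Reasoning

between-mono : ∀ {f g l} r → (∀ i → l < i → i < r → f i ℚ.≤ g i) → between f l r ℚ.≤ between g l r
between-mono zero h = ℚ.≤-refl
between-mono {f} {g} {l} (suc r) h with l <ᵇ r in eq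
... | false = ℚ.≤-refl
... | true  = ℚ.+-mono-≤ (between-mono r (λ i l<i i<r → h i l<i (m<n⇒m<1+n i<r)))
                        (h r (<ᵇ⇒< l r (subst T (sym eq) _)) ≤-refl)

between-cong : ∀ {f g l} r → (∀ i → l < i → i < r → f i ≡ g i) → between f l r ≡ between g l r
between-cong r h = ℚ.≤-antisym (between-mono r (λ i p q → ℚ.≤-reflexive (h i p q)))
                               (between-mono r (λ i p q → ℚ.≤-reflexive (sym (h i p q))))

-- A chain of parents, with `suc u` coding the parent `u`, that stays inside the open interval until
-- it leaves through `B`. The index `h` is a hop budget: it falls by one per step, and `B h u` can
-- demand how much must be left at the exit.
data Reach (f : ℕ → ℕ) (x y : ℕ) (B : ℕ → ℕ → Set) : ℕ → ℕ → Set where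
  stop : ∀ {h i} → B h i → Reach f x y B h i
  step : ∀ {h i u} → x < i → i < y → f i ≡ suc u → Reach f x y B h u → Reach f x y B (suc h) i

-- Chains are spliced here: wherever the chain of the smaller interval leaves, a chain of the larger
-- one continues.
reach-map : ∀ {f f′ x x′ y y′ B B′} →
            (∀ i → x < i → i < y → f i ≡ f′ i) → x′ ≤ x → y ≤ y′ →
            (∀ {h u} → B h u → Reach f′ x′ y′ B′ h u) →
            ∀ {h i} → Reach f x y B h i → Reach f′ x′ y′ B′ h i
reach-map eq x≤ y≤ b (stop p) = b p
reach-map eq x≤ y≤ b (step x<i i<y e p) =
  step (≤-<-trans x≤ x<i) (<-≤-trans i<y y≤) (trans (sym (eq _ x<i i<y)) e) (reach-map eq x≤ y≤ b p)

-- Optimality of the interval recursion, for abstract distances between positions.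

module DP (N k : ℕ) (δ : ℕ → ℕ → ℚ) (terminal : ℕ → ℕ) where

  nearer : ℕ → ℕ → ℕ → ℕ
  nearer l i r = if does (δ r i ℚ.<? δ l i) then r else l

  link : ℕ → ℕ → ℕ → ℚ
  link l i r = if does (δ r i ℚ.<? δ l i) then δ r i else δ l i

  δ-nearer : ∀ l i r → δ (nearer l i r) i ≡ link l i r
  δ-nearer l i r with does (δ r i ℚ.<? δ l i)
  ... | true  = refl
  ... | false = refl

  nearer-end : ∀ l i r → nearer l i r ≡ l ⊎ nearer l i r ≡ r
  nearer-end l i r with does (δ r i ℚ.<? δ l i)
  ... | true  = inj₂ refl
  ... | false = inj₁ refl

  link≤ˡ : ∀ l i r → link l i r ℚ.≤ δ l i
  link≤ˡ l i r with does (δ r i ℚ.<? δ l i) in eq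
  ... | true  = ℚ.<⇒≤ (less⇒< {δ r i} eq)
  ... | false = ℚ.≤-refl

  link≤ʳ : ∀ l i r → link l i r ℚ.≤ δ r i
  link≤ʳ l i r with does (δ r i ℚ.<? δ l i) in eq
  ... | true  = ℚ.≤-refl
  ... | false = ¬less⇒≥ {δ r i} eq

  pay : (ℕ → ℕ) → ℕ → ℚ
  pay f i with f i
  ... | zero  = 0ℚ
  ... | suc u = δ u i

  pay-cong : ∀ {f g} i → f i ≡ g i → pay f i ≡ pay g i
  pay-cong {f} {g} i e with f i | g i | e
  ... | zero  | _ | refl = refl
  ... | suc u | _ | refl = refl

  pay-suc : ∀ f i {u} → f i ≡ suc u → pay f i ≡ δ u i
  pay-suc f i e rewrite e = refl

  pay-zero : ∀ f i → f i ≡ 0 → pay f i ≡ 0ℚ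
  pay-zero f i e rewrite e = refl

  -- The achievable half of optimality. A position that is neither terminal nor given a parent is
  -- absent and needs no chain; every other one starts with the full budget `k`, and `B` fixes what
  -- must remain when its chain leaves the interval.
  record Served (B : ℕ → ℕ → Set) (l r : ℕ) (v : ℚ) (f : ℕ → ℕ) : Set where
    constructor served
    field
      reach : ∀ i → l < i → i < r → terminal i ≢ 0 ⊎ f i ≢ 0 → Reach f l r B k i
      price : between (pay f) l r ℚ.≤ v

  open Served

  served-cong : ∀ {B l r v f g} → (∀ i → l < i → i < r → f i ≡ g i) →
                Served B l r v f → Served B l r v g
  served-cong {l = l} {r} {f = f} {g} eq s .reach i l<i i<r act =
    reach-map eq ≤-refl ≤-refl stop (s .reach i l<i i<r (act′ act))
    where
    act′ : terminal i ≢ 0 ⊎ g i ≢ 0 → terminal i ≢ 0 ⊎ f i ≢ 0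
    act′ (inj₁ t) = inj₁ t
    act′ (inj₂ n) = inj₂ (λ e → n (trans (sym (eq i l<i i<r)) e))
  served-cong {r = r} {f = f} {g} eq s .price =
    ℚ.≤-trans (between-mono r (λ i p q → ℚ.≤-reflexive (pay-cong {g} {f} i (sym (eq i p q))))) (s .price)

  -- The ends of the interval are connected already, by at most q hops.
  Ends : ℕ → ℕ → ℕ → ℕ → ℕ → Set
  Ends q l r h u = q ≤ h × (u ≡ l ⊎ u ≡ r)

  -- A partial interval (l , b) of (l , r): b lies one level deeper, l and r still serve as parents.
  Ends+ : ℕ → ℕ → ℕ → ℕ → ℕ → ℕ → Set
  Ends+ q l r b h u = Ends q l r h u ⊎ (suc q ≤ h × u ≡ b)

  -- An arbitrary competitor: label i is the depth of i, and payment i the length of its parent edge.  The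
  -- parent has a smaller label, so it cannot lie strictly inside an interval all of whose labels are ≥ label i.
  record Rival : Set where
    field
      label    : ℕ → ℕ
      payment  : ℕ → ℚ
      payment≥0 : ∀ i → 0ℚ ℚ.≤ payment i
      covers   : ∀ i → 0 < i → i < N → terminal i ≢ 0 → label i ≤ k
      pays     : ∀ {l i r} → l < i → i < r → r ≤ N → label i ≤ k →
                 (∀ u → l < u → u < r → label i ≤ label u) →
                 l ≡ 0 ⊎ label l < label i → r ≡ N ⊎ label r < label i →
                 link l i r ℚ.≤ payment i

  module _ (R : Rival) where
    open Rival R
    -- The sentinels 0 and `N` are exempt from the bound on end labels: the rivals made from trees
    -- label the copies of the root by 1, although the outermost `q` is 0.
    Inside : ℕ → ℕ → ℕ → Set
    Inside q l r = (∀ u → l < u → u < r → q < label u)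
                 × (l ≡ 0 ⊎ label l ≤ q) × (r ≡ N ⊎ label r ≤ q)

  Lower : ℕ → ℕ → ℕ → ℚ → Set
  Lower q l r v = ∀ R → Inside R q l r → v ℚ.≤ between (Rival.payment R) l r

  Lower+ : ℕ → ℕ → ℕ → ℕ → ℚ → Set
  Lower+ q l r b v = ∀ R → Inside R q l r → b ≡ r ⊎ (b < r × Rival.label R b ≡ suc q) →
                     v ℚ.≤ between (Rival.payment R) l b

  Optimal : ℕ → ℕ → ℕ → ℚ → (ℕ → ℕ) → Set
  Optimal q l r v f = Served (Ends q l r) l r v f × Lower q l r v

  Optimal+ : ℕ → ℕ → ℕ → ℕ → ℚ → (ℕ → ℕ) → Set
  Optimal+ q l r b v f = Served (Ends+ q l r b) l b v f × Lower+ q l r b v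

  optimal-cong : ∀ {q l r v f g} → (∀ i → l < i → i < r → f i ≡ g i) →
                 Optimal q l r v f → Optimal q l r v g
  optimal-cong eq (s , low) = served-cong eq s , low

  close : ∀ {q l r v f} → Optimal+ q l r r v f → Optimal q l r v f
  close {q} {l} {r} (s , low) =
    served (λ i p p′ a → reach-map (λ _ _ _ → refl) ≤-refl ≤-refl
              (λ { (inj₁ b) → stop b ; (inj₂ (le , e)) → stop (<⇒≤ le , inj₂ e) })
              (s .reach i p p′ a))
           (s .price) ,
    λ R ins → low R ins (inj₁ refl)

  fee : ℕ → ℕ → ℕ → ℚ
  fee l r i = if 0 <ᵇ terminal i then link l i r else 0ℚ

  attach : ℕ → ℕ → ℕ → ℕ
  attach l r i = if 0 <ᵇ terminal i then suc (nearer l i r) else 0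

  -- With `q + 1 = k` all interior labels are at least `k`, so a covered terminal has the least
  -- label of the interval and `pays` applies to it. Non-terminals can be left out since payments
  -- are nonnegative.
  optimal-base : ∀ {q l r v f} → suc q ≡ k → r ≤ N →
                 v ≡ between (fee l r) l r → (∀ i → l < i → i < r → f i ≡ attach l r i) →
                 Optimal q l r v f
  optimal-base {q} {l} {r} {f = f} refl r≤N refl eq =
    served reach′ (ℚ.≤-reflexive (between-cong r paid)) , low
    where
    reach′ : ∀ i → l < i → i < r → terminal i ≢ 0 ⊎ f i ≢ 0 → Reach f l r (Ends q l r) k i
    reach′ i l<i i<r act with terminal i in te | eq i l<i i<r
    reach′ i l<i i<r (inj₁ t) | zero  | e = contradiction refl t
    reach′ i l<i i<r (inj₂ t) | zero  | e = contradiction e t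
    ... | suc _ | e = step l<i i<r e (stop (≤-refl , nearer-end l i r))
    paid : ∀ i → l < i → i < r → pay f i ≡ fee l r i
    paid i l<i i<r with terminal i | eq i l<i i<r
    ... | zero  | e = pay-zero f i e
    ... | suc _ | e = trans (pay-suc f i e) (δ-nearer l i r)
    low : Lower q l r (between (fee l r) l r)
    low R (ins , bl , br) = between-mono r paid≤
      where
      open Rival R
      paid≤ : ∀ i → l < i → i < r → fee l r i ℚ.≤ payment i
      paid≤ i l<i i<r with terminal i in te
      ... | zero  = payment≥0 i
      ... | suc _ = pays l<i i<r r≤N i≤k
                      (λ u p p′ → ≤-trans i≤k (ins u p p′))
                      (Data.Sum.map₂ (λ le → ≤-<-trans le (ins i l<i i<r)) bl)
                      (Data.Sum.map₂ (λ le → ≤-<-trans le (ins i l<i i<r)) br)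
        where
        i≤k : label i ≤ k
        i≤k = covers i (≤-<-trans z≤n l<i) (<-≤-trans i<r r≤N) (λ e → 0≢1+n (trans (sym e) te))

  -- The case of no vertex on the new level before `b`: the deeper solution leaves one hop more at
  -- `l` than is asked for.
  served-first : ∀ {q l r b v f} → Served (Ends (suc q) l b) l b v f → Served (Ends+ q l r b) l b v f
  served-first s = served
    (λ i p p′ a → reach-map (λ _ _ _ → refl) ≤-refl ≤-refl
       (λ { (le , inj₁ e) → stop (inj₁ (<⇒≤ le , inj₁ e)) ; (le , inj₂ e) → stop (inj₂ (le , e)) })
       (s .reach i p p′ a))
    (s .price)

  -- A chain leaving either part through `a` has `q + 1` hops left there; the link of `a` to `l` or
  -- `r` spends one of them and leaves the `q` that these ends require.
  served-next : ∀ {q l r a b v₁ v₂ f₁ f₂ f} → suc q ≤ k → l < a → a < b →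
                Served (Ends+ q l r a) l a v₁ f₁ → Served (Ends (suc q) a b) a b v₂ f₂ →
                (∀ i → l < i → i < a → f₁ i ≡ f i) → f a ≡ suc (nearer l a r) →
                (∀ i → a < i → i < b → f₂ i ≡ f i) →
                Served (Ends+ q l r b) l b ((v₁ ℚ.+ link l a r) ℚ.+ v₂) f
  served-next {q} {l} {r} {a} {b} {v₁} {v₂} {f₁} {f₂} {f} q<k l<a a<b s₁ s₂ e₁ eₐ e₂ =
    served reach′ price′
    where
    B = Ends+ q l r b
    at-a : ∀ {h} → suc q ≤ h → Reach f l b B h a
    at-a (s≤s le) = step l<a a<b eₐ (stop (inj₁ (le , nearer-end l a r)))
    bound₁ : ∀ {h u} → Ends+ q l r a h u → Reach f l b B h u
    bound₁ (inj₁ e)           = stop (inj₁ e)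
    bound₁ (inj₂ (le , refl)) = at-a le
    bound₂ : ∀ {h u} → Ends (suc q) a b h u → Reach f l b B h u
    bound₂ (le , inj₁ refl) = at-a le
    bound₂ (le , inj₂ e)    = stop (inj₂ (le , e))
    reach′ : ∀ i → l < i → i < b → terminal i ≢ 0 ⊎ f i ≢ 0 → Reach f l b B k i
    reach′ i l<i i<b act with <-cmp i a
    ... | tri≈ _ refl _ = at-a q<k
    ... | tri< i<a _ _ = reach-map e₁ ≤-refl (<⇒≤ a<b) bound₁
      (s₁ .reach i l<i i<a (Data.Sum.map₂ (λ n e → n (trans (sym (e₁ i l<i i<a)) e)) act))
    ... | tri> _ _ a<i = reach-map e₂ (<⇒≤ l<a) ≤-refl bound₂
      (s₂ .reach i a<i i<b (Data.Sum.map₂ (λ n e → n (trans (sym (e₂ i a<i i<b)) e)) act))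
    price′ : between (pay f) l b ℚ.≤ (v₁ ℚ.+ link l a r) ℚ.+ v₂
    price′ = begin
      between (pay f) l b
        ≡⟨ between-split (pay f) l<a a<b ⟩
      (between (pay f) l a ℚ.+ pay f a) ℚ.+ between (pay f) a b
        ≤⟨ ℚ.+-mono-≤ (ℚ.+-mono-≤
             (ℚ.≤-trans (ℚ.≤-reflexive (between-cong a (λ i p p′ → pay-cong {f} {f₁} i (sym (e₁ i p p′))))) (s₁ .price))
             (ℚ.≤-reflexive (trans (pay-suc f a eₐ) (δ-nearer l a r))))
             (ℚ.≤-trans (ℚ.≤-reflexive (between-cong b (λ i p p′ → pay-cong {f} {f₂} i (sym (e₂ i p p′))))) (s₂ .price)) ⟩
      (v₁ ℚ.+ link l a r) ℚ.+ v₂ ∎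
      where open ℚ.≤-Reasoning

  -- Cutting at the last vertex of label `q + 1` leaves only larger labels on its right, an instance
  -- of the next level, while all earlier vertices of that label fall to a partial problem of the
  -- same level.
  last-label : ∀ (label : ℕ → ℕ) q l b → l < b → (∀ u → l < u → u < b → q < label u) →
               (∀ u → l < u → u < b → suc q < label u)
               ⊎ (∃ λ a → l < a × a < b × label a ≡ suc q × (∀ u → a < u → u < b → suc q < label u))
  last-label label q l (suc b) l<b ins with m≤n⇒m<n∨m≡n (s≤s⁻¹ l<b)
  ... | inj₂ refl = inj₁ λ u p p′ → contradiction (<-≤-trans p (s≤s⁻¹ p′)) (<-irrefl refl)
  ... | inj₁ l<b′ with m≤n⇒m<n∨m≡n (ins b l<b′ ≤-refl)
  ...   | inj₂ e = inj₂ (b , l<b′ , ≤-refl , sym e ,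
                         λ u p p′ → contradiction (<-≤-trans p (s≤s⁻¹ p′)) (<-irrefl refl))
  ...   | inj₁ lt with last-label label q l b l<b′ (λ u p p′ → ins u p (m<n⇒m<1+n p′))
  ...     | inj₁ all = inj₁ λ u p p′ → extend all u p p′
    where
    extend : ∀ {x} → (∀ u → x < u → u < b → suc q < label u) →
             ∀ u → x < u → u < suc b → suc q < label u
    extend all u p p′ with m≤n⇒m<n∨m≡n (s≤s⁻¹ p′)
    ... | inj₁ u<b  = all u p u<b
    ... | inj₂ refl = lt
  ...     | inj₂ (a , l<a , a<b , e , all) = inj₂ (a , l<a , m<n⇒m<1+n a<b , e , extend all)
    where
    extend : ∀ {x} → (∀ u → x < u → u < b → suc q < label u) →
             ∀ u → x < u → u < suc b → suc q < label u
    extend all u p p′ with m≤n⇒m<n∨m≡n (s≤s⁻¹ p′)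
    ... | inj₁ u<b  = all u p u<b
    ... | inj₂ refl = lt

  end : ∀ {q r b} {label : ℕ → ℕ} → b ≡ r ⊎ (b < r × label b ≡ suc q) →
        r ≡ N ⊎ label r ≤ q → b ≡ N ⊎ label b ≤ suc q
  end (inj₁ refl)    br = Data.Sum.map₂ m≤n⇒m≤1+n br
  end (inj₂ (_ , e)) br = inj₂ (≤-reflexive e)

  -- G a and H a are the values stored for the pairs (a, b) and (l, a).
  lower-next : ∀ {q l r b v} (G H : ℕ → ℚ) → suc q ≤ k → l < b → b ≤ r → r ≤ N →
               (∀ a → l ≤ a → a < b → Lower (suc q) a b (G a)) →
               (∀ a → l < a → a < b → Lower+ q l r a (H a)) →
               v ℚ.≤ G l → (∀ a → l < a → a < b → v ℚ.≤ (H a ℚ.+ link l a r) ℚ.+ G a) →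
               Lower+ q l r b v
  lower-next {q} {l} {r} {b} {v} G H q<k l<b b≤r r≤N lowG lowH first next R (ins , bl , br) eb
    with last-label (Rival.label R) q l b l<b (λ u p p′ → ins u p (<-≤-trans p′ b≤r))
  ... | inj₁ all = ℚ.≤-trans first (lowG l ≤-refl l<b R (all , Data.Sum.map₂ m≤n⇒m≤1+n bl , end {label = Rival.label R} eb br))
  ... | inj₂ (a , l<a , a<b , ea , all) = ℚ.≤-trans (next a l<a a<b) (begin
    (H a ℚ.+ link l a r) ℚ.+ G a
      ≤⟨ ℚ.+-mono-≤ (ℚ.+-mono-≤
           (lowH a l<a a<b R (ins , bl , br) (inj₂ (a<r , ea)))
           -- `pays` is applied in the whole of `(l , r)`, where `a` still has the least label; so
           -- the right candidate for its parent is `r` and not `b`.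
           (pays l<a a<r r≤N (≤-trans (≤-reflexive ea) q<k)
              (λ u p p′ → ≤-trans (≤-reflexive ea) (ins u p p′))
              (Data.Sum.map₂ below bl) (Data.Sum.map₂ below br)))
           (lowG a (<⇒≤ l<a) a<b R (all , inj₂ (≤-reflexive ea) , end {label = Rival.label R} eb br)) ⟩
    (between payment l a ℚ.+ payment a) ℚ.+ between payment a b
      ≡⟨ between-split payment l<a a<b ⟨
    between payment l b ∎)
    where
    open ℚ.≤-Reasoning
    open Rival R
    a<r = <-≤-trans a<b b≤r
    below : ∀ {m} → m ≤ q → m < label a
    below le = ≤-<-trans le (≤-reflexive (sym ea))

-- Row-major addresses, and the program of the recursion.

cell-< : ∀ {w u v m} → u < m → v < w → u * w + v < m * w
cell-< {w} {u} {v} {m} u<m v<w = begin-strict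
  u * w + v  <⟨ +-monoʳ-< (u * w) v<w ⟩
  u * w + w  ≡⟨ +-comm (u * w) w ⟩
  suc u * w  ≤⟨ *-monoˡ-≤ w u<m ⟩
  m * w      ∎
  where open ≤-Reasoning

cell-row : ∀ {w u v u′ v′} → v < w → v′ < w → u * w + v ≡ u′ * w + v′ → u ≡ u′
cell-row {w} {u} {v} {u′} {v′} v<w v′<w e with <-cmp u u′
... | tri≈ _ eq _ = eq
... | tri< lt _ _ = contradiction (<-≤-trans (cell-< {w} lt v<w) (m≤m+n (u′ * w) v′)) (<-irrefl e)
... | tri> _ _ gt = contradiction (<-≤-trans (cell-< {w} gt v′<w) (m≤m+n (u * w) v)) (<-irrefl (sym e))

cell-inj : ∀ {w u v u′ v′} → v < w → v′ < w → u * w + v ≡ u′ * w + v′ → u ≡ u′ × v ≡ v′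
cell-inj {w} {u} {v} {u′} {v′} v<w v′<w e with cell-row {w} {u} {v} {u′} {v′} v<w v′<w e
... | refl = refl , +-cancelˡ-≡ (u * w) _ _ e

-- W holds n + 2 and K₁ holds k ∸ 1.  MN and MW are the multiples of n and of n + 2, which replace
-- multiplication in addresses.  PO maps positions to vertices, Dm holds the metric.  GV holds the optimal value of
-- each interval (l , r) and PG its plan: for each position 0 if absent, and otherwise 1 + its parent's position.
-- HV and HP hold the same for the partial intervals (l , b) of the current (l , r).
W K₁ MN MW PO PG HP Lv Rc Rv Bv Av Iv Sv PR Qv : ℕ
W  = 4
K₁ = 5
MN = 7
MW = 8
PO = 10
PG = 11
HP = 12
Lv = 20
Rc = 21
Rv = 22
Bv = 23
Av = 24
Iv = 25
Sv = 26
PR = 27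
Qv = 28
Dm GV HV PW BV : ℕ
Dm = 1
GV = 2
HV = 3
PW = 4
BV = 5

rvar : ℕ → Expr rat
rvar x = read x (const 0)

at : Expr nat → Expr nat → Expr nat
at u v = add (read MW u) v

posDist : Expr nat → Expr nat → Expr rat
posDist a b = read Dm (add (read MN (read PO a)) (read PO b))

linkP : ℕ → ℕ → ℕ → Prog
linkP l i r =
  asg nat PR (const 0) (var l) ∙
  asg rat PW (const 0) (posDist (var l) (var i)) ∙
  cond (less (posDist (var r) (var i)) (rvar PW))
    (asg nat PR (const 0) (var r) ∙ asg rat PW (const 0) (posDist (var r) (var i)))
    nop

candidate : Expr rat
candidate = add (add (read HV (var Av)) (rvar PW)) (read GV (at (var Av) (var Bv)))

better : Test
better = less candidate (rvar BV)

recordP : Prog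
recordP = asg rat BV (const 0) candidate ∙ asg nat Sv (const 0) (var Av)

tryP : Prog
tryP = cond better recordP nop

splitGuard : Test
splitGuard = conj (less (var Lv) (var Av)) (less (var Av) (var Bv))

searchBody : Prog
searchBody = cond splitGuard
               (linkP Lv Av Rv ∙ tryP) nop

searchP : Prog
searchP = for Av W searchBody

-- The plan for `(l , b)` is glued at the split point `s`: the deeper plan of `(s , b)` on its
-- right, the partial plan of `(l , s)` on its left. If `s` is `l`, the cells up to `l` receive
-- values about which the plan for `(l , b)` says nothing.
copyPG copyHP setParent copyLeft : Prog
copyPG    = asg nat HP (at (var Bv) (var Iv)) (read PG (at (at (var Sv) (var Bv)) (var Iv)))
copyHP    = asg nat HP (at (var Bv) (var Iv)) (read HP (at (var Sv) (var Iv)))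
setParent = asg nat HP (at (var Bv) (var Iv)) (add (const 1) (var PR))
copyLeft  = cond (less (var Iv) (var Sv)) copyHP setParent

rowBody : Prog
rowBody = cond (less (var Sv) (var Iv)) copyPG copyLeft

rowP : Prog
rowP = for Iv W rowBody

chainGuard : Test
chainGuard = conj (less (var Lv) (var Bv)) (neg (less (var Rv) (var Bv)))

initP : Prog
initP = asg nat Sv (const 0) (var Lv) ∙ asg rat BV (const 0) (read GV (at (var Lv) (var Bv)))

keepBest : Prog
keepBest = asg rat HV (var Bv) (rvar BV)

extendP : Prog
extendP = initP ∙ searchP ∙ keepBest ∙ linkP Lv Sv Rv ∙ rowP

chainBody : Prog
chainBody = cond chainGuard extendP nop

chainP : Prog
chainP = for Bv W chainBody

storeBody : Prog
storeBody = asg nat PG (at (at (var Lv) (var Rv)) (var Iv)) (read HP (at (var Rv) (var Iv)))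

storeP : Prog
storeP = for Iv W storeBody

storeGV : Prog
storeGV = asg rat GV (at (var Lv) (var Rv)) (read HV (var Rv))

solveP : Prog
solveP = chainP ∙ storeGV ∙ storeP

-- Loops only count upwards; columns descend by mirroring the counter, from `n + 1` down to 0.
setR : Prog
setR = asg nat Rv (const 0) (sub (var W) (incr Rc))

pairBody : Prog
pairBody = setR ∙ cond (less (var Lv) (var Rv)) solveP nop

rowsBody : Prog
rowsBody = for Rc W pairBody

layerBody : Prog
layerBody = for Lv W rowsBody

layersP : Prog
layersP = for Qv K₁ layerBody

baseGuard : Test
baseGuard = conj (conj (less (var Lv) (var Iv)) (less (var Iv) (var Rv)))
                 (less (const 0) (read 1 (read PO (var Iv))))

setAttach setAbsent addFee baseBody baseRow clearSum keepSum basePair baseLine baseP : Prog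
setAttach = asg nat PG (at (at (var Lv) (var Rv)) (var Iv)) (add (const 1) (var PR))
setAbsent = asg nat PG (at (at (var Lv) (var Rv)) (var Iv)) (const 0)
addFee    = asg rat BV (const 0) (add (rvar BV) (rvar PW))
baseBody  = cond baseGuard (linkP Lv Iv Rv ∙ addFee ∙ setAttach) setAbsent
baseRow   = for Iv W baseBody
clearSum  = asg rat BV (const 0) (const 0ℚ)
keepSum   = asg rat GV (at (var Lv) (var Rv)) (rvar BV)
basePair  = clearSum ∙ baseRow ∙ keepSum
baseLine  = for Rv W basePair
baseP     = for Lv W baseLine

-- Correctness of the program of the recursion.

module Correct (N k : ℕ) (δ : ℕ → ℕ → ℚ) (terminal : ℕ → ℕ) where
  open DP N k δ terminal

  w : ℕ
  w = suc N

  Static : State → Set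
  Static σ = σ nat W 0 ≡ w
           × (∀ x → x < w * w → σ nat MW x ≡ x * w)
           × (∀ i j → i < w → j < w → σ rat Dm (σ nat MN (σ nat PO i) + σ nat PO j) ≡ δ i j)
           × (∀ i → i < w → σ nat 1 (σ nat PO i) ≡ terminal i)

  sparesStatic : Prog → Bool
  sparesStatic p = not (writesTo p nat W ∨ writesTo p nat MW ∨ writesTo p rat Dm
                        ∨ writesTo p nat MN ∨ writesTo p nat PO ∨ writesTo p nat 1)

  static-frame : ∀ p σ τ → Agree p σ τ → sparesStatic p ≡ true → Static σ → Static τ
  static-frame p σ τ ag e (sW , sM , sD , s1)
    with writesTo p nat W in a | writesTo p nat MW in b | writesTo p rat Dm in c
       | writesTo p nat MN in f | writesTo p nat PO in g | writesTo p nat 1 in h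
  ... | false | false | false | false | false | false =
    trans (ag nat W 0 a) sW ,
    (λ x lt → trans (ag nat MW x b) (sM x lt)) ,
    (λ i j li lj → trans (ag rat Dm _ c)
       (trans (cong (σ rat Dm) (cong₂ _+_ (trans (ag nat MN _ f) (cong (σ nat MN) (ag nat PO i g))) (ag nat PO j g))) (sD i j li lj))) ,
    (λ i li → trans (ag nat 1 _ h) (trans (cong (σ nat 1) (ag nat PO i g)) (s1 i li)))

  mw : ∀ σ → Static σ → ∀ {x} y → x ≡ y → y < w * w → σ nat MW x ≡ y * w
  mw σ st y refl lt = proj₁ (proj₂ st) y lt

  link-run : ∀ l i r σ → Static σ → ∀ {a c b} → σ nat l 0 ≡ a → σ nat i 0 ≡ c → σ nat r 0 ≡ b →
             a < w → c < w → b < w →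
             (PR ≡ᵇ l) ≡ false → (PR ≡ᵇ i) ≡ false → (PR ≡ᵇ r) ≡ false →
             run (linkP l i r) σ nat PR 0 ≡ nearer a c b × run (linkP l i r) σ rat PW 0 ≡ link a c b
  link-run l i r σ st {a} {c} {b} ea ec eb la lc lb l≢ i≢ r≢
    rewrite l≢ | i≢ | r≢ | ea | ec | eb
      | proj₁ (proj₂ (proj₂ st)) a c la lc | proj₁ (proj₂ (proj₂ st)) b c lb lc
      with does (δ b c ℚ.<? δ a c)
  ... | true  = refl , refl
  ... | false = refl , refl

  -- Invariant of a search for the minimum in which `s ≡ l` stands for not splitting at all and the
  -- split points below `m` have been inspected.
  record Best (l r b : ℕ) (G H : ℕ → ℚ) (m : ℕ) (v : ℚ) (s : ℕ) : Set where
    field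
      attained : (s ≡ l × v ≡ G l) ⊎ (l < s × s < b × v ≡ (H s ℚ.+ link l s r) ℚ.+ G s)
      first    : v ℚ.≤ G l
      next     : ∀ a → a < m → l < a → a < b → v ℚ.≤ (H a ℚ.+ link l a r) ℚ.+ G a

  best-keep : ∀ {l r b G H m v s} → Best l r b G H m v s →
              (l < m → m < b → v ℚ.≤ (H m ℚ.+ link l m r) ℚ.+ G m) → Best l r b G H (suc m) v s
  best-keep B h = record
    { attained = Best.attained B ; first = Best.first B ; next = next′ }
    where
    next′ : ∀ a → _ → _ → _ → _
    next′ a a<m p p′ with m≤n⇒m<n∨m≡n (s≤s⁻¹ a<m)
    ... | inj₁ lt   = Best.next B a lt p p′
    ... | inj₂ refl = h p p′

  best-replace : ∀ {l r b G H m v s v′} → Best l r b G H m v s → l < m → m < b →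
                 v′ ≡ (H m ℚ.+ link l m r) ℚ.+ G m → v′ ℚ.≤ v → Best l r b G H (suc m) v′ m
  best-replace B l<m m<b e le = record
    { attained = inj₂ (l<m , m<b , e) ; first = ℚ.≤-trans le (Best.first B) ; next = next′ }
    where
    next′ : ∀ a → _ → _ → _ → _
    next′ a a<m p p′ with m≤n⇒m<n∨m≡n (s≤s⁻¹ a<m)
    ... | inj₁ lt   = ℚ.≤-trans le (Best.next B a lt p p′)
    ... | inj₂ refl = ℚ.≤-reflexive e

  best-cong : ∀ {l r b G H G′ H′ m v s} → (∀ a → G a ≡ G′ a) → (∀ a → H a ≡ H′ a) →
              Best l r b G H m v s → Best l r b G′ H′ m v s
  best-cong {l} {r} eG eH B = record
    { attained = Data.Sum.map (λ (e , e′) → e , trans e′ (eG _)) (λ (p , p′ , e) → p , p′ , trans e (same-value _)) (Best.attained B)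
    ; first    = ℚ.≤-trans (Best.first B) (ℚ.≤-reflexive (eG l))
    ; next     = λ a p p′ p″ → ℚ.≤-trans (Best.next B a p p′ p″) (ℚ.≤-reflexive (same-value a)) }
    where
    same-value : ∀ a → _ ≡ _
    same-value a = cong₂ (λ h g → (h ℚ.+ link l a r) ℚ.+ g) (eH a) (eG a)

  try-run : ∀ {l r b G H m s} τ → τ nat Av 0 ≡ m → eval τ candidate ≡ (H m ℚ.+ link l m r) ℚ.+ G m →
            l < m → m < b → Best l r b G H m (τ rat BV 0) s → τ nat Sv 0 ≡ s →
            Best l r b G H (suc m) (run tryP τ rat BV 0) (run tryP τ nat Sv 0)
  try-run {l} {r} {b} {G} {H} τ refl value l<m m<b best refl =
    cond-rule (λ ρ → Best l r b G H (suc (τ nat Av 0)) (ρ rat BV 0) (ρ nat Sv 0)) better recordP nop τ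
      (λ lt → best-replace best l<m m<b value (ℚ.<⇒≤ (less⇒< {eval τ candidate} lt)))
      (λ ge → best-keep best λ _ _ →
         ℚ.≤-trans (¬less⇒≥ {eval τ candidate} ge) (ℚ.≤-reflexive value))

  search-run : ∀ σ {l r b} → Static σ → σ nat Lv 0 ≡ l → σ nat Rv 0 ≡ r → σ nat Bv 0 ≡ b →
               l < b → b ≤ r → r < w → σ nat Sv 0 ≡ l → σ rat BV 0 ≡ σ rat GV (l * w + b) →
               Best l r b (λ a → σ rat GV (a * w + b)) (σ rat HV) w
                    (run searchP σ rat BV 0) (run searchP σ nat Sv 0)
  search-run σ {l} {r} {b} st eL eR eB l<b b≤r r<w eS eV =
    for-rule Av W searchBody Inv refl (λ _ _ _ i → i) σ (proj₁ st) start body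
    where
    G H : ℕ → ℚ
    G a = σ rat GV (a * w + b)
    H = σ rat HV
    Inv : ℕ → State → Set
    Inv m τ = Best l r b G H m (τ rat BV 0) (τ nat Sv 0)
    start : Inv 0 σ
    start = record { attained = inj₁ (eS , eV) ; first = ℚ.≤-reflexive eV ; next = λ _ () }
    body : ∀ m τ → m < w → τ nat Av 0 ≡ m → Agree searchP σ τ → Inv m τ → Inv (suc m) (run searchBody τ)
    body m τ m<w eA ag inv =
      cond-rule (Inv (suc m)) splitGuard (linkP Lv Av Rv ∙ tryP) nop τ inside outside
      where
      eL′ = trans (ag nat Lv 0 refl) eL
      eR′ = trans (ag nat Rv 0 refl) eR
      eB′ = trans (ag nat Bv 0 refl) eB
      st′ = static-frame searchP σ τ ag refl st
      outside : test τ splitGuard ≡ false → Inv (suc m) τ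
      outside e = best-keep inv λ l<m m<b → contradiction
        (trans (sym (cong₂ _∧_ (<ᵇ-true (subst₂ _<_ (sym eL′) (sym eA) l<m))
                               (<ᵇ-true (subst₂ _<_ (sym eA) (sym eB′) m<b)))) e) λ ()
      inside : test τ splitGuard ≡ true → Inv (suc m) (run tryP (run (linkP Lv Av Rv) τ))
      inside e = continue (run (linkP Lv Av Rv) τ)
        (run-frame (linkP Lv Av Rv) τ)
        (proj₂ (link-run Lv Av Rv τ st′ eL′ eA eR′ (<-trans l<b (≤-<-trans b≤r r<w)) m<w r<w refl refl refl))
        where
        guards = ∧-true {τ nat Lv 0 <ᵇ τ nat Av 0} e
        l<m : l < m
        l<m = subst₂ _<_ eL′ eA (<ᵇ-true⁻ (proj₁ guards))
        m<b : m < b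
        m<b = subst₂ _<_ eA eB′ (<ᵇ-true⁻ (proj₂ guards))
        continue : ∀ τ₁ → Agree (linkP Lv Av Rv) τ τ₁ → τ₁ rat PW 0 ≡ link l m r → Inv (suc m) (run tryP τ₁)
        continue τ₁ fr ePW = try-run τ₁ eA₁ value l<m m<b inv₁ refl
          where
          inv₁ : Inv m τ₁
          inv₁ = subst₂ (Best l r b G H m) (sym (fr rat BV 0 refl)) (sym (fr nat Sv 0 refl)) inv
          st₁ = static-frame (linkP Lv Av Rv) τ τ₁ fr refl st′
          eA₁ = trans (fr nat Av 0 refl) eA
          eB₁ = trans (fr nat Bv 0 refl) eB′
          m<ww : m < w * w
          m<ww = <-≤-trans m<w (m≤m*n w w)
          value : eval τ₁ candidate ≡ (H m ℚ.+ link l m r) ℚ.+ G m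
          value = cong₂ ℚ._+_
            (cong₂ ℚ._+_ (trans (cong (τ₁ rat HV) eA₁) (trans (fr rat HV m refl) (ag rat HV m refl))) ePW)
            (trans (cong (τ₁ rat GV) (cong₂ _+_ (mw τ₁ st₁ m eA₁ m<ww) eB₁))
                   (trans (fr rat GV _ refl) (ag rat GV _ refl)))

  record Filled {X : Set} (base : ℕ) (entry : ℕ → X) (old : ℕ → X) (m : ℕ) (cells : ℕ → X) : Set where
    field
      written : ∀ i → i < m → cells (base + i) ≡ entry i
      kept    : ∀ x → (∀ i → i < w → x ≢ base + i) → cells x ≡ old x

  open Filled

  filled-start : ∀ {X : Set} {base} {entry : ℕ → X} {old cells} →
                 (∀ x → cells x ≡ old x) → Filled base entry old 0 cells
  filled-start e = record { written = λ _ () ; kept = λ x _ → e x }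

  filled-step : ∀ {s A base m addr v entry old} (τ : State) → m < w →
                Filled base entry old m (τ s A) → addr ≡ base + m → v ≡ entry m →
                Filled base entry old (suc m) (update τ s A addr v s A)
  filled-step {s} {A} {base} {m} {v = v} {entry} τ m<w F refl ev = record
    { written = written′
    ; kept = λ x out → trans (update-miss τ s A v (λ e → out m m<w (sym e))) (F .kept x out) }
    where
    written′ : ∀ i → i < suc m → update τ s A (base + m) v s A (base + i) ≡ entry i
    written′ i i≤m with m≤n⇒m<n∨m≡n (s≤s⁻¹ i≤m)
    ... | inj₂ refl = trans (update-hit τ s A v refl) ev
    ... | inj₁ i<m  = trans (update-miss τ s A v (λ e → <-irrefl (sym (+-cancelˡ-≡ base m i e)) i<m)) (F .written i i<m)

  ∉-row : ∀ {b b′ j} → b′ ≢ b → j < w → ∀ i → i < w → b′ * w + j ≢ b * w + i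
  ∉-row ne j<w i i<w e = ne (cell-row {w} j<w i<w e)

  at-eval : ∀ τ → Static τ → ∀ {x y} u v → x ≡ u → y ≡ v → u < w * w → τ nat MW x + y ≡ u * w + v
  at-eval τ st u v ex ey lt = cong₂ _+_ (mw τ st u ex lt) ey

  <w⇒<ww : ∀ {i} → i < w → i < w * w
  <w⇒<ww i<w = <-≤-trans i<w (m≤m*n w w)

  rowEntry : State → ℕ → ℕ → ℕ → ℕ → ℕ
  rowEntry σ s b p i =
    if s <ᵇ i then σ nat PG ((s * w + b) * w + i)
    else if i <ᵇ s then σ nat HP (s * w + i) else suc p

  entry-> : ∀ σ {s b p i} → s < i → rowEntry σ s b p i ≡ σ nat PG ((s * w + b) * w + i)
  entry-> σ s<i rewrite <ᵇ-true s<i = refl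

  entry-< : ∀ σ {s b p i} → i < s → rowEntry σ s b p i ≡ σ nat HP (s * w + i)
  entry-< σ i<s rewrite <ᵇ-false (<⇒≤ i<s) | <ᵇ-true i<s = refl

  entry-≡ : ∀ σ {s b p i} → s ≡ i → rowEntry σ s b p i ≡ suc p
  entry-≡ σ {s} refl rewrite <ᵇ-false (≤-refl {s}) = refl

  row-run : ∀ σ {s b p} → Static σ → σ nat Sv 0 ≡ s → σ nat Bv 0 ≡ b → σ nat PR 0 ≡ p → s < b → b < w →
            Filled (b * w) (rowEntry σ s b p) (σ nat HP) w (run rowP σ nat HP)
  row-run σ {s} {b} {p} st eS eB eP s<b b<w =
    for-rule Iv W rowBody (λ m τ → Filled (b * w) entry (σ nat HP) m (τ nat HP))
      refl (λ _ _ _ i → i) σ (proj₁ st) (filled-start (λ _ → refl)) body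
    where
    entry = rowEntry σ s b p
    Inv : ℕ → State → Set
    Inv m τ = Filled (b * w) entry (σ nat HP) m (τ nat HP)
    s<w = <-trans s<b b<w
    body : ∀ m τ → m < w → τ nat Iv 0 ≡ m → Agree rowP σ τ → Inv m τ → Inv (suc m) (run rowBody τ)
    body m τ m<w eI ag inv =
      cond-rule (Inv (suc m)) (less (var Sv) (var Iv)) copyPG copyLeft τ
        (λ e → filled-step τ m<w inv addr (trans valPG (sym (entry-> σ (above e)))))
        (λ e → cond-rule (Inv (suc m)) (less (var Iv) (var Sv)) copyHP setParent τ
          (λ e′ → filled-step τ m<w inv addr (trans valHP (sym (entry-< σ (subst₂ _<_ eI eS′ (<ᵇ-true⁻ e′))))))
          (λ e′ → filled-step τ m<w inv addr
             (trans (cong suc (trans (ag nat PR 0 refl) eP))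
                    (sym (entry-≡ σ (≤-antisym (subst₂ _≤_ eS′ eI (<ᵇ-false⁻ e′))
                                             (subst₂ _≤_ eI eS′ (<ᵇ-false⁻ e))))))))
      where
      eS′ = trans (ag nat Sv 0 refl) eS
      eB′ = trans (ag nat Bv 0 refl) eB
      st′ = static-frame rowP σ τ ag refl st
      above : (τ nat Sv 0 <ᵇ τ nat Iv 0) ≡ true → s < m
      above e = subst₂ _<_ eS′ eI (<ᵇ-true⁻ e)
      addr : τ nat MW (τ nat Bv 0) + τ nat Iv 0 ≡ b * w + m
      addr = at-eval τ st′ b m eB′ eI (<w⇒<ww b<w)
      valPG : τ nat PG (τ nat MW (τ nat MW (τ nat Sv 0) + τ nat Bv 0) + τ nat Iv 0) ≡ σ nat PG ((s * w + b) * w + m)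
      valPG = trans (cong (τ nat PG) (at-eval τ st′ (s * w + b) m (at-eval τ st′ s b eS′ eB′ (<w⇒<ww s<w)) eI
                                                (cell-< {w} s<w b<w)))
                    (ag nat PG _ refl)
      valHP : τ nat HP (τ nat MW (τ nat Sv 0) + τ nat Iv 0) ≡ σ nat HP (s * w + m)
      valHP = trans (cong (τ nat HP) (at-eval τ st′ s m eS′ eI (<w⇒<ww s<w)))
                    (inv .kept _ (∉-row (λ e → <-irrefl e s<b) m<w))

  Chain : ℕ → ℕ → ℕ → ℕ → (ℕ → ℚ) → (ℕ → ℕ) → Set
  Chain q l r m H P = ∀ b → b < m → l < b → b ≤ r → Optimal+ q l r b (H b) (λ i → P (b * w + i))

  Stored : ℕ → ℕ → ℕ → (ℕ → ℚ) → (ℕ → ℕ) → Set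
  Stored q a b G P = Optimal q a b (G (a * w + b)) (λ i → P ((a * w + b) * w + i))

  Layer : ℕ → ℕ → ℕ → (ℕ → ℚ) → (ℕ → ℕ) → Set
  Layer q l r G P = ∀ a b → l ≤ a → a < b → b ≤ r →
                    Stored q a b G P

  -- The search serves the two halves of optimality differently: `attained` tells how the plan is
  -- assembled, `first` and `next` bound every rival.
  chain-step : ∀ {q l r b v s} (σ : State) {H : ℕ → ℚ} {P : ℕ → ℕ} {v′ P′} → suc q ≤ k → l < b → b ≤ r → r < w →
               Layer (suc q) l r (σ rat GV) (σ nat PG) → Chain q l r b H P →
               Best l r b (λ a → σ rat GV (a * w + b)) H w v s →
               v′ ≡ v →
               (∀ i → i < w → s < i → P′ i ≡ σ nat PG ((s * w + b) * w + i)) →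
               (∀ i → i < s → P′ i ≡ P (s * w + i)) →
               P′ s ≡ suc (nearer l s r) →
               Optimal+ q l r b v′ P′
  chain-step {q} {l} {r} {b} {v} {s} σ {H} {P} {P′ = P′} q<k l<b b≤r r<w old chain best refl hi lo mid =
    go (Best.attained best) ,
    lower-next (λ a → σ rat GV (a * w + b)) H q<k l<b b≤r (s≤s⁻¹ r<w)
      (λ a l≤a a<b → proj₂ (old a b l≤a a<b b≤r))
      (λ a l<a a<b → proj₂ (chain a a<b l<a (≤-trans (<⇒≤ a<b) b≤r)))
      (Best.first best) (λ a l<a a<b → Best.next best a (<-trans a<b (≤-<-trans b≤r r<w)) l<a a<b)
    where
    go : _ → Served (Ends+ q l r b) l b v P′
    go (inj₁ (refl , refl)) = served-first (served-cong
      (λ i l<i i<b → sym (hi i (<-trans i<b (≤-<-trans b≤r r<w)) l<i)) (proj₁ (old l b ≤-refl l<b b≤r)))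
    go (inj₂ (l<s , s<b , refl)) = served-next q<k l<s s<b
      (proj₁ (chain s s<b l<s (≤-trans (<⇒≤ s<b) b≤r)))
      (proj₁ (old s b (<⇒≤ l<s) s<b b≤r))
      (λ i l<i i<s → sym (lo i i<s)) mid
      (λ i s<i i<b → sym (hi i (<-trans i<b (≤-<-trans b≤r r<w)) s<i))

  best-below : ∀ {l r b G H m v s} → l < b → Best l r b G H m v s → s < b
  best-below l<b B with Best.attained B
  ... | inj₁ (refl , _)    = l<b
  ... | inj₂ (_ , s<b , _) = s<b

  chain-extend : ∀ {q l r m H H′ P P′} → Chain q l r m H P →
                 (∀ b → b < m → H′ b ≡ H b) → (∀ b i → b < m → i < b → P′ (b * w + i) ≡ P (b * w + i)) →
                 (l < m → m ≤ r → Optimal+ q l r m (H′ m) (λ i → P′ (m * w + i))) →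
                 Chain q l r (suc m) H′ P′
  chain-extend {q} {l} {r} {H = H} {H′} {P} {P′} ch eH eP new b b≤m l<b b≤r with m≤n⇒m<n∨m≡n (s≤s⁻¹ b≤m)
  ... | inj₂ refl = new l<b b≤r
  ... | inj₁ b<m with ch b b<m l<b b≤r
  ...   | (s , low) rewrite eH b b<m = served-cong (λ i _ i<b → sym (eP b i b<m i<b)) s , low

  chain-run : ∀ σ {q l r} → suc q ≤ k → Static σ → σ nat Lv 0 ≡ l → σ nat Rv 0 ≡ r → l < r → r < w →
              Layer (suc q) l r (σ rat GV) (σ nat PG) →
              Chain q l r w (run chainP σ rat HV) (run chainP σ nat HP)
  chain-run σ {q} {l} {r} q<k st eL eR l<r r<w old =
    for-rule Bv W chainBody Inv refl (λ _ _ _ i → i) σ (proj₁ st) (λ _ ()) body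
    where
    l<w = <-trans l<r r<w
    Inv : ℕ → State → Set
    Inv m τ = Chain q l r m (τ rat HV) (τ nat HP)
    body : ∀ b τ → b < w → τ nat Bv 0 ≡ b → Agree chainP σ τ → Inv b τ → Inv (suc b) (run chainBody τ)
    body b τ b<w eB ag inv =
      cond-rule (Inv (suc b)) chainGuard extendP nop τ inside outside
      where
      eL′ = trans (ag nat Lv 0 refl) eL
      eR′ = trans (ag nat Rv 0 refl) eR
      st′ = static-frame chainP σ τ ag refl st
      outside : test τ chainGuard ≡ false → Inv (suc b) τ
      outside e = chain-extend {P = τ nat HP} {P′ = τ nat HP} inv (λ _ _ → refl) (λ _ _ _ _ → refl) λ l<b b≤r → contradiction
        (trans (sym (cong₂ _∧_ (<ᵇ-true (subst₂ _<_ (sym eL′) (sym eB) l<b))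
                               (cong not (<ᵇ-false (subst₂ _≤_ (sym eB) (sym eR′) b≤r))))) e) λ ()
      inside : test τ chainGuard ≡ true →
               Inv (suc b) (run extendP τ)
      inside e = searching (run initP τ) (run-frame initP τ) eL′
          (cong (τ rat GV) (at-eval τ st′ l b eL′ eB (<w⇒<ww l<w)))
        where
        guards = ∧-true {τ nat Lv 0 <ᵇ τ nat Bv 0} e
        l<b : l < b
        l<b = subst₂ _<_ eL′ eB (<ᵇ-true⁻ (proj₁ guards))
        b≤r : b ≤ r
        b≤r = subst₂ _≤_ eB eR′ (<ᵇ-false⁻ (T-not (subst T (sym (proj₂ guards)) _)))
        G : ℕ → ℚ
        G a = σ rat GV (a * w + b)

        searching : ∀ τ₁ → Agree initP τ τ₁ → τ₁ nat Sv 0 ≡ l → τ₁ rat BV 0 ≡ τ rat GV (l * w + b) →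
                    Inv (suc b) (run (searchP ∙ keepBest ∙ linkP Lv Sv Rv ∙ rowP) τ₁)
        searching τ₁ fr₁ eS₁ eV₁ = linking (run searchP τ₁) (run-frame searchP τ₁)
          (search-run τ₁ st₁ eL₁ eR₁ eB₁ l<b b≤r r<w eS₁ (trans eV₁ (sym (fr₁ rat GV _ refl))))
          where
          st₁ = static-frame initP τ τ₁ fr₁ refl st′
          eL₁ = trans (fr₁ nat Lv 0 refl) eL′
          eR₁ = trans (fr₁ nat Rv 0 refl) eR′
          eB₁ = trans (fr₁ nat Bv 0 refl) eB
          linking : ∀ τ₂ → Agree searchP τ₁ τ₂ →
                    Best l r b (λ a → τ₁ rat GV (a * w + b)) (τ₁ rat HV) w (τ₂ rat BV 0) (τ₂ nat Sv 0) →
                    Inv (suc b) (run (keepBest ∙ linkP Lv Sv Rv ∙ rowP) τ₂)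
          linking τ₂ fr₂ best = rowing
            (run keepBest τ₂) (run-frame keepBest τ₂)
            (run (linkP Lv Sv Rv) (run keepBest τ₂)) (run-frame (linkP Lv Sv Rv) (run keepBest τ₂))
            (update-hit τ₂ rat HV (τ₂ rat BV 0) eB₂)
            (λ x x≢b → update-miss τ₂ rat HV (τ₂ rat BV 0) (λ e′ → x≢b (trans (sym e′) eB₂)))
            (proj₁ (link-run Lv Sv Rv (run keepBest τ₂) st₃ eL₂ refl eR₂ l<w s<w r<w refl refl refl))
            where
            st₂ = static-frame searchP τ₁ τ₂ fr₂ refl st₁
            st₃ : Static (run keepBest τ₂)
            st₃ = st₂
            eL₂ = trans (fr₂ nat Lv 0 refl) eL₁
            eR₂ = trans (fr₂ nat Rv 0 refl) eR₁
            eB₂ = trans (fr₂ nat Bv 0 refl) eB₁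
            s = τ₂ nat Sv 0
            s<b = best-below l<b best
            s<w = <-trans s<b b<w
            rowing : ∀ τ₃ → Agree keepBest τ₂ τ₃ → ∀ τ₄ → Agree (linkP Lv Sv Rv) τ₃ τ₄ →
                     τ₃ rat HV b ≡ τ₂ rat BV 0 → (∀ x → x ≢ b → τ₃ rat HV x ≡ τ₂ rat HV x) →
                     τ₄ nat PR 0 ≡ nearer l s r → Inv (suc b) (run rowP τ₄)
            rowing τ₃ fr₃ τ₄ fr₄ hit miss ePR = finish (run rowP τ₄) (run-frame rowP τ₄)
              (row-run τ₄ st₄ (trans (fr₄ nat Sv 0 refl) (fr₃ nat Sv 0 refl))
                 (trans (fr₄ nat Bv 0 refl) (trans (fr₃ nat Bv 0 refl) eB₂)) ePR s<b b<w)
              where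
              st₄ = static-frame (linkP Lv Sv Rv) τ₃ τ₄ fr₄ refl
                      (static-frame keepBest τ₂ τ₃ fr₃ refl st₂)
              HP₄ : ∀ x → τ₄ nat HP x ≡ τ nat HP x
              HP₄ x = trans (fr₄ nat HP x refl) (trans (fr₃ nat HP x refl) (trans (fr₂ nat HP x refl) (fr₁ nat HP x refl)))
              PG₄ : ∀ x → τ₄ nat PG x ≡ σ nat PG x
              PG₄ x = trans (fr₄ nat PG x refl) (trans (fr₃ nat PG x refl)
                        (trans (fr₂ nat PG x refl) (trans (fr₁ nat PG x refl) (ag nat PG x refl))))
              finish : ∀ τ₅ → Agree rowP τ₄ τ₅ →
                       Filled (b * w) (rowEntry τ₄ s b (nearer l s r)) (τ₄ nat HP) w (τ₅ nat HP) → Inv (suc b) τ₅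
              finish τ₅ fr₅ F = chain-extend {P = τ nat HP} {P′ = τ₅ nat HP} inv
                (λ x x<b → trans (fr₅ rat HV x refl) (trans (fr₄ rat HV x refl) (trans (miss x (λ e → <-irrefl e x<b))
                             (trans (fr₂ rat HV x refl) (fr₁ rat HV x refl)))))
                (λ x i x<b i<x → trans (F .kept _ (∉-row (λ e → <-irrefl e x<b) (<-trans i<x (<-trans x<b b<w))))
                                        (HP₄ _))
                (λ _ _ → chain-step {q} {l} {r} {b} {τ₂ rat BV 0} {s} σ {τ rat HV} {τ nat HP} q<k l<b b≤r r<w old inv
                   best′ (trans (fr₅ rat HV b refl) (trans (fr₄ rat HV b refl) hit))
                   (λ i i<w s<i → trans (F .written i i<w) (trans (entry-> τ₄ s<i) (PG₄ _)))
                   (λ i i<s → trans (F .written i (<-trans i<s s<w)) (trans (entry-< τ₄ i<s) (HP₄ _)))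
                   (trans (F .written s s<w) (entry-≡ τ₄ {s} refl)))
                where
                best′ : Best l r b G (τ rat HV) w (τ₂ rat BV 0) s
                best′ = best-cong (λ a → trans (fr₁ rat GV _ refl) (ag rat GV _ refl)) (λ a → fr₁ rat HV a refl) best

  store-run : ∀ σ {l r} → Static σ → σ nat Lv 0 ≡ l → σ nat Rv 0 ≡ r → l < w → r < w →
              Filled ((l * w + r) * w) (λ i → σ nat HP (r * w + i)) (σ nat PG) w (run storeP σ nat PG)
  store-run σ {l} {r} st eL eR l<w r<w =
    for-rule Iv W storeBody (λ m τ → Filled ((l * w + r) * w) entry (σ nat PG) m (τ nat PG))
      refl (λ _ _ _ i → i) σ (proj₁ st) (filled-start (λ _ → refl)) body
    where
    entry : ℕ → ℕ
    entry i = σ nat HP (r * w + i)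
    body : ∀ m τ → m < w → τ nat Iv 0 ≡ m → Agree storeP σ τ →
           Filled ((l * w + r) * w) entry (σ nat PG) m (τ nat PG) →
           Filled ((l * w + r) * w) entry (σ nat PG) (suc m) (run storeBody τ nat PG)
    body m τ m<w eI ag inv = filled-step τ m<w inv
      (at-eval τ st′ (l * w + r) m (at-eval τ st′ l r eL′ eR′ (<w⇒<ww l<w)) eI (cell-< {w} l<w r<w))
      (trans (cong (τ nat HP) (at-eval τ st′ r m eR′ eI (<w⇒<ww r<w))) (ag nat HP _ refl))
      where
      st′ = static-frame storeP σ τ ag refl st
      eL′ = trans (ag nat Lv 0 refl) eL
      eR′ = trans (ag nat Rv 0 refl) eR

  -- The layer is rebuilt in place, rows l ascending and columns descending from N, so that
  -- the intervals inside (l , r) still hold their values of depth q + 1.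
  Mixed : ℕ → ℕ → ℕ → (ℕ → ℚ) → (ℕ → ℕ) → Set
  Mixed q l r G P = ∀ a b → a < b → b < w →
      (a < l ⊎ (a ≡ l × r ≤ b) → Stored q a b G P)
    × (l < a ⊎ (a ≡ l × b < r) → Stored (suc q) a b G P)

  Table : ℕ → (ℕ → ℚ) → (ℕ → ℕ) → Set
  Table q G P = ∀ a b → a < b → b < w → Stored q a b G P

  mixed-skip : ∀ {q l r G P} → r ≤ l → Mixed q l (suc r) G P → Mixed q l r G P
  mixed-skip {l = l} r≤l M a b a<b b<w = done , undone
    where
    done : _ → _
    done (inj₁ lt) = proj₁ (M a b a<b b<w) (inj₁ lt)
    done (inj₂ (refl , _)) = proj₁ (M a b a<b b<w) (inj₂ (refl , ≤-<-trans r≤l a<b))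
    undone : _ → _
    undone (inj₁ lt) = proj₂ (M a b a<b b<w) (inj₁ lt)
    undone (inj₂ (refl , lt)) = proj₂ (M a b a<b b<w) (inj₂ (refl , m<n⇒m<1+n lt))

  Update : ℕ → ℕ → (ℕ → ℚ) → (ℕ → ℕ) → (ℕ → ℚ) → (ℕ → ℕ) → Set
  Update l r G P G′ P′ = (∀ x → x ≢ l * w + r → G′ x ≡ G x)
                       × (∀ x → (∀ i → i < w → x ≢ (l * w + r) * w + i) → P′ x ≡ P x)

  stored-keep : ∀ {q a b l r G P G′ P′} → Update l r G P G′ P′ → b < w → r < w → a ≢ l ⊎ b ≢ r →
                Stored q a b G P → Stored q a b G′ P′
  stored-keep {q} {a} {b} {l} {r} (eG , eP) b<w r<w ne o =
    subst (λ v → Optimal q a b v _) (sym (eG _ cell≢))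
      (optimal-cong (λ i _ i<b → sym (eP _ (∉-row cell≢ (<-trans i<b b<w)))) o)
    where
    cell≢ : a * w + b ≢ l * w + r
    cell≢ e = Data.Sum.[ (λ na → na (proj₁ (cell-inj {w} {a} {b} {l} {r} b<w r<w e))) ,
                         (λ nb → nb (proj₂ (cell-inj {w} {a} {b} {l} {r} b<w r<w e))) ] ne

  mixed-store : ∀ {q l r} G P G′ P′ → r < w → Mixed q l (suc r) G P →
                Stored q l r G′ P′ → Update l r G P G′ P′ → Mixed q l r G′ P′
  mixed-store {q} {l} {r} G P G′ P′ r<w M new upd a b a<b b<w = done , undone
    where
    keep : ∀ {q′} → a ≢ l ⊎ b ≢ r → Stored q′ a b G P → Stored q′ a b G′ P′
    keep = stored-keep {l = l} {r} {G} {P} {G′} {P′} upd b<w r<w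
    done : _ → _
    done (inj₁ lt) = keep (inj₁ (<⇒≢ lt)) (proj₁ (M a b a<b b<w) (inj₁ lt))
    done (inj₂ (refl , r≤b)) with m≤n⇒m<n∨m≡n r≤b
    ... | inj₁ r<b  = keep (inj₂ (≢-sym (<⇒≢ r<b))) (proj₁ (M a b a<b b<w) (inj₂ (refl , r<b)))
    ... | inj₂ refl = new
    undone : _ → _
    undone (inj₁ lt) = keep (inj₁ (≢-sym (<⇒≢ lt))) (proj₂ (M a b a<b b<w) (inj₁ lt))
    undone (inj₂ (refl , lt)) =
      keep (inj₂ (<⇒≢ lt)) (proj₂ (M a b a<b b<w) (inj₂ (refl , m<n⇒m<1+n lt)))

  solve-run : ∀ σ {q l r} → suc q ≤ k → Static σ → σ nat Lv 0 ≡ l → σ nat Rv 0 ≡ r → l < r → r < w →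
              Mixed q l (suc r) (σ rat GV) (σ nat PG) →
              Mixed q l r (run solveP σ rat GV) (run solveP σ nat PG)
  solve-run σ {q} {l} {r} q<k st eL eR l<r r<w M =
    storing (run chainP σ) (run-frame chainP σ)
      (chain-run σ q<k st eL eR l<r r<w old r r<w l<r ≤-refl)
    where
    l<w = <-trans l<r r<w
    old : Layer (suc q) l r (σ rat GV) (σ nat PG)
    old a b l≤a a<b b≤r with m≤n⇒m<n∨m≡n l≤a
    ... | inj₁ l<a  = proj₂ (M a b a<b (≤-<-trans b≤r r<w)) (inj₁ l<a)
    ... | inj₂ refl = proj₂ (M a b a<b (≤-<-trans b≤r r<w)) (inj₂ (refl , s≤s b≤r))
    storing : ∀ τ₁ → Agree chainP σ τ₁ → Optimal+ q l r r (τ₁ rat HV r) (λ i → τ₁ nat HP (r * w + i)) →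
              Mixed q l r (run (storeGV ∙ storeP) τ₁ rat GV) (run (storeGV ∙ storeP) τ₁ nat PG)
    storing τ₁ fr₁ opt = finish (run storeGV τ₁) (run-frame storeGV τ₁)
        (trans (update-hit τ₁ rat GV _ addr) (cong (τ₁ rat HV) eR₁))
        (λ x ne → update-miss τ₁ rat GV _ (λ e → ne (trans (sym e) addr)))
      where
      st₁ = static-frame chainP σ τ₁ fr₁ refl st
      eL₁ = trans (fr₁ nat Lv 0 refl) eL
      eR₁ = trans (fr₁ nat Rv 0 refl) eR
      addr : τ₁ nat MW (τ₁ nat Lv 0) + τ₁ nat Rv 0 ≡ l * w + r
      addr = at-eval τ₁ st₁ l r eL₁ eR₁ (<w⇒<ww l<w)
      finish : ∀ τ₂ → Agree storeGV τ₁ τ₂ → τ₂ rat GV (l * w + r) ≡ τ₁ rat HV r →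
               (∀ x → x ≢ l * w + r → τ₂ rat GV x ≡ τ₁ rat GV x) →
               Mixed q l r (run storeP τ₂ rat GV) (run storeP τ₂ nat PG)
      finish τ₂ fr₂ hit miss = conclude (run storeP τ₂) (run-frame storeP τ₂)
          (store-run τ₂ (static-frame storeGV τ₁ τ₂ fr₂ refl st₁)
             (trans (fr₂ nat Lv 0 refl) eL₁) (trans (fr₂ nat Rv 0 refl) eR₁) l<w r<w)
        where
        conclude : ∀ τ₃ → Agree storeP τ₂ τ₃ →
                   Filled ((l * w + r) * w) (λ i → τ₂ nat HP (r * w + i)) (τ₂ nat PG) w (τ₃ nat PG) →
                   Mixed q l r (τ₃ rat GV) (τ₃ nat PG)
        conclude τ₃ fr₃ F = mixed-store (σ rat GV) (σ nat PG) (τ₃ rat GV) (τ₃ nat PG) r<w M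
          (subst (λ v → Optimal q l r v _) (sym (trans (fr₃ rat GV _ refl) hit))
             (optimal-cong (λ i _ i<r → sym (trans (F .written i (<-trans i<r r<w)) (fr₂ nat HP _ refl))) (close opt)))
          ((λ x ne → trans (fr₃ rat GV x refl) (trans (miss x ne) (fr₁ rat GV x refl))) ,
           (λ x out → trans (F .kept x out) (trans (fr₂ nat PG x refl) (fr₁ nat PG x refl))))

  pair-run : ∀ σ {q l m} → suc q ≤ k → Static σ → σ nat Lv 0 ≡ l → σ nat Rc 0 ≡ m → m < w →
             Mixed q l (w ∸ m) (σ rat GV) (σ nat PG) →
             Mixed q l (w ∸ suc m) (run pairBody σ rat GV) (run pairBody σ nat PG)
  pair-run σ {q} {l} {m} q<k st eL eC m<w M = deciding (run setR σ) (run-frame setR σ)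
      (cong₂ _∸_ (proj₁ st) (cong suc eC))
    where
    r = w ∸ suc m
    M′ : Mixed q l (suc r) (σ rat GV) (σ nat PG)
    M′ = subst (λ x → Mixed q l x (σ rat GV) (σ nat PG)) (+-∸-assoc 1 (s≤s⁻¹ m<w)) M
    deciding : ∀ τ → Agree setR σ τ → τ nat Rv 0 ≡ r →
               Mixed q l r (run (cond (less (var Lv) (var Rv)) solveP nop) τ rat GV)
                           (run (cond (less (var Lv) (var Rv)) solveP nop) τ nat PG)
    deciding τ fr eR = cond-rule (λ ρ → Mixed q l r (ρ rat GV) (ρ nat PG)) (less (var Lv) (var Rv)) solveP nop τ
      (λ e → solve-run τ q<k st₁ eL₁ eR (subst₂ _<_ eL₁ eR (<ᵇ-true⁻ e)) (s≤s (m∸n≤m N m)) M₁)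
      (λ e → mixed-skip {G = τ rat GV} {τ nat PG} (subst₂ _≤_ eR eL₁ (<ᵇ-false⁻ e)) M₁)
      where
      st₁ = static-frame setR σ τ fr refl st
      eL₁ = trans (fr nat Lv 0 refl) eL
      M₁ : Mixed q l (suc r) (τ rat GV) (τ nat PG)
      M₁ a b a<b b<w rewrite fr rat GV (a * w + b) refl =
        (λ d → optimal-cong (λ i _ _ → sym (fr nat PG _ refl)) (proj₁ (M′ a b a<b b<w) d)) ,
        (λ d → optimal-cong (λ i _ _ → sym (fr nat PG _ refl)) (proj₂ (M′ a b a<b b<w) d))

  rows-run : ∀ σ {q l} → suc q ≤ k → Static σ → σ nat Lv 0 ≡ l →
             Mixed q l w (σ rat GV) (σ nat PG) → Mixed q l 0 (run rowsBody σ rat GV) (run rowsBody σ nat PG)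
  rows-run σ {q} {l} q<k st eL M =
    subst (λ x → Mixed q l x (run rowsBody σ rat GV) (run rowsBody σ nat PG)) (n∸n≡0 w)
      (for-rule Rc W pairBody (λ m τ → Mixed q l (w ∸ m) (τ rat GV) (τ nat PG)) refl (λ _ _ _ i → i) σ (proj₁ st) M
        (λ m τ m<w eC ag inv → pair-run τ q<k (static-frame rowsBody σ τ ag refl st)
                                 (trans (ag nat Lv 0 refl) eL) eC m<w inv))

  layer-run : ∀ σ {q} → suc q ≤ k → Static σ →
              Table (suc q) (σ rat GV) (σ nat PG) → Table q (run layerBody σ rat GV) (run layerBody σ nat PG)
  layer-run σ {q} q<k st T a b a<b b<w =
    proj₁ (for-rule Lv W rowsBody (λ l τ → Mixed q l w (τ rat GV) (τ nat PG)) refl (λ _ _ _ i → i) σ (proj₁ st) start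
      (λ l τ l<w eL ag inv → next (run rowsBody τ)
         (rows-run τ q<k (static-frame layerBody σ τ ag refl st) eL inv))
      a b a<b b<w)
      (inj₁ (<-trans a<b b<w))
    where
    start : Mixed q 0 w (σ rat GV) (σ nat PG)
    start a b a<b b<w = (λ { (inj₂ (_ , w≤b)) → contradiction (<-≤-trans b<w w≤b) (<-irrefl refl) }) ,
                        (λ _ → T a b a<b b<w)
    next : ∀ {l} τ → Mixed q l 0 (τ rat GV) (τ nat PG) → Mixed q (suc l) w (τ rat GV) (τ nat PG)
    next {l} τ M a b a<b b<w = done , undone
      where
      done : _ → _
      done (inj₂ (_ , w≤b)) = contradiction (<-≤-trans b<w w≤b) (<-irrefl refl)
      done (inj₁ a≤l) with m≤n⇒m<n∨m≡n (s≤s⁻¹ a≤l)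
      ... | inj₁ a<l  = proj₁ (M a b a<b b<w) (inj₁ a<l)
      ... | inj₂ refl = proj₁ (M a b a<b b<w) (inj₂ (refl , z≤n))
      undone : _ → _
      undone (inj₁ lt)         = proj₂ (M a b a<b b<w) (inj₁ (<⇒≤ lt))
      undone (inj₂ (refl , _)) = proj₂ (M a b a<b b<w) (inj₁ ≤-refl)

  layers-run : ∀ σ {k₁} → k ≡ suc k₁ → Static σ → σ nat K₁ 0 ≡ k₁ →
               Table k₁ (σ rat GV) (σ nat PG) → Table 0 (run layersP σ rat GV) (run layersP σ nat PG)
  layers-run σ {k₁} refl st eK T =
    subst (λ q → Table q (run layersP σ rat GV) (run layersP σ nat PG)) (n∸n≡0 k₁)
      (for-rule Qv K₁ layerBody (λ m τ → Table (k₁ ∸ m) (τ rat GV) (τ nat PG)) refl (λ _ _ _ i → i) σ eK T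
        (λ m τ m<k _ ag inv → layer-run τ (s≤s (m∸n≤m k₁ (suc m)))
           (static-frame layersP σ τ ag refl st)
           (subst (λ q → Table q (τ rat GV) (τ nat PG)) (sym (suc-∸-suc m<k)) inv)))
    where
    suc-∸-suc : ∀ {m n} → m < n → suc (n ∸ suc m) ≡ n ∸ m
    suc-∸-suc {zero}  (s≤s _)  = refl
    suc-∸-suc {suc m} (s≤s lt) = suc-∸-suc lt

  baseEntry : ℕ → ℕ → ℕ → ℕ
  baseEntry l r i = if ((l <ᵇ i) ∧ (i <ᵇ r)) ∧ (0 <ᵇ terminal i) then suc (nearer l i r) else 0

  baseEntry-attach : ∀ {l r i} → l < i → i < r → baseEntry l r i ≡ attach l r i
  baseEntry-attach l<i i<r rewrite <ᵇ-true l<i | <ᵇ-true i<r = refl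

  -- The loop runs over the whole line while the sum stops before `r`, hence the cut-off `m ⊓ r`. Up
  -- to `l` both sums are empty, from `r` on both are complete, and in between a non-terminal is
  -- free.
  fees-stay : ∀ {l r} m → ((l <ᵇ m) ∧ (m <ᵇ r)) ∧ (0 <ᵇ terminal m) ≡ false →
              between (fee l r) l (m ⊓ r) ≡ between (fee l r) l (suc m ⊓ r)
  fees-stay {l} {r} m e with <-≤-connex m r
  ... | inj₂ r≤m rewrite m≥n⇒m⊓n≡n r≤m | m≥n⇒m⊓n≡n (m≤n⇒m≤1+n r≤m) = refl
  ... | inj₁ m<r rewrite m≤n⇒m⊓n≡m (<⇒≤ m<r) | m≤n⇒m⊓n≡m m<r with <-≤-connex l m
  ...   | inj₂ m≤l = trans (between-empty (fee l r) (m≤n⇒m≤1+n m≤l)) (sym (between-empty (fee l r) (s≤s m≤l)))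
  ...   | inj₁ l<m = sym (trans (between-step (fee l r) l<m)
                             (trans (cong (between (fee l r) l m ℚ.+_) (free l<m e)) (ℚ.+-identityʳ _)))
    where
    free : l < m → ((l <ᵇ m) ∧ (m <ᵇ r)) ∧ (0 <ᵇ terminal m) ≡ false → fee l r m ≡ 0ℚ
    free lt e′ rewrite <ᵇ-true lt | <ᵇ-true m<r | e′ = refl

  fees-grow : ∀ {l r} m → l < m → m < r → (0 <ᵇ terminal m) ≡ true →
              between (fee l r) l (m ⊓ r) ℚ.+ link l m r ≡ between (fee l r) l (suc m ⊓ r)
  fees-grow {l} {r} m l<m m<r t rewrite m≤n⇒m⊓n≡m (<⇒≤ m<r) | m≤n⇒m⊓n≡m m<r =
    sym (trans (between-step (fee l r) l<m) (cong (between (fee l r) l m ℚ.+_) charged))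
    where
    charged : fee l r m ≡ link l m r
    charged rewrite t = refl

  baseRow-run : ∀ σ {l r} → Static σ → σ nat Lv 0 ≡ l → σ nat Rv 0 ≡ r → l < w → r < w → σ rat BV 0 ≡ 0ℚ →
                Filled ((l * w + r) * w) (baseEntry l r) (σ nat PG) w (run baseRow σ nat PG)
                × run baseRow σ rat BV 0 ≡ between (fee l r) l (w ⊓ r)
  baseRow-run σ {l} {r} st eL eR l<w r<w eV =
    for-rule Iv W baseBody Inv refl (λ _ _ _ i → i) σ (proj₁ st) (filled-start (λ _ → refl) , eV) body
    where
    Inv : ℕ → State → Set
    Inv m τ = Filled ((l * w + r) * w) (baseEntry l r) (σ nat PG) m (τ nat PG)
            × τ rat BV 0 ≡ between (fee l r) l (m ⊓ r)
    address : ∀ m τ → Static τ → τ nat Lv 0 ≡ l → τ nat Rv 0 ≡ r → τ nat Iv 0 ≡ m →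
              τ nat MW (τ nat MW (τ nat Lv 0) + τ nat Rv 0) + τ nat Iv 0 ≡ (l * w + r) * w + m
    address m τ st′ eL′ eR′ eI =
      at-eval τ st′ (l * w + r) m (at-eval τ st′ l r eL′ eR′ (<w⇒<ww l<w)) eI (cell-< {w} l<w r<w)
    body : ∀ m τ → m < w → τ nat Iv 0 ≡ m → Agree baseRow σ τ → Inv m τ → Inv (suc m) (run baseBody τ)
    body m τ m<w eI ag (F , sum) =
      cond-rule (Inv (suc m)) baseGuard (linkP Lv Iv Rv ∙ addFee ∙ setAttach) setAbsent τ
        inside
        (λ e → filled-step τ m<w F (address m τ st′ eL′ eR′ eI) (sym (absent (trans (sym guard) e))) ,
               trans sum (fees-stay {l} {r} m (trans (sym guard) e)))
      where
      st′ = static-frame baseRow σ τ ag refl st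
      eL′ = trans (ag nat Lv 0 refl) eL
      eR′ = trans (ag nat Rv 0 refl) eR
      guard : test τ baseGuard ≡ ((l <ᵇ m) ∧ (m <ᵇ r)) ∧ (0 <ᵇ terminal m)
      guard = cong₂ _∧_ (cong₂ _∧_ (cong₂ _<ᵇ_ eL′ eI) (cong₂ _<ᵇ_ eI eR′))
                        (cong (0 <ᵇ_) (trans (cong (λ x → τ nat 1 (τ nat PO x)) eI) (proj₂ (proj₂ (proj₂ st′)) m m<w)))
      absent : ((l <ᵇ m) ∧ (m <ᵇ r)) ∧ (0 <ᵇ terminal m) ≡ false → baseEntry l r m ≡ 0
      absent e rewrite e = refl
      present : ((l <ᵇ m) ∧ (m <ᵇ r)) ∧ (0 <ᵇ terminal m) ≡ true → baseEntry l r m ≡ suc (nearer l m r)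
      present e rewrite e = refl
      inside : test τ baseGuard ≡ true → Inv (suc m) (run (linkP Lv Iv Rv ∙ addFee ∙ setAttach) τ)
      inside e = attaching (run (linkP Lv Iv Rv) τ) (run-frame (linkP Lv Iv Rv) τ)
                   (link-run Lv Iv Rv τ st′ eL′ eI eR′ l<w m<w r<w refl refl refl)
        where
        e′ = trans (sym guard) e
        guards = ∧-true {(l <ᵇ m) ∧ (m <ᵇ r)} e′
        l<m = <ᵇ-true⁻ (proj₁ (∧-true {l <ᵇ m} (proj₁ guards)))
        m<r = <ᵇ-true⁻ (proj₂ (∧-true {l <ᵇ m} (proj₁ guards)))
        attaching : ∀ τ₁ → Agree (linkP Lv Iv Rv) τ τ₁ → τ₁ nat PR 0 ≡ nearer l m r × τ₁ rat PW 0 ≡ link l m r →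
                    Inv (suc m) (run (addFee ∙ setAttach) τ₁)
        attaching τ₁ fr (ePR , ePW) =
          filled-step τ₁ m<w
            (record { written = λ i i<m → trans (fr nat PG _ refl) (F .written i i<m)
                    ; kept = λ x out → trans (fr nat PG x refl) (F .kept x out) })
            (address m τ₁ (static-frame (linkP Lv Iv Rv) τ τ₁ fr refl st′)
               (trans (fr nat Lv 0 refl) eL′) (trans (fr nat Rv 0 refl) eR′) (trans (fr nat Iv 0 refl) eI))
            (trans (cong suc ePR) (sym (present e′))) ,
          trans (cong₂ ℚ._+_ (trans (fr rat BV 0 refl) sum) ePW) (fees-grow {l} {r} m l<m m<r (proj₂ guards))

  Prefix : ℕ → ℕ → ℕ → (ℕ → ℚ) → (ℕ → ℕ) → Set
  Prefix q l m G P = ∀ a b → a < b → b < w → a < l ⊎ (a ≡ l × b < m) →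
                     Stored q a b G P

  prefix-store : ∀ {q l r} G P G′ P′ → r < w → Prefix q l r G P →
                 (l < r → Stored q l r G′ P′) → Update l r G P G′ P′ → Prefix q l (suc r) G′ P′
  prefix-store {q} {l} {r} G P G′ P′ r<w old new upd a b a<b b<w = split
    where
    keep : a ≢ l ⊎ b ≢ r → Stored q a b G P → Stored q a b G′ P′
    keep = stored-keep {l = l} {r} {G} {P} {G′} {P′} upd b<w r<w
    split : _ → _
    split (inj₁ lt) = keep (inj₁ (<⇒≢ lt)) (old a b a<b b<w (inj₁ lt))
    split (inj₂ (refl , b≤r)) with m≤n⇒m<n∨m≡n (s≤s⁻¹ b≤r)
    ... | inj₁ b<r  = keep (inj₂ (<⇒≢ b<r)) (old a b a<b b<w (inj₂ (refl , b<r)))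
    ... | inj₂ refl = new a<b

  basePair-run : ∀ σ {k₁ l r} → suc k₁ ≡ k → Static σ → σ nat Lv 0 ≡ l → σ nat Rv 0 ≡ r → l < w → r < w →
                 Prefix k₁ l r (σ rat GV) (σ nat PG) →
                 Prefix k₁ l (suc r) (run basePair σ rat GV) (run basePair σ nat PG)
  basePair-run σ {k₁} {l} {r} ek st eL eR l<w r<w old =
    summing (run clearSum σ) (run-frame clearSum σ) refl
    where
    summing : ∀ τ → Agree clearSum σ τ → τ rat BV 0 ≡ 0ℚ →
              Prefix k₁ l (suc r) (run (baseRow ∙ keepSum) τ rat GV) (run (baseRow ∙ keepSum) τ nat PG)
    summing τ fr e = keeping (run baseRow τ) (run-frame baseRow τ)
        (baseRow-run τ st₁ (trans (fr nat Lv 0 refl) eL) (trans (fr nat Rv 0 refl) eR) l<w r<w e)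
      where
      st₁ = static-frame clearSum σ τ fr refl st
      keeping : ∀ τ₁ → Agree baseRow τ τ₁ →
                Filled ((l * w + r) * w) (baseEntry l r) (τ nat PG) w (τ₁ nat PG)
                × τ₁ rat BV 0 ≡ between (fee l r) l (w ⊓ r) →
                Prefix k₁ l (suc r) (run keepSum τ₁ rat GV) (run keepSum τ₁ nat PG)
      keeping τ₁ fr₁ (F , sum) = prefix-store (σ rat GV) (σ nat PG) (run keepSum τ₁ rat GV) (τ₁ nat PG) r<w old
          (λ l<r → optimal-base ek (s≤s⁻¹ r<w)
             (trans (update-hit τ₁ rat GV _ addr) (trans sum (cong (between (fee l r) l) (m≥n⇒m⊓n≡n (<⇒≤ r<w)))))
             (λ i l<i i<r → trans (F .written i (<-trans i<r r<w)) (baseEntry-attach l<i i<r)))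
          ((λ x ne → trans (update-miss τ₁ rat GV _ (λ e′ → ne (trans (sym e′) addr)))
                           (trans (fr₁ rat GV x refl) (fr rat GV x refl))) ,
           (λ x out → trans (F .kept x out) (fr nat PG x refl)))
        where
        addr : τ₁ nat MW (τ₁ nat Lv 0) + τ₁ nat Rv 0 ≡ l * w + r
        addr = at-eval τ₁ (static-frame baseRow τ τ₁ fr₁ refl st₁) l r
                 (trans (fr₁ nat Lv 0 refl) (trans (fr nat Lv 0 refl) eL))
                 (trans (fr₁ nat Rv 0 refl) (trans (fr nat Rv 0 refl) eR)) (<w⇒<ww l<w)

  base-run : ∀ σ {k₁} → suc k₁ ≡ k → Static σ → Table k₁ (run baseP σ rat GV) (run baseP σ nat PG)
  base-run σ {k₁} ek st a b a<b b<w =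
    for-rule Lv W baseLine (λ l τ → Prefix k₁ l 0 (τ rat GV) (τ nat PG)) refl (λ _ _ _ i → i) σ (proj₁ st)
      (λ { _ _ _ _ (inj₁ ()) ; _ _ _ _ (inj₂ (_ , ())) })
      (λ l τ l<w eL ag inv → next (run baseLine τ)
         (for-rule Rv W basePair (λ m ρ → Prefix k₁ l m (ρ rat GV) (ρ nat PG)) refl (λ _ _ _ i → i) τ
            (proj₁ (st₁ τ ag)) inv
            (λ m ρ m<w eR ag′ inv′ → basePair-run ρ ek
               (static-frame baseLine τ ρ ag′ refl (st₁ τ ag))
               (trans (ag′ nat Lv 0 refl) eL) eR l<w m<w inv′)))
      a b a<b b<w (inj₁ (<-trans a<b b<w))
    where
    st₁ : ∀ τ → Agree baseP σ τ → Static τ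
    st₁ τ ag = static-frame baseP σ τ ag refl st
    next : ∀ {l} τ → Prefix k₁ l w (τ rat GV) (τ nat PG) → Prefix k₁ (suc l) 0 (τ rat GV) (τ nat PG)
    next {l} τ pre a b a<b b<w (inj₁ a≤l) with m≤n⇒m<n∨m≡n (s≤s⁻¹ a≤l)
    ... | inj₁ a<l  = pre a b a<b b<w (inj₁ a<l)
    ... | inj₂ refl = pre a b a<b b<w (inj₂ (refl , b<w))

-- Geometry of path metrics.

module _ {n : ℕ} {d : DistanceFunction (Fin n)} (isMetric : IsMetric _≡_ d) where

  private module M = IsMetric isMetric

  distinct-positive : ∀ {u v} → u ≢ v → 0ℚ ℚ.< d u v
  distinct-positive {u} {v} ne with ℚ.<-cmp 0ℚ (d u v)
  ... | Relation.Binary.tri< lt _ _ = lt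
  ... | Relation.Binary.tri≈ _ e _  = contradiction (M.0⇒≈ (sym e)) ne
  ... | Relation.Binary.tri> _ _ gt = contradiction (ℚ.<-≤-trans gt M.nonNegative) (ℚ.<-irrefl refl)

  edge-bound : ∀ (G : Graph n) → Induces G d → ∀ {u v w} → weight G u v ≡ just w → d u v ℚ.≤ w
  edge-bound G ind {u} {v} {w} e =
    ℚ.≤-trans (proj₂ (ind u v) record { walk = (w , e) ◅ ε ; simple = (u≢v ∷ []) ∷ [] ∷ [] })
              (ℚ.≤-reflexive (ℚ.+-identityʳ w))
    where
    u≢v : u ≢ v
    u≢v refl with trans (sym e) (loopless G u)
    ... | ()

  walk-bound : ∀ (G : Graph n) → Induces G d → ∀ {u v} (p : Star (Edge G) u v) → d u v ℚ.≤ length G p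
  walk-bound G ind ε = ℚ.≤-reflexive (M.≈⇒0 refl)
  walk-bound G ind (_◅_ {i = u} {j = x} {k = v} (w , e) p) =
    ℚ.≤-trans (M.triangle u x v) (ℚ.+-mono-≤ (edge-bound G ind e) (walk-bound G ind p))

  -- Together with the triangle inequality this says that `d` is additive along the order.
  Line : Permutation′ n → Set
  Line π = ∀ x v y → toℕ (π ⟨$⟩ʳ x) ≤ toℕ (π ⟨$⟩ʳ v) → toℕ (π ⟨$⟩ʳ v) ≤ toℕ (π ⟨$⟩ʳ y) →
           d x v ℚ.+ d v y ℚ.≤ d x y

  permutation-injective : ∀ (π : Permutation′ n) {u v} → toℕ (π ⟨$⟩ʳ u) ≡ toℕ (π ⟨$⟩ʳ v) → u ≡ v
  permutation-injective π e =
    trans (sym (inverseˡ π)) (trans (cong (π ⟨$⟩ˡ_) (toℕ-injective e)) (inverseˡ π))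

  -- Each edge of a path graph changes the position by one, so a walk from `x` to `y` cannot jump
  -- over `v`; cut at `v`, it is at least as long as the two distances together.
  path-line : ∀ (P : Graph n) (isPath : IsPathGraph P) → Induces P d → Line (proj₁ isPath)
  path-line P (π , adj) ind x v y x≤v v≤y with proj₁ (ind x y)
  ... | p , e = ℚ.≤-trans (crossing (walk p) x≤v) (ℚ.≤-reflexive e)
    where
    pos : Fin n → ℕ
    pos u = toℕ (π ⟨$⟩ʳ u)
    at-v : ∀ {x} → x ≡ v → (q : Star (Edge P) x y) → d x v ℚ.+ d v y ℚ.≤ length P q
    at-v refl q = ℚ.≤-trans (ℚ.≤-reflexive (trans (cong (ℚ._+ d v y) (M.≈⇒0 refl)) (ℚ.+-identityˡ _)))
                            (walk-bound P ind q)
    crossing : ∀ {x} (q : Star (Edge P) x y) → pos x ≤ pos v → d x v ℚ.+ d v y ℚ.≤ length P q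
    crossing ε le = at-v (permutation-injective π (≤-antisym le v≤y)) ε
    crossing {x} (_◅_ {j = z} (w , e) q) le with m≤n⇒m<n∨m≡n le
    ... | inj₂ eq = at-v (permutation-injective π eq) ((w , e) ◅ q)
    ... | inj₁ lt = begin
      d x v ℚ.+ d v y               ≤⟨ ℚ.+-monoˡ-≤ (d v y) (M.triangle x z v) ⟩
      (d x z ℚ.+ d z v) ℚ.+ d v y   ≡⟨ ℚ.+-assoc (d x z) (d z v) (d v y) ⟩
      d x z ℚ.+ (d z v ℚ.+ d v y)   ≤⟨ ℚ.+-mono-≤ (edge-bound P ind e) (crossing q (next (Equivalence.to (adj x z) (w , e)))) ⟩
      w ℚ.+ length P q              ∎
      where
      open ℚ.≤-Reasoning
      next : suc (pos x) ≡ pos z ⊎ suc (pos z) ≡ pos x → pos z ≤ pos v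
      next (inj₁ e′) = ≤-trans (≤-reflexive (sym e′)) lt
      next (inj₂ e′) = ≤-trans (≤-trans (n≤1+n _) (≤-reflexive e′)) le

  line-reverse : ∀ π → Line π → Line (π ∘ₚ reverse)
  line-reverse π line x v y x≤v v≤y = begin
    d x v ℚ.+ d v y  ≡⟨ trans (cong₂ ℚ._+_ (M.sym x v) (M.sym v y)) (ℚ.+-comm (d v x) (d y v)) ⟩
    d y v ℚ.+ d v x  ≤⟨ line y v x (flipped v y v≤y) (flipped x v x≤v) ⟩
    d y x            ≡⟨ M.sym y x ⟩
    d x y            ∎
    where
    open ℚ.≤-Reasoning
    flipped : ∀ a b → toℕ (opposite (π ⟨$⟩ʳ a)) ≤ toℕ (opposite (π ⟨$⟩ʳ b)) → toℕ (π ⟨$⟩ʳ b) ≤ toℕ (π ⟨$⟩ʳ a)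
    flipped a b le = ≮⇒≥ λ lt → <⇒≱ (∸-monoʳ-< (s≤s lt) (toℕ<n (π ⟨$⟩ʳ b)))
      (subst₂ _≤_ (opposite-prop (π ⟨$⟩ʳ a)) (opposite-prop (π ⟨$⟩ʳ b)) le)

  module _ (π : Permutation′ n) (line : Line π) where

    pos : Fin n → ℕ
    pos u = toℕ (π ⟨$⟩ʳ u)

    line-left : ∀ {u v y} → pos u ≤ pos v → pos v ≤ pos y → d v y ℚ.≤ d u y
    line-left {u} {v} {y} p q = ℚ.≤-trans
      (ℚ.≤-trans (ℚ.≤-reflexive (sym (ℚ.+-identityˡ _))) (ℚ.+-monoˡ-≤ (d v y) M.nonNegative)) (line u v y p q)

    line-right : ∀ {u v y} → pos u ≤ pos v → pos v ≤ pos y → d u v ℚ.≤ d u y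
    line-right {u} {v} {y} p q = ℚ.≤-trans
      (ℚ.≤-trans (ℚ.≤-reflexive (sym (ℚ.+-identityʳ _))) (ℚ.+-monoʳ-≤ (d u v) M.nonNegative)) (line u v y p q)

    line-right-< : ∀ {u v y} → pos u ≤ pos v → pos v < pos y → d u v ℚ.< d u y
    line-right-< {u} {v} {y} p q = ℚ.<-≤-trans
      (ℚ.≤-<-trans (ℚ.≤-reflexive (sym (ℚ.+-identityʳ _)))
         (ℚ.+-monoʳ-< (d u v) (distinct-positive λ e → <-irrefl (cong pos e) q)))
      (line u v y p (<⇒≤ q))

    line-left-< : ∀ {u v y} → pos u < pos v → pos v ≤ pos y → d v y ℚ.< d u y
    line-left-< {u} {v} {y} p q = ℚ.<-≤-trans
      (ℚ.≤-<-trans (ℚ.≤-reflexive (sym (ℚ.+-identityˡ _)))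
         (ℚ.+-monoˡ-< (d v y) (distinct-positive λ e → <-irrefl (cong pos e) p)))
      (line u v y (<⇒≤ p) q)

    from-end : ∀ {e} → pos e ≡ 0 → ∀ {u v} → d e u ℚ.< d e v → pos u < pos v
    from-end {e} e0 {u} {v} lt = ≰⇒> λ v≤u →
      ℚ.<-irrefl refl (ℚ.<-≤-trans lt (line-right (≤-trans (≤-reflexive e0) z≤n) v≤u))

    to-end : ∀ {e} → pos e ≡ 0 → ∀ {u v} → pos u < pos v → d e u ℚ.< d e v
    to-end e0 lt = line-right-< (≤-trans (≤-reflexive e0) z≤n) lt

  -- A vertex beyond `e`, seen from `r`, would be strictly farther because distinct points have
  -- positive distance. If `e` turns out to be the right end, the order is reversed.
  farthest-end : ∀ π → Line π → ∀ r e → (∀ v → d r v ℚ.≤ d r e) →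
                 ∃ λ ρ → Line ρ × toℕ (ρ ⟨$⟩ʳ e) ≡ 0
  farthest-end π line r e far with <-≤-connex (toℕ (π ⟨$⟩ʳ e)) (toℕ (π ⟨$⟩ʳ r))
  ... | inj₁ e<r = π , line , n≤0⇒n≡0 (≮⇒≥ λ 0<e → ℚ.<-irrefl refl (begin-strict
      d r e  ≡⟨ M.sym r e ⟩
      d e r  <⟨ line-left-< π line {first 0<e} (subst (_< pos′ e) (sym (first-pos 0<e)) 0<e) (<⇒≤ e<r) ⟩
      d (first 0<e) r ≡⟨ M.sym (first 0<e) r ⟩
      d r (first 0<e) ≤⟨ far (first 0<e) ⟩
      d r e ∎))
    where
    open ℚ.≤-Reasoning
    pos′ : Fin n → ℕ
    pos′ u = toℕ (π ⟨$⟩ʳ u)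
    0<n : 0 < pos′ e → 0 < n
    0<n p = <-trans p (toℕ<n _)
    first : 0 < pos′ e → Fin n
    first p = π ⟨$⟩ˡ fromℕ< (0<n p)
    first-pos : ∀ p → pos′ (first p) ≡ 0
    first-pos p = trans (cong toℕ (inverseʳ π)) (toℕ-fromℕ< (0<n p))
  ... | inj₂ r≤e = π ∘ₚ reverse , line-reverse π line ,
      trans (opposite-prop (π ⟨$⟩ʳ e)) (m≤n⇒m∸n≡0 (≮⇒≥ λ lt → ℚ.<-irrefl refl (begin-strict
        d r e          <⟨ line-right-< π line r≤e (subst (pos′ e <_) (sym (last-pos lt)) ≤-refl) ⟩
        d r (last lt)  ≤⟨ far (last lt) ⟩
        d r e          ∎)))
    where
    open ℚ.≤-Reasoning
    pos′ : Fin n → ℕ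
    pos′ u = toℕ (π ⟨$⟩ʳ u)
    last : suc (pos′ e) < n → Fin n
    last lt = π ⟨$⟩ˡ fromℕ< lt
    last-pos : ∀ lt → pos′ (last lt) ≡ suc (pos′ e)
    last-pos lt = trans (cong toℕ (inverseʳ π)) (toℕ-fromℕ< lt)

-- Finite sums, and simple paths from walks.

module SumLast {a ℓ} (M : CommutativeMonoid a ℓ) where

  open CommutativeMonoid M using (Carrier; _≈_; ∙-cong; reflexive) renaming (_∙_ to _⊕_; trans to ≈-trans)
  open Algebra.Properties.CommutativeMonoid.Sum M using () renaming (sum to Σ; sum-cong-≗ to Σ-cong; sum-init-last to Σ-init-last)

  -- `sum` unfolds from the front, whereas `between` and `count` grow at the end. Both rational and
  -- natural sums need the conversion.
  sum-last : ∀ (f : ℕ → Carrier) n → Σ {suc n} (λ j → f (toℕ j)) ≈ Σ {n} (λ j → f (toℕ j)) ⊕ f n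
  sum-last f n = ≈-trans (Σ-init-last {n} (λ j → f (toℕ j)))
    (∙-cong (reflexive (Σ-cong {n} (λ j → cong f (toℕ-inject₁ j)))) (reflexive (cong f (toℕ-fromℕ n))))

sum-mono : ∀ {n} {f g : Fin n → ℚ} → (∀ i → f i ℚ.≤ g i) → sum f ℚ.≤ sum g
sum-mono {zero}  h = ℚ.≤-refl
sum-mono {suc n} h = ℚ.+-mono-≤ (h fzero) (sum-mono (λ i → h (fsuc i)))

module _ {V : Set} {E : V → V → Set} where

  hops-◅◅ : ∀ {a b c} (p : Star E a b) (q : Star E b c) → hops (p ◅◅ q) ≡ hops p + hops q
  hops-◅◅ ε       q = refl
  hops-◅◅ (_ ◅ p) q = cong suc (hops-◅◅ p q)

  source∈ : ∀ {a b} (p : Star E a b) → a ∈ˡ visited p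
  source∈ ε       = here refl
  source∈ (_ ◅ p) = here refl

  target∈ : ∀ {a b} (p : Star E a b) → b ∈ˡ visited p
  target∈ ε       = here refl
  target∈ (_ ◅ p) = there (target∈ p)

  suffix : ∀ {a b x} (p : Star E a b) → Unique (visited p) → x ∈ˡ visited p →
           ∃ λ (q : Path E x b) → hops (walk q) ≤ hops p
  suffix ε       u        (here refl) = record { walk = ε ; simple = u } , z≤n
  suffix (e ◅ p) u        (here refl) = record { walk = e ◅ p ; simple = u } , ≤-refl
  suffix (e ◅ p) (_ ∷ u)  (there x∈)  with suffix p u x∈
  ... | q , le = q , m≤n⇒m≤1+n le

module _ {n : ℕ} {E : Fin n → Fin n → Set} where

  open import Data.List.Membership.DecPropositional (_≟ᶠ_ {n}) using (_∈?_)

  -- When the new source already occurs on the rest, everything before that occurrence is dropped,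
  -- so the hop bound survives. Walks can thus be concatenated freely where simple paths are
  -- demanded.
  erase-loops : ∀ {a b} (p : Star E a b) → ∃ λ (q : Path E a b) → hops (walk q) ≤ hops p
  erase-loops ε = record { walk = ε ; simple = [] ∷ [] } , z≤n
  erase-loops {a} (e ◅ p) with erase-loops p
  ... | q , le with a ∈? visited (walk q)
  ...   | no a∉ = record { walk = e ◅ walk q ; simple = ¬Any⇒All¬ _ a∉ ∷ simple q } , s≤s le
  ...   | yes a∈ with suffix (walk q) (simple q) a∈
  ...     | q′ , le′ = q′ , ≤-trans le′ (m≤n⇒m≤1+n le)

-- Trees given by parent maps: cost, hop bound and acyclicity.

-- A parent map is coded by naturals: 0 for no parent, suc (toℕ u) for the parent u.
module Parents {n : ℕ} (code : Fin n → ℕ) where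

  IsParent : Fin n → Fin n → Set
  IsParent v u = code v ≡ suc (toℕ u)

  parent-unique : ∀ {v u u′} → IsParent v u → IsParent v u′ → u ≡ u′
  parent-unique e e′ = toℕ-injective (suc-injective (trans (sym e) e′))

  linked : Fin n → Fin n → Bool
  linked u v = (code u ≡ᵇ suc (toℕ v)) ∨ (code v ≡ᵇ suc (toℕ u))

  linked-cases : ∀ {u v} → T (linked u v) → IsParent u v ⊎ IsParent v u
  linked-cases {u} {v} t with Equivalence.to (T-∨ {code u ≡ᵇ suc (toℕ v)}) t
  ... | inj₁ e = inj₁ (≡ᵇ⇒≡ _ _ e)
  ... | inj₂ e = inj₂ (≡ᵇ⇒≡ _ _ e)

  linked-up : ∀ {u v} → IsParent u v → T (linked u v)
  linked-up {u} {v} e = Equivalence.from (T-∨ {code u ≡ᵇ suc (toℕ v)}) (inj₁ (≡⇒≡ᵇ _ _ e))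

  linked-down : ∀ {u v} → IsParent v u → T (linked u v)
  linked-down {u} {v} e = Equivalence.from (T-∨ {code u ≡ᵇ suc (toℕ v)}) (inj₂ (≡⇒≡ᵇ _ _ e))

  module Cost (d : DistanceFunction (Fin n)) (isMetric : IsMetric _≡_ d) where
    private module M = IsMetric isMetric

    -- A matrix with at most one nonzero entry per row, so that the total can be regrouped by
    -- unordered pairs, as in `cost`.
    dues : Fin n → Fin n → ℚ
    dues u v = if code u ≡ᵇ suc (toℕ v) then d u v else 0ℚ

    upkeep : Fin n → ℚ
    upkeep u = sum (dues u)

    dues≥0 : ∀ u v → 0ℚ ℚ.≤ dues u v
    dues≥0 u v with code u ≡ᵇ suc (toℕ v)
    ... | true  = M.nonNegative
    ... | false = ℚ.≤-refl

    dues-self : ∀ u → dues u u ≡ 0ℚ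
    dues-self u with code u ≡ᵇ suc (toℕ u)
    ... | true  = M.≈⇒0 refl
    ... | false = refl

    mutual-dues : Fin n → Fin n → ℚ
    mutual-dues u v = if does (u <ᶠ? v) then dues u v ℚ.+ dues v u else 0ℚ

    -- The entries on one side of the diagonal are folded onto the other by exchanging the two sums;
    -- the diagonal vanishes because `d u u` does.
    upkeep-total : sum upkeep ≡ sum (λ u → sum (mutual-dues u))
    upkeep-total = begin
      sum (λ u → sum (dues u))
        ≡⟨ sum-cong-≗ (λ u → trans (sum-cong-≗ (by-order u)) (∑-distrib-+ (below u) (above u))) ⟩
      sum (λ u → sum (below u) ℚ.+ sum (above u))
        ≡⟨ ∑-distrib-+ (λ u → sum (below u)) (λ u → sum (above u)) ⟩
      sum (λ u → sum (below u)) ℚ.+ sum (λ u → sum (above u))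
        ≡⟨ cong (sum (λ u → sum (below u)) ℚ.+_) (∑-comm above) ⟩
      sum (λ u → sum (below u)) ℚ.+ sum (λ v → sum (λ u → above u v))
        ≡⟨ ∑-distrib-+ (λ u → sum (below u)) (λ v → sum (λ u → above u v)) ⟨
      sum (λ u → sum (below u) ℚ.+ sum (λ v → above v u))
        ≡⟨ sum-cong-≗ (λ u → trans (sym (∑-distrib-+ (below u) (λ v → above v u))) (sum-cong-≗ (joined u))) ⟩
      sum (λ u → sum (mutual-dues u)) ∎
      where
      open ≡-Reasoning
      below above : Fin n → Fin n → ℚ
      below u v = if does (u <ᶠ? v) then dues u v else 0ℚ
      above u v = if does (v <ᶠ? u) then dues u v else 0ℚ
      by-order : ∀ u v → dues u v ≡ below u v ℚ.+ above u v
      by-order u v with <-cmp (toℕ u) (toℕ v)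
      ... | tri< lt _ ≯ rewrite dec-true (u <ᶠ? v) lt | dec-false (v <ᶠ? u) ≯ = sym (ℚ.+-identityʳ _)
      ... | tri> ≮ _ gt rewrite dec-true (v <ᶠ? u) gt | dec-false (u <ᶠ? v) ≮ = sym (ℚ.+-identityˡ _)
      ... | tri≈ ≮ e ≯ rewrite dec-false (v <ᶠ? u) ≯ | dec-false (u <ᶠ? v) ≮ | toℕ-injective e =
        trans (dues-self v) (sym (ℚ.+-identityˡ _))
      joined : ∀ u v → below u v ℚ.+ above v u ≡ mutual-dues u v
      joined u v with does (u <ᶠ? v)
      ... | true  = refl
      ... | false = ℚ.+-identityˡ _

    upkeep≥0 : ∀ u → 0ℚ ℚ.≤ upkeep u
    upkeep≥0 u = ℚ.≤-trans (ℚ.≤-reflexive (sym (sum-replicate-zero n))) (sum-mono (dues≥0 u))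

    upkeep-root : ∀ u → code u ≡ 0 → upkeep u ≡ 0ℚ
    upkeep-root u e rewrite e = sum-replicate-zero n

    upkeep-child : ∀ {u v} → IsParent u v → upkeep u ≡ d u v
    upkeep-child {u} {v} e rewrite e = single (d u) v
      where
      single : ∀ {m} (f : Fin m → ℚ) v → sum (λ x → if toℕ v ≡ᵇ toℕ x then f x else 0ℚ) ≡ f v
      single {suc m} f fzero    = trans (cong (f fzero ℚ.+_) (sum-replicate-zero m)) (ℚ.+-identityʳ _)
      single {suc m} f (fsuc v) = trans (ℚ.+-identityˡ _) (single (λ x → f (fsuc x)) v)

    -- Levels forbid that two vertices are each other's parents, so every edge of `S` is charged at
    -- most once.
    upkeep≤cost : ∀ S (level : Fin n → ℕ) → (∀ {u v} → IsParent u v → Adj S u v × level v < level u) →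
                  sum upkeep ℚ.≤ cost d S
    upkeep≤cost S level h = ℚ.≤-trans (ℚ.≤-reflexive upkeep-total) (sum-mono λ u → sum-mono λ v → pointwise u v)
      where
      pointwise : ∀ u v → mutual-dues u v ℚ.≤ (if edge S u v ∧ does (u <ᶠ? v) then d u v else 0ℚ)
      pointwise u v with does (u <ᶠ? v)
      ... | false rewrite ∧-zeroʳ (edge S u v) = ℚ.≤-refl
      ... | true with code u ≡ᵇ suc (toℕ v) in eu | code v ≡ᵇ suc (toℕ u) in ev
      ...   | false | false with edge S u v
      ...     | true  = M.nonNegative
      ...     | false = ℚ.≤-refl
      pointwise u v | true | true | true =
        contradiction (<-trans (proj₂ (h (≡ᵇ⇒≡ _ _ (subst T (sym eu) _)))) (proj₂ (h (≡ᵇ⇒≡ _ _ (subst T (sym ev) _)))))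
                      (<-irrefl refl)
      pointwise u v | true | true | false
        rewrite T⇒≡ (proj₁ (h {u} {v} (≡ᵇ⇒≡ _ _ (subst T (sym eu) _)))) = ℚ.≤-reflexive (ℚ.+-identityʳ _)
      pointwise u v | true | false | true
        rewrite T⇒≡ (Subgraph.symmetric S (proj₁ (h {v} {u} (≡ᵇ⇒≡ _ _ (subst T (sym ev) _))))) =
        ℚ.≤-reflexive (trans (ℚ.+-identityˡ _) (M.sym v u))

    -- An edge claimed from both ends would be paid twice and counted once, which nonnegativity
    -- allows.
    cost≤upkeep : ∀ S → (∀ u v → edge S u v ≡ linked u v) → cost d S ℚ.≤ sum upkeep
    cost≤upkeep S h = ℚ.≤-trans (sum-mono λ u → sum-mono λ v → pointwise u v) (ℚ.≤-reflexive (sym upkeep-total))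
      where
      pointwise : ∀ u v → (if edge S u v ∧ does (u <ᶠ? v) then d u v else 0ℚ) ℚ.≤ mutual-dues u v
      pointwise u v rewrite h u v with does (u <ᶠ? v)
      ... | false rewrite ∧-zeroʳ (linked u v) = ℚ.≤-refl
      ... | true with code u ≡ᵇ suc (toℕ v) | code v ≡ᵇ suc (toℕ u)
      ...   | false | false = ℚ.≤-refl
      ...   | false | true  = ℚ.≤-reflexive (trans (M.sym u v) (sym (ℚ.+-identityˡ _)))
      ...   | true  | false = ℚ.≤-reflexive (sym (ℚ.+-identityʳ _))
      ...   | true  | true  = ℚ.≤-trans (ℚ.≤-reflexive (sym (ℚ.+-identityʳ _))) (ℚ.+-monoʳ-≤ (d u v) M.nonNegative)

  -- Here `h` is a budget rather than the exact depth: `top` accepts any remainder.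
  data Up (r : Fin n) : ℕ → Fin n → Set where
    top  : ∀ {h} → Up r h r
    rise : ∀ {h v u} → IsParent v u → Up r h u → Up r (suc h) v

  data Above : Fin n → Fin n → Set where
    one  : ∀ {v u} → IsParent v u → Above v u
    more : ∀ {v u x} → IsParent v u → Above u x → Above v x

  above-snoc : ∀ {v u x} → Above v u → IsParent u x → Above v x
  above-snoc (one e)    f = more e (one f)
  above-snoc (more e a) f = more e (above-snoc a f)

  -- Parents are unique, so a chain from `v` back to `v` can be rotated to start at the parent of
  -- `v`. Repeating this along the way up ends at the root, which has no parent.
  no-cycle : ∀ {r h v} → code r ≡ 0 → Up r h v → ¬ Above v v
  no-cycle r0 top (one e)    = contradiction (trans (sym r0) e) λ ()
  no-cycle r0 top (more e _) = contradiction (trans (sym r0) e) λ ()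
  no-cycle r0 (rise e p) (one f) rewrite parent-unique e f = no-cycle r0 p (one f)
  no-cycle r0 (rise e p) (more f a) rewrite parent-unique e f = no-cycle r0 p (above-snoc a f)

  module Tree (r : Fin n) (k : ℕ) (r0 : code r ≡ 0) (up : ∀ v → code v ≢ 0 → Up r k v) where

    present : Fin n → Bool
    present v = does (v ≟ᶠ r) ∨ (0 <ᵇ code v)

    present-up : ∀ {v} → T (present v) → Up r k v
    present-up {v} t with v ≟ᶠ r
    ... | yes refl = top
    ... | no  _    = up v λ e → <⇒≢ (<ᵇ⇒< 0 (code v) t) (sym e)

    child-present : ∀ {u v} → IsParent u v → T (present u)
    child-present {u} e with does (u ≟ᶠ r)
    ... | true  = _
    ... | false rewrite e = _

    up-present : ∀ {h v} → Up r h v → T (present v)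
    up-present top rewrite dec-true (r ≟ᶠ r) refl = _
    up-present (rise e p) = child-present e

    up-parent : ∀ {h u v} → Up r h u → IsParent u v → T (present v)
    up-parent top e = contradiction (trans (sym r0) e) λ ()
    up-parent (rise e p) e′ rewrite sym (parent-unique e e′) = up-present p

    parent-present : ∀ {u v} → IsParent u v → T (present v)
    parent-present e = up-parent (up _ (λ z → 0≢1+n (trans (sym z) e))) e

    member : ∀ {v} → T (present v) → v ∈ tabulate present
    member {v} t = lookup⇒[]= v _ (trans (lookup∘tabulate present v) (T⇒≡ t))

    member⁻ : ∀ {v} → v ∈ tabulate present → T (present v)
    member⁻ {v} m = subst T (trans (sym ([]=⇒lookup m)) (lookup∘tabulate present v)) _

    tree : Subgraph n
    tree = record
      { vertices    = tabulate present
      ; edge        = linked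
      ; endpoints   = λ {u} {v} t → member (Data.Sum.[ child-present , parent-present ] (linked-cases {u} {v} t))
      ; symmetric   = λ {u} {v} t → Data.Sum.[ linked-down , linked-up ] (linked-cases {u} {v} t)
      ; irreflexive = λ {u} t → loop {u} (Data.Sum.reduce (linked-cases {u} {u} t))
      }
      where
      loop : ∀ {u} → ¬ (code u ≡ suc (toℕ u))
      loop e = no-cycle r0 (up _ (λ z → 0≢1+n (trans (sym z) e))) (one e)

    E : Fin n → Fin n → Set
    E = Adj tree

    from-root : ∀ {h v} → Up r h v → ∃ λ (p : Star E r v) → hops p ≤ h
    from-root top = ε , z≤n
    from-root (rise {h} {v} {u} e p) with from-root p
    ... | q , le = q ◅◅ (linked-down {u} {v} e ◅ ε) ,
      ≤-trans (≤-reflexive (trans (hops-◅◅ q (linked-down {u} {v} e ◅ ε)) (+-comm (hops q) 1))) (s≤s le)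

    to-root : ∀ {h v} → Up r h v → Star E v r
    to-root top                = ε
    to-root (rise {h} {v} {u} e p) = linked-up {v} {u} e ◅ to-root p

    -- Seen from the far end: the parent of `u` is off the path, so the last edge cannot descend to
    -- `u`. A vertex whose parent is its successor on the path cannot also have its predecessor as
    -- parent, hence all edges rise.
    rising : ∀ {v x y u} (e : E x y) (p : Star E y u) → Unique (x ∷ visited p) →
             IsParent u v → v ∉ˡ (x ∷ visited p) → IsParent x y × Above x u
    rising {v} {x} {y} e ε _ uv v∉ with linked-cases {x} {y} e
    ... | inj₁ xy = xy , one xy
    ... | inj₂ yx = contradiction (here (parent-unique uv yx)) v∉
    rising {v} {x} {y} e (_◅_ {j = z} f p) (x∉ ∷ un) uv v∉ with rising f p un uv (λ m → v∉ (there m))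
    ... | yz , above with linked-cases {x} {y} e
    ...   | inj₁ xy = xy , more xy above
    ...   | inj₂ yx rewrite parent-unique yx yz = contradiction (there (source∈ p)) (All¬⇒¬Any x∉)

    -- After one step away from the root a simple path never turns: rising from `y` would return to
    -- `x`.
    descending : ∀ {x y u} → IsParent y x → (p : Star E y u) → x ∉ˡ visited p → Unique (visited p) →
                 u ≡ y ⊎ Above u y
    descending yx ε _ _ = inj₁ refl
    descending {x} {y} yx (_◅_ {j = z} f p) x∉ (y∉ ∷ un) with linked-cases {y} {z} f
    ... | inj₁ yz rewrite parent-unique yx yz = contradiction (there (source∈ p)) x∉
    ... | inj₂ zy with descending zy p (All¬⇒¬Any y∉) un
    ...   | inj₁ refl = inj₂ (one zy)
    ...   | inj₂ a    = inj₂ (above-snoc a zy)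

    -- The rest of a longer simple path would close a chain of parents that returns to its start.
    acyclic : ∀ {u v} → E u v → (p : Path E v u) → hops (walk p) ≤ 1
    acyclic {u} {v} e record { walk = ε } = z≤n
    acyclic {u} {v} e record { walk = f ◅ ε } = ≤-refl
    acyclic {u} {v} e record { walk = _◅_ {j = y} f (_◅_ {j = z} g p) ; simple = v∉ ∷ un }
      with linked-cases {u} {v} e
    ... | inj₁ uv with rising g p un uv (All¬⇒¬Any v∉)
    ...   | yz , above with linked-cases {v} {y} f
    ...     | inj₁ vy = contradiction (more vy (above-snoc above uv)) (no-cycle r0 (present-up (parent-present uv)))
    ...     | inj₂ yv rewrite parent-unique yv yz = contradiction (there (source∈ p)) (All¬⇒¬Any v∉)
    acyclic {u} {v} e record { walk = _◅_ {j = y} f (_◅_ {j = z} g p) ; simple = v∉ ∷ un }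
        | inj₂ vu with linked-cases {v} {y} f
    ...   | inj₁ vy rewrite parent-unique vu vy with un
    ...     | y∉ ∷ _ = contradiction (target∈ p) (All¬⇒¬Any y∉)
    acyclic {u} {v} e record { walk = _◅_ {j = y} f (_◅_ {j = z} g p) ; simple = v∉ ∷ un }
        | inj₂ vu | inj₂ yv with descending yv (g ◅ p) (All¬⇒¬Any v∉) un
    ...   | inj₁ refl = contradiction (more vu (one yv)) (no-cycle r0 (present-up (child-present vu)))
    ...   | inj₂ a    = contradiction (more vu (above-snoc a yv)) (no-cycle r0 (present-up (child-present vu)))

    isTree : IsTree tree
    isTree = record
      { connected = λ u∈ v∈ → proj₁ (erase-loops (to-root (present-up (member⁻ u∈)) ◅◅
                                              proj₁ (from-root (present-up (member⁻ v∈)))))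
      ; acyclic   = λ {u} {v} → acyclic {u} {v}
      }

    isKHop : ∀ {X} → (∀ {v} → v ∈ X → T (present v)) → IsKHopSteinerTree X r k tree
    isKHop cover = record
      { isTree    = isTree
      ; root      = member (up-present (top {h = 0}))
      ; terminals = λ v∈ → member (cover v∈)
      ; hop       = λ v∈ → within (from-root (present-up (member⁻ v∈)))
      }
      where
      within : ∀ {v} → ∃ (λ (p : Star E r v) → hops p ≤ k) → ∃ λ (p : Path E r v) → hops (walk p) ≤ k
      within (p , le) with erase-loops p
      ... | q , le′ = q , ≤-trans le′ le

between-sum : ∀ (f : ℕ → ℚ) n → between f 0 (suc n) ≡ sum {n} (λ j → f (suc (toℕ j)))
between-sum f zero    = refl
between-sum f (suc n) = trans (cong (ℚ._+ f (suc n)) (between-sum f n))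
  (sym (SumLast.sum-last ℚ.+-0-commutativeMonoid (f ∘ suc) n))

-- Hop distances, and the passage between trees and plans on the line.

-- level (suc K) is the hop distance from r capped at suc K, so that suc K also stands for “unreached”.
module Levels {n : ℕ} (S : Subgraph n) (r : Fin n) where

  within : ℕ → Fin n → Bool
  within zero    v = does (v ≟ᶠ r)
  within (suc h) v = within h v ∨ does (any? λ u → T? (edge S v u ∧ within h u))

  within-mono : ∀ {h h′ v} → h ≤ h′ → T (within h v) → T (within h′ v)
  within-mono {h′ = zero} z≤n t = t
  within-mono {h} {suc h′} {v} le t with m≤n⇒m<n∨m≡n le
  ... | inj₂ refl = t
  ... | inj₁ lt   = Equivalence.from T-∨ (inj₁ (within-mono (s≤s⁻¹ lt) t))

  within-step : ∀ {h u v} → Adj S v u → T (within h u) → T (within (suc h) v)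
  within-step {h} {u} {v} a t = Equivalence.from (T-∨ {within h v}) (inj₂ found)
    where
    found : T (does (any? λ x → T? (edge S v x ∧ within h x)))
    found rewrite dec-true (any? λ x → T? (edge S v x ∧ within h x)) (u , Equivalence.from (T-∧ {edge S v u}) (a , t)) = _

  walk-within : ∀ {h x v} (p : Star (Adj S) x v) → T (within h x) → T (within (hops p + h) v)
  walk-within ε t = t
  walk-within {h} {v = v} (_◅_ {j = y} e p) t =
    subst (λ m → T (within m v)) (+-suc (hops p) h)
      (walk-within {suc h} p (within-step {h} (Subgraph.symmetric S e) t))

  level : ℕ → Fin n → ℕ
  level zero    v = zero
  level (suc K) v = if within K v then level K v else suc K

  level≤ : ∀ K v → level K v ≤ K
  level≤ zero    v = z≤n
  level≤ (suc K) v with within K v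
  ... | true  = m≤n⇒m≤1+n (level≤ K v)
  ... | false = ≤-refl

  level-low : ∀ K {h v} → T (within h v) → level K v ≤ h
  level-low zero    t = z≤n
  level-low (suc K) {h} {v} t with within K v in eq
  ... | true  = level-low K t
  ... | false = ≰⇒> λ h≤K → subst T eq (within-mono h≤K t)

  level-within : ∀ K {v} → T (within K v) → T (within (level K v) v)
  level-within zero    t = t
  level-within (suc K) {v} t with within K v in eq
  ... | true  = level-within K (subst T (sym eq) _)
  ... | false rewrite eq = t

  level-reached : ∀ K {v} → level (suc K) v ≤ K → T (within (level (suc K) v) v)
  level-reached K {v} le with within K v in eq
  ... | true  = level-within K (subst T (sym eq) _)
  ... | false = contradiction le (<-irrefl refl)

  -- Level `h + 1` excludes being within `h` hops, so a neighbour within `h` must be responsible.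
  -- The bound `suc h ≤ K` keeps the level away from the cap.
  level-parent : ∀ K {v h} → level (suc K) v ≡ suc h → suc h ≤ K → ∃ λ u → Adj S v u × level (suc K) u ≤ h
  level-parent K {v} {h} e le
    with Equivalence.to (T-∨ {within h v}) (subst (λ m → T (within m v)) e (level-reached K (≤-trans (≤-reflexive e) le)))
  ... | inj₁ t = contradiction (≤-trans (≤-reflexive (sym e)) (level-low (suc K) t)) (<-irrefl refl)
  ... | inj₂ t with any? (λ u → T? (edge S v u ∧ within h u))
  ...   | yes (u , t′) with Equivalence.to (T-∧ {edge S v u}) t′
  ...     | a , tu = u , a , level-low (suc K) tu

-- Positions on the line: 1 … n are the vertices in order, and 0 and suc n are copies of the root.
module Positions {n : ℕ} {d : DistanceFunction (Fin n)} (isMetric : IsMetric _≡_ d)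
                 (ρ : Permutation′ n) (line : Line isMetric ρ)
                 (X : Subset n) (r : Fin n) (k : ℕ) where

  private module M = IsMetric isMetric

  N : ℕ
  N = suc n

  rank : Fin n → ℕ
  rank v = toℕ (ρ ⟨$⟩ʳ v)

  vertex : ℕ → Fin n
  vertex zero = r
  vertex (suc i) with i <? n
  ... | yes i<n = ρ ⟨$⟩ˡ fromℕ< i<n
  ... | no  _   = r

  vertex-inner : ∀ {i} (i<n : i < n) → vertex (suc i) ≡ ρ ⟨$⟩ˡ fromℕ< i<n
  vertex-inner {i} i<n with i <? n
  ... | yes p = refl
  ... | no ≮  = contradiction i<n ≮

  vertex-last : vertex N ≡ r
  vertex-last with n <? n
  ... | yes p = contradiction p (<-irrefl refl)
  ... | no  _ = refl

  vertex-rank : ∀ v → vertex (suc (rank v)) ≡ v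
  vertex-rank v = trans (vertex-inner (toℕ<n _)) (trans (cong (ρ ⟨$⟩ˡ_) (fromℕ<-toℕ _ _)) (inverseˡ ρ))

  rank-vertex : ∀ {i} → 0 < i → i < N → suc (rank (vertex i)) ≡ i
  rank-vertex {suc i} _ i<N =
    cong suc (trans (cong (toℕ ∘ (ρ ⟨$⟩ʳ_)) (vertex-inner (s≤s⁻¹ i<N))) (trans (cong toℕ (inverseʳ ρ)) (toℕ-fromℕ< (s≤s⁻¹ i<N))))

  δ : ℕ → ℕ → ℚ
  δ i j = d (vertex i) (vertex j)

  terminal : ℕ → ℕ
  terminal i = flag (lookup X (vertex i))

  open DP N k δ terminal public

  sum-positions : ∀ (g : Fin n → ℚ) → sum g ≡ between (λ i → g (vertex i)) 0 N
  sum-positions g = trans (sum-permute g (flip ρ)) (sym (trans (between-sum (λ i → g (vertex i)) n)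
    (sum-cong-≗ λ j → cong g (trans (vertex-inner (toℕ<n j)) (cong (ρ ⟨$⟩ˡ_) (fromℕ<-toℕ j (toℕ<n j)))))))

  rank-≤ : ∀ {i j} → 0 < i → i ≤ j → j < N → rank (vertex i) ≤ rank (vertex j)
  rank-≤ 0<i i≤j j<N = s≤s⁻¹ (subst₂ _≤_ (sym (rank-vertex 0<i (≤-<-trans i≤j j<N)))
                                         (sym (rank-vertex (<-≤-trans 0<i i≤j) j<N)) i≤j)

  -- A sentinel has the distances of the root and not those of its place on the line, hence `0 < x`;
  -- the same goes for `x < N` in `δ-right`.
  δ-left : ∀ {x l i} → 0 < x → x ≤ l → l < i → i < N → δ l i ℚ.≤ δ x i
  δ-left 0<x x≤l l<i i<N = line-left isMetric ρ line
    (rank-≤ 0<x x≤l (<-trans l<i i<N)) (rank-≤ (<-≤-trans 0<x x≤l) (<⇒≤ l<i) i<N)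

  δ-right : ∀ {x b i} → 0 < i → i < b → b ≤ x → x < N → δ b i ℚ.≤ δ x i
  δ-right {x} {b} {i} 0<i i<b b≤x x<N = subst₂ ℚ._≤_ (M.sym (vertex i) (vertex b)) (M.sym (vertex i) (vertex x))
    (line-right isMetric ρ line (rank-≤ 0<i (<⇒≤ i<b) (≤-<-trans b≤x x<N)) (rank-≤ (<-trans 0<i i<b) b≤x x<N))

  module FromTree (S : Subgraph n) (isK : IsKHopSteinerTree X r k S) where
    open Levels S r

    depth : Fin n → ℕ
    depth = level (suc k)

    -- Any neighbour of smaller depth will do: `upkeep≤cost` asks only that parent edges belong to
    -- `S` and descend in depth.
    code : Fin n → ℕ
    code v with any? (λ u → T? (edge S v u) ×-dec (depth u <? depth v))
    ... | yes (u , _) = suc (toℕ u)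
    ... | no  _       = 0

    code-parent : ∀ {u v} → code u ≡ suc (toℕ v) → Adj S u v × depth v < depth u
    code-parent {u} e with any? (λ x → T? (edge S u x) ×-dec (depth x <? depth u))
    ... | yes (x , a , lt) rewrite sym (toℕ-injective (suc-injective e)) = a , lt

    depth-zero : ∀ {v} → depth v ≡ 0 → v ≡ r
    depth-zero {v} eq = does-true (v ≟ᶠ r) (T⇒≡ (subst (λ m → T (within m v)) eq
      (level-reached k (≤-trans (≤-reflexive eq) z≤n))))

    has-parent : ∀ {v} → v ≢ r → depth v ≤ k → ∃ λ u → code v ≡ suc (toℕ u)
    has-parent {v} v≢r le with any? (λ u → T? (edge S v u) ×-dec (depth u <? depth v))
    ... | yes (u , _) = u , refl
    ... | no none with depth v in eq
    ...   | zero  = contradiction (depth-zero eq) v≢r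
    ...   | suc h with level-parent k eq le
    ...     | u , a , le′ = contradiction (u , a , s≤s le′) none

    -- The root is labelled 1 instead of 0: all labels between the sentinels must exceed their 0, and
    -- the sentinels serve in its place as the parent of the other vertices labelled 1.
    label : ℕ → ℕ
    label i = if does (vertex i ≟ᶠ r) then 1 else depth (vertex i)

    open Parents code
    open Cost d isMetric

    payment : ℕ → ℚ
    payment i = upkeep (vertex i)

    depth≥1 : ∀ {v} → v ≢ r → 1 ≤ depth v
    depth≥1 {v} v≢r with depth v in eq
    ... | suc _ = s≤s z≤n
    ... | zero  = contradiction (depth-zero eq) v≢r

    label≥1 : ∀ i → 1 ≤ label i
    label≥1 i with vertex i ≟ᶠ r
    ... | yes _  = ≤-refl
    ... | no v≢r = depth≥1 v≢r

    depth-terminal : ∀ {v} → v ∈ X → depth v ≤ k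
    depth-terminal v∈ with IsKHopSteinerTree.hop isK (IsKHopSteinerTree.terminals isK v∈)
    ... | p , le = level-low (suc k) (within-mono {hops (walk p) + 0} (≤-trans (≤-reflexive (+-identityʳ _)) le)
                     (walk-within {0} (walk p) (subst T (sym (dec-true (r ≟ᶠ r) refl)) _)))

    covers : 1 ≤ k → ∀ i → 0 < i → i < N → terminal i ≢ 0 → label i ≤ k
    covers 1≤k i _ _ t with vertex i ≟ᶠ r
    ... | yes _ = 1≤k
    ... | no  _ with lookup X (vertex i) in eq
    ...   | true  = depth-terminal (lookup⇒[]= (vertex i) X eq)
    ...   | false = contradiction refl t

    label-depth : ∀ i → vertex i ≢ r → label i ≡ depth (vertex i)
    label-depth i v≢r with vertex i ≟ᶠ r
    ... | yes e = contradiction e v≢r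
    ... | no  _ = refl

    -- If the parent lies outside `(l , b)`, one of the ends is at least as near. Inside, its label
    -- would be too small, unless it is the root with its label 1. Then `label i` is 1 as well, no
    -- label lies below it, and so `l` is the sentinel that represents the root.
    pays : ∀ {l i b} → l < i → i < b → b ≤ N → label i ≤ k →
           (∀ u → l < u → u < b → label i ≤ label u) →
           l ≡ 0 ⊎ label l < label i → b ≡ N ⊎ label b < label i → link l i b ℚ.≤ payment i
    pays {l} {i} {b} l<i i<b b≤N le ins bl br with vertex i ≟ᶠ r
    ... | yes i≡r with bl
    -- The position of the root itself has label 1, so its left end can only be the sentinel, at
    -- distance 0.
    ...   | inj₁ refl = ℚ.≤-trans (link≤ˡ l i b) (ℚ.≤-trans (ℚ.≤-reflexive (M.≈⇒0 (sym i≡r))) (upkeep≥0 (vertex i)))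
    ...   | inj₂ lt   = contradiction (label≥1 l) (<⇒≱ lt)
    pays {l} {i} {b} l<i i<b b≤N le ins bl br | no i≢r with has-parent i≢r le
    ... | u , e = ℚ.≤-trans bounded (ℚ.≤-reflexive (sym (upkeep-child e)))
      where
      x = suc (rank u)
      x-vertex : vertex x ≡ u
      x-vertex = vertex-rank u
      x<N : x < N
      x<N = s≤s (toℕ<n _)
      δx : δ x i ≡ d (vertex i) u
      δx = trans (cong (λ v → d v (vertex i)) x-vertex) (M.sym u (vertex i))
      root-parent : l < x → x < b → u ≡ r × l ≡ 0
      root-parent l<x x<b = u≡r , l≡0
        where
        higher = ins x l<x x<b
        u≡r : u ≡ r
        u≡r with u ≟ᶠ r
        ... | yes e′ = e′
        ... | no u≢r = contradiction
          (<-≤-trans (proj₂ (code-parent e)) (≤-trans higher (≤-reflexive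
             (trans (label-depth x (λ e′ → u≢r (trans (sym x-vertex) e′))) (cong depth x-vertex)))))
          (<-irrefl refl)
        label-x : label x ≡ 1
        label-x rewrite dec-true (vertex x ≟ᶠ r) (trans x-vertex u≡r) = refl
        l≡0 : l ≡ 0
        l≡0 = Data.Sum.[ (λ e′ → e′) , (λ lt → contradiction (label≥1 l)
                (<⇒≱ (<-≤-trans lt (≤-trans higher (≤-reflexive label-x))))) ] bl
      bounded : link l i b ℚ.≤ d (vertex i) u
      bounded with <-≤-connex l x | <-≤-connex x b
      ... | inj₂ x≤l | _ = ℚ.≤-trans (link≤ˡ l i b)
        (ℚ.≤-trans (δ-left (s≤s z≤n) x≤l l<i (<-≤-trans i<b b≤N)) (ℚ.≤-reflexive δx))
      ... | inj₁ _ | inj₂ b≤x = ℚ.≤-trans (link≤ʳ l i b)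
        (ℚ.≤-trans (δ-right (≤-<-trans z≤n l<i) i<b b≤x x<N) (ℚ.≤-reflexive δx))
      ... | inj₁ l<x | inj₁ x<b with root-parent l<x x<b
      ...   | refl , refl = ℚ.≤-trans (link≤ˡ l i b) (ℚ.≤-reflexive (M.sym r (vertex i)))

    rival : 1 ≤ k → Rival
    rival 1≤k = record
      { label = label ; payment = payment ; payment≥0 = λ i → upkeep≥0 (vertex i)
      ; covers = covers 1≤k ; pays = pays }

    payment≤cost : between payment 0 N ℚ.≤ cost d S
    payment≤cost = ℚ.≤-trans (ℚ.≤-reflexive (sym (sum-positions upkeep))) (upkeep≤cost S depth code-parent)

  module ToTree (f : ℕ → ℕ) {v : ℚ} (opt : Optimal 0 0 N v f) where

    -- The plan may give a parent to the root's own position. It is dropped here, which can only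
    -- lower the cost.
    code : Fin n → ℕ
    code u with does (u ≟ᶠ r) | f (suc (rank u))
    ... | true  | _     = 0
    ... | false | zero  = 0
    ... | false | suc x = suc (toℕ (vertex x))

    open Parents code
    open Cost d isMetric

    code-root : code r ≡ 0
    code-root rewrite dec-true (r ≟ᶠ r) refl = refl

    code-position : ∀ {i x} → 0 < i → i < N → vertex i ≢ r → f i ≡ suc x → code (vertex i) ≡ suc (toℕ (vertex x))
    code-position {i} 0<i i<N i≢r e
      rewrite dec-false (vertex i ≟ᶠ r) i≢r | rank-vertex 0<i i<N | e = refl

    -- Both exits are copies of the root. A chain that meets the root's own position stops there
    -- early, since `top` accepts an unspent budget.
    reach-up : ∀ {h i} → Reach f 0 N (Ends 0 0 N) h i → Up r h (vertex i)
    reach-up (stop (_ , inj₁ refl)) = top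
    reach-up {h} (stop (_ , inj₂ refl)) = subst (Up r h) (sym vertex-last) top
    reach-up (step {h} {i} 0<i i<N e p) with vertex i ≟ᶠ r
    ... | yes e′ = subst (Up r (suc h)) (sym e′) top
    ... | no i≢r = rise (code-position 0<i i<N i≢r e) (reach-up p)

    served-vertex : ∀ u → terminal (suc (rank u)) ≢ 0 ⊎ f (suc (rank u)) ≢ 0 → Up r k u
    served-vertex u act = subst (Up r k) (vertex-rank u)
      (reach-up (Served.reach (proj₁ opt) (suc (rank u)) (s≤s z≤n) (s≤s (toℕ<n _)) act))

    up : ∀ u → code u ≢ 0 → Up r k u
    up u ne with does (u ≟ᶠ r) | f (suc (rank u)) in e
    ... | true  | _     = contradiction refl ne
    ... | false | zero  = contradiction refl ne
    ... | false | suc x = served-vertex u (inj₂ λ z → 0≢1+n (trans (sym z) e))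

    open Tree r k code-root up public

    result : IsKHopSteinerTree X r k tree
    result = isKHop λ {u} u∈ → up-present (served-vertex u (inj₁ (subst (λ b → flag b ≢ 0)
      (sym (trans (cong (lookup X) (vertex-rank u)) ([]=⇒lookup u∈))) λ ())))

    cost≤ : cost d tree ℚ.≤ v
    cost≤ = ℚ.≤-trans (cost≤upkeep tree (λ _ _ → refl)) (ℚ.≤-trans (ℚ.≤-reflexive (sum-positions upkeep))
      (ℚ.≤-trans (between-mono N pointwise) (Served.price (proj₁ opt))))
      where
      pay≥0 : ∀ i → 0ℚ ℚ.≤ pay f i
      pay≥0 i with f i
      ... | zero  = ℚ.≤-refl
      ... | suc x = M.nonNegative
      pointwise : ∀ i → 0 < i → i < N → upkeep (vertex i) ℚ.≤ pay f i
      pointwise i 0<i i<N = cases (vertex i ≟ᶠ r) (f i) refl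
        where
        unpaid : vertex i ≢ r → f i ≡ 0 → code (vertex i) ≡ 0
        unpaid i≢r e rewrite dec-false (vertex i ≟ᶠ r) i≢r | rank-vertex 0<i i<N | e = refl
        cases : Dec (vertex i ≡ r) → ∀ y → f i ≡ y → upkeep (vertex i) ℚ.≤ pay f i
        cases (yes i≡r) _ _ = ℚ.≤-trans (ℚ.≤-reflexive (upkeep-root (vertex i) (trans (cong code i≡r) code-root))) (pay≥0 i)
        cases (no i≢r) zero e =
          ℚ.≤-trans (ℚ.≤-reflexive (upkeep-root (vertex i) (unpaid i≢r e))) (pay≥0 i)
        cases (no i≢r) (suc x) e = ℚ.≤-reflexive (trans (upkeep-child (code-position 0<i i<N i≢r e))
          (trans (M.sym (vertex i) (vertex x)) (sym (pay-suc f i e))))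

    minimum : 1 ≤ k → IsMinimumKHopSteinerTree d X r k tree
    minimum 1≤k = result , λ S′ isK → ℚ.≤-trans cost≤ (ℚ.≤-trans
      (proj₂ opt (FromTree.rival S′ isK 1≤k)
         -- At `q = 0` the whole line is `Inside`: labels start at 1 and both ends are sentinels.
         ((λ u _ _ → FromTree.label≥1 S′ isK u) , inj₁ refl , inj₁ refl))
      (FromTree.payment≤cost S′ isK))

-- Programs for the multiplication tables, the distances and the order.

FL Uv Xv Vv Tv Ev Cv Jv Yv Zv : ℕ
FL = 9
Uv = 30
Xv = 31
Vv = 32
Tv = 33
Ev = 34
Cv = 35
Jv = 36
Yv = 37
Zv = 38

pair : ℕ → ℕ → Expr nat
pair u v = add (read MN (var u)) (var v)

sizesP : Prog
sizesP = asg nat W (const 0) (add (const 2) (var 0)) ∙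
         asg nat K₁ (const 0) (sub (read 0 (const 1)) (const 1))

-- Multiples are made by repeated addition. There are `w * w` of them because the address of a plan
-- multiplies an interval index `l * w + r` by `w` once more.
tableBody tableRow tableP : Prog
tableBody = asg nat MW (var Jv) (var Yv) ∙ asg nat MN (var Jv) (var Zv) ∙
            asg nat Jv (const 0) (incr Jv) ∙
            asg nat Yv (const 0) (add (var Yv) (var W)) ∙ asg nat Zv (const 0) (add (var Zv) (var 0))
tableRow  = for Bv W tableBody
tableP    = for Av W tableRow

-- `FL` marks the pairs with a tentative distance, as no rational stands for infinity. The diagonal
-- starts out known, with the value 0 that `Dm` holds initially.
knowP selfP : Prog
knowP = asg nat FL (pair Uv Uv) (const 1)
selfP = for Uv 0 knowP

viaX : Expr rat
viaX = add (read 0 (pair Uv Xv)) (read Dm (pair Xv Vv))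

-- A positive matrix entry is the test for an edge. `worse` requires the pair to be known already,
-- so an unknown pair is always written.
worse improves : Test
worse    = conj (less (const 0) (read FL (pair Uv Vv))) (neg (less viaX (read Dm (pair Uv Vv))))
improves = conj (less (const 0ℚ) (read 0 (pair Uv Xv)))
                (conj (less (const 0) (read FL (pair Xv Vv))) (neg worse))

assignP relaxP relaxV relaxX relaxU roundsP : Prog
assignP = asg rat Dm (pair Uv Vv) viaX ∙ asg nat FL (pair Uv Vv) (const 1)
relaxP  = cond improves assignP nop
relaxV  = for Vv 0 relaxP
relaxX  = for Xv 0 relaxV
relaxU  = for Uv 0 relaxX
roundsP = for Tv 0 relaxU

startE farP farLoop endP : Prog
startE  = asg nat Ev (const 0) (read 0 (const 2))
farP    = cond (less {rat} (read Dm (add (read MN (read 0 (const 2))) (var Ev)))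
                     (read Dm (add (read MN (read 0 (const 2))) (var Vv))))
            (asg nat Ev (const 0) (var Vv)) nop
farLoop = for Vv 0 farP
endP    = startE ∙ farLoop

countP countLoop clearCount placeP rankP ranksP rootsP orderP : Prog
countP     = cond (less {rat} (read Dm (pair Ev Vv)) (read Dm (pair Ev Uv)))
               (asg nat Cv (const 0) (incr Cv)) nop
countLoop  = for Vv 0 countP
clearCount = asg nat Cv (const 0) (const 0)
placeP     = asg nat PO (incr Cv) (var Uv)
rankP      = clearCount ∙ countLoop ∙ placeP
ranksP     = for Uv 0 rankP
rootsP     = asg nat PO (const 0) (read 0 (const 2)) ∙
             asg nat PO (add (const 1) (var 0)) (read 0 (const 2))
orderP     = ranksP ∙ rootsP

-- Correctness of the tables and of the relaxation rounds.

module Tables (n : ℕ) where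
  w : ℕ
  w = suc (suc n)

  record Multiples (m j y z : ℕ) (mw mn : ℕ → ℕ) : Set where
    field
      index : j ≡ m
      accw  : y ≡ m * w
      accn  : z ≡ m * n
      rows  : ∀ x → x < m → mw x ≡ x * w
      cols  : ∀ x → x < m → mn x ≡ x * n

  Tabled : ℕ → State → Set
  Tabled m τ = Multiples m (τ nat Jv 0) (τ nat Yv 0) (τ nat Zv 0) (τ nat MW) (τ nat MN)

  write-next : ∀ τ A {j m y} {v : ℕ → ℕ} → j ≡ m → y ≡ v m → (∀ x → x < m → τ nat A x ≡ v x) →
               ∀ x → x < suc m → update τ nat A j y nat A x ≡ v x
  write-next τ A {m = m} refl refl old x x≤m with m≤n⇒m<n∨m≡n (s≤s⁻¹ x≤m)
  ... | inj₂ refl = update-hit τ nat A _ refl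
  ... | inj₁ x<m  = trans (update-miss τ nat A _ (λ e → <-irrefl (sym e) x<m)) (old x x<m)

  table-step : ∀ {m} τ → τ nat W 0 ≡ w → τ nat 0 0 ≡ n → Tabled m τ → Tabled (suc m) (run tableBody τ)
  table-step {m} τ eW en t = record
    { index = cong suc (t .index)
    ; accw  = trans (cong₂ _+_ (t .accw) eW) (+-comm (m * w) w)
    ; accn  = trans (cong₂ _+_ (t .accn) en) (+-comm (m * n) n)
    ; rows  = write-next τ MW {v = _* w} (t .index) (t .accw) (t .rows)
    ; cols  = write-next τ MN {v = _* n} (t .index) (t .accn) (t .cols)
    }
    where open Multiples

  tables-run : ∀ σ → σ nat W 0 ≡ w → σ nat 0 0 ≡ n → Tabled 0 σ → Tabled (w * w) (run tableP σ)
  tables-run σ eW en start =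
    for-rule Av W tableRow (λ a τ → Tabled (a * w) τ) refl (λ _ _ _ t → record { Multiples t }) σ eW start
      (λ a τ a<w _ ag t → subst (λ m → Tabled m (run tableRow τ)) (+-comm (a * w) w)
         (for-rule Bv W tableBody (λ b ρ → Tabled (a * w + b) ρ) refl (λ _ _ _ t′ → record { Multiples t′ }) τ
            (trans (ag nat W 0 refl) eW) (subst (λ m → Tabled m τ) (sym (+-identityʳ (a * w))) t)
            (λ b ρ b<w _ ag′ t′ → subst (λ m → Tabled m (run tableBody ρ)) (sym (+-suc (a * w) b))
               (table-step ρ (trans (ag′ nat W 0 refl) (trans (ag nat W 0 refl) eW))
                             (trans (ag′ nat 0 0 refl) (trans (ag nat 0 0 refl) en)) t′))))

module Shortest {n : ℕ} (G : Graph n) {d : DistanceFunction (Fin n)}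
                (isMetric : IsMetric _≡_ d) (ind : Induces G d) where

  private module M = IsMetric isMetric

  w : ℕ
  w = suc (suc n)

  cell : Fin n → Fin n → ℕ
  cell u v = toℕ u * n + toℕ v

  cell-injective : ∀ {u v u′ v′} → cell u v ≡ cell u′ v′ → u ≡ u′ × v ≡ v′
  cell-injective {u} {v} {u′} {v′} e with cell-inj {n} {toℕ u} {toℕ v} {toℕ u′} {toℕ v′} (toℕ<n v) (toℕ<n v′) e
  ... | eu , ev = toℕ-injective eu , toℕ-injective ev

  Setting : State → Set
  Setting σ = σ nat 0 0 ≡ n
            × (∀ (u : Fin n) → σ nat MN (toℕ u) ≡ toℕ u * n)
            × (∀ u v → σ rat 0 (cell u v) ≡ fromMaybe 0ℚ (weight G u v))

  setting-frame : ∀ p σ τ → Agree p σ τ → writesTo p nat 0 ≡ false → writesTo p nat MN ≡ false →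
                  writesTo p rat 0 ≡ false → Setting σ → Setting τ
  setting-frame p σ τ ag a b c (s₁ , s₂ , s₃) =
    trans (ag nat 0 0 a) s₁ , (λ u → trans (ag nat MN _ b) (s₂ u)) , (λ u v → trans (ag rat 0 _ c) (s₃ u v))

  pair-eval : ∀ σ → Setting σ → ∀ {x y u v} → x ≡ toℕ u → y ≡ toℕ v → σ nat MN x + y ≡ cell u v
  pair-eval σ s {u = u} refl refl = cong (_+ _) (proj₁ (proj₂ s) u)

  for-each : ∀ x p (Inv : ℕ → State → Set) → writesTo p nat x ≡ false →
             (∀ m τ v → Inv m τ → Inv m (update τ nat x 0 v)) →
             ∀ σ → σ nat 0 0 ≡ n → Inv 0 σ →
             (∀ (i : Fin n) τ → τ nat x 0 ≡ toℕ i → Agree (for x 0 p) σ τ → Inv (toℕ i) τ → Inv (suc (toℕ i)) (run p τ)) →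
             Inv n (run (for x 0 p) σ)
  for-each x p Inv fr stable σ en start body = for-rule x 0 p Inv fr stable σ en start
    (λ m τ m<n e ag inv → subst (λ i → Inv (suc i) (run p τ)) (toℕ-fromℕ< m<n)
       (body (fromℕ< m<n) τ (trans e (sym (toℕ-fromℕ< m<n))) ag (subst (λ i → Inv i τ) (sym (toℕ-fromℕ< m<n)) inv)))

  Sound : (ℕ → ℕ) → (ℕ → ℚ) → Set
  Sound F D = ∀ u v → F (cell u v) ≢ 0 → d u v ℚ.≤ D (cell u v)

  Known : (ℕ → ℕ) → (ℕ → ℚ) → Fin n → Fin n → ℚ → Set
  Known F D u v q = F (cell u v) ≢ 0 × D (cell u v) ℚ.≤ q

  Extends : (ℕ → ℕ) → (ℕ → ℚ) → (ℕ → ℕ) → (ℕ → ℚ) → Set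
  Extends F D F′ D′ = ∀ u v q → Known F D u v q → Known F′ D′ u v q

  -- Only an upper bound is claimed, because relaxation works in place and may be ahead of round
  -- `i`. With `Sound` it becomes exact once `i` covers a shortest path.
  Progress : ℕ → (ℕ → ℕ) → (ℕ → ℚ) → Set
  Progress i F D = ∀ {u v} (p : Star (Edge G) u v) → hops p ≤ i → Known F D u v (length G p)

  Relaxed : ℕ → Fin n → Fin n → Fin n → (ℕ → ℕ) → (ℕ → ℚ) → Set
  Relaxed i u x v F D = ∀ (e : Edge G u x) (p : Star (Edge G) x v) → hops p ≤ i →
                        Known F D u v (proj₁ e ℚ.+ length G p)

  module _ (F : ℕ → ℕ) (D : ℕ → ℚ) (F′ : ℕ → ℕ) (D′ : ℕ → ℚ) {u v : Fin n} {c : ℚ}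
           (hitF : F′ (cell u v) ≡ 1) (hitD : D′ (cell u v) ≡ c)
           (missF : ∀ y → y ≢ cell u v → F′ y ≡ F y) (missD : ∀ y → y ≢ cell u v → D′ y ≡ D y) where

    private
      same? : ∀ a b → (a ≡ u × b ≡ v) ⊎ cell a b ≢ cell u v
      same? a b with cell a b Data.Nat.≟ cell u v
      ... | yes e = inj₁ (cell-injective {a} {b} {u} {v} e)
      ... | no ne = inj₂ ne

    assign-sound : d u v ℚ.≤ c → Sound F D → Sound F′ D′
    assign-sound le s a b with same? a b
    ... | inj₁ (refl , refl) = λ _ → ℚ.≤-trans le (ℚ.≤-reflexive (sym hitD))
    ... | inj₂ ne rewrite missF _ ne | missD _ ne = s a b

    assign-extends : (F (cell u v) ≢ 0 → c ℚ.≤ D (cell u v)) → Extends F D F′ D′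
    assign-extends le a b q (k , l) with same? a b
    ... | inj₁ (refl , refl) = (λ e → 0≢1+n (trans (sym e) hitF)) , ℚ.≤-trans (ℚ.≤-reflexive hitD) (ℚ.≤-trans (le k) l)
    ... | inj₂ ne rewrite missF _ ne | missD _ ne = k , l

  edge-weight : ∀ {u x} → (e : Edge G u x) → fromMaybe 0ℚ (weight G u x) ≡ proj₁ e
  edge-weight (q , e) = cong (fromMaybe 0ℚ) e

  weight-edge : ∀ {u x} → 0ℚ ℚ.< fromMaybe 0ℚ (weight G u x) → ∃ λ (e : Edge G u x) → proj₁ e ≡ fromMaybe 0ℚ (weight G u x)
  weight-edge {u} {x} lt with weight G u x in eq
  ... | just q  = (q , refl) , refl
  ... | nothing = contradiction lt (ℚ.<-irrefl refl)

  ≢false : ∀ {b} → b ≢ false → b ≡ true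
  ≢false {true}  _  = refl
  ≢false {false} ne = contradiction refl ne

  ∧-intro : ∀ {a b} → a ≡ true → b ≡ true → a ∧ b ≡ true
  ∧-intro refl refl = refl

  positive⁻ : ∀ {m} → m ≢ 0 → (0 <ᵇ m) ≡ true
  positive⁻ {zero}  ne = contradiction refl ne
  positive⁻ {suc m} _  = refl

  positive⁺ : ∀ {m} → (0 <ᵇ m) ≡ true → m ≢ 0
  positive⁺ {suc m} _ ()

  -- An assignment is sound by the triangle inequality. If nothing is assigned although `u`, `x` is
  -- an edge and the rest is known, then `worse` holds, and the stored value is already as good as
  -- the detour through `x`.
  relax-run : ∀ {i} τ (u x v : Fin n) → Setting τ → τ nat Uv 0 ≡ toℕ u → τ nat Xv 0 ≡ toℕ x → τ nat Vv 0 ≡ toℕ v →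
              Sound (τ nat FL) (τ rat Dm) → Progress i (τ nat FL) (τ rat Dm) →
              Sound (run relaxP τ nat FL) (run relaxP τ rat Dm)
              × Extends (τ nat FL) (τ rat Dm) (run relaxP τ nat FL) (run relaxP τ rat Dm)
              × Relaxed i u x v (run relaxP τ nat FL) (run relaxP τ rat Dm)
  relax-run {i} τ u x v st eU eX eV sound progress =
    cond-rule (λ ρ → Sound (ρ nat FL) (ρ rat Dm)
                   × Extends (τ nat FL) (τ rat Dm) (ρ nat FL) (ρ rat Dm)
                   × Relaxed i u x v (ρ nat FL) (ρ rat Dm)) improves assignP nop τ taken skipped
    where
    F = τ nat FL
    D = τ rat Dm
    q = fromMaybe 0ℚ (weight G u x)
    c = q ℚ.+ D (cell x v)
    eUX : τ nat MN (τ nat Uv 0) + τ nat Xv 0 ≡ cell u x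
    eUX = pair-eval τ st eU eX
    eXV : τ nat MN (τ nat Xv 0) + τ nat Vv 0 ≡ cell x v
    eXV = pair-eval τ st eX eV
    eUV : τ nat MN (τ nat Uv 0) + τ nat Vv 0 ≡ cell u v
    eUV = pair-eval τ st eU eV
    eW : τ rat 0 (τ nat MN (τ nat Uv 0) + τ nat Xv 0) ≡ q
    eW = trans (cong (τ rat 0) eUX) (proj₂ (proj₂ st) u x)
    eC : eval τ viaX ≡ c
    eC = cong₂ ℚ._+_ eW (cong D eXV)
    eD : eval {rat} τ (read Dm (pair Uv Vv)) ≡ D (cell u v)
    eD = cong D eUV
    taken : test τ improves ≡ true → _
    taken e = finish (run assignP τ)
        (update-hit τ nat FL 1 eUV) (trans (update-hit τ rat Dm (eval τ viaX) eUV) eC)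
        (λ y ne → update-miss τ nat FL 1 (λ e′ → ne (trans (sym e′) eUV)))
        (λ y ne → update-miss τ rat Dm (eval τ viaX) (λ e′ → ne (trans (sym e′) eUV)))
      where
      guard₁ = proj₁ (∧-true {test τ (less (const 0ℚ) (read 0 (pair Uv Xv)))} e)
      guards = ∧-true {test τ (less (const 0) (read FL (pair Xv Vv)))}
                      (proj₂ (∧-true {test τ (less (const 0ℚ) (read 0 (pair Uv Xv)))} e))
      edge-ux = weight-edge {u} {x} (subst (0ℚ ℚ.<_) eW (less⇒< {0ℚ} guard₁))
      knownXV : F (cell x v) ≢ 0
      knownXV = subst (λ y → F y ≢ 0) eXV (positive⁺ (proj₁ guards))
      not-worse : test τ worse ≡ false
      not-worse = T-not (subst T (sym (proj₂ guards)) _)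
      improves-on : F (cell u v) ≢ 0 → c ℚ.≤ D (cell u v)
      improves-on ne = subst₂ ℚ._≤_ eC eD (ℚ.<⇒≤ (less⇒< {eval τ viaX} (≢false λ lt → contradiction
        (trans (sym not-worse) (∧-intro (positive⁻ (subst (λ y → F y ≢ 0) (sym eUV) ne)) (cong not lt))) λ ())))
      bound : d u v ℚ.≤ c
      bound = ℚ.≤-trans (M.triangle u x v)
        (ℚ.+-mono-≤ (ℚ.≤-trans (edge-bound isMetric G ind (proj₂ (proj₁ edge-ux))) (ℚ.≤-reflexive (proj₂ edge-ux)))
                    (sound x v knownXV))
      finish : ∀ ρ → ρ nat FL (cell u v) ≡ 1 → ρ rat Dm (cell u v) ≡ c →
               (∀ y → y ≢ cell u v → ρ nat FL y ≡ F y) → (∀ y → y ≢ cell u v → ρ rat Dm y ≡ D y) →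
               Sound (ρ nat FL) (ρ rat Dm) × Extends F D (ρ nat FL) (ρ rat Dm) × Relaxed i u x v (ρ nat FL) (ρ rat Dm)
      finish ρ hitF hitD missF missD =
        assign-sound F D (ρ nat FL) (ρ rat Dm) {u} {v} hitF hitD missF missD bound sound ,
        assign-extends F D (ρ nat FL) (ρ rat Dm) {u} {v} hitF hitD missF missD improves-on ,
        λ e′ p le → (λ z → 0≢1+n (trans (sym z) hitF)) ,
          ℚ.≤-trans (ℚ.≤-reflexive hitD) (ℚ.+-mono-≤ (ℚ.≤-reflexive (edge-weight e′)) (proj₂ (progress p le)))
    skipped : test τ improves ≡ false → _
    skipped e = sound , (λ _ _ _ known → known) , relaxed
      where
      relaxed : Relaxed i u x v F D
      relaxed e′ p le = cases (test τ worse) refl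
        where
        knownXV = progress p le
        is-edge : test τ (less (const 0ℚ) (read 0 (pair Uv Xv))) ≡ true
        is-edge = ≢false λ eq → ℚ.<-irrefl refl (ℚ.<-≤-trans (positive G (proj₂ e′))
          (ℚ.≤-trans (ℚ.≤-reflexive (sym (trans eW (edge-weight e′)))) (¬less⇒≥ {0ℚ} eq)))
        cases : ∀ b → test τ worse ≡ b → Known F D u v (proj₁ e′ ℚ.+ length G p)
        cases true ew = subst (λ y → F y ≢ 0) eUV (positive⁺ (proj₁ both)) ,
            ℚ.≤-trans (subst₂ ℚ._≤_ eD eC (¬less⇒≥ {eval τ viaX} (T-not (subst T (sym (proj₂ both)) _))))
                      (ℚ.+-mono-≤ (ℚ.≤-reflexive (edge-weight e′)) (proj₂ knownXV))
          where both = ∧-true {test τ (less (const 0) (read FL (pair Uv Vv)))} ew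
        cases false ew = contradiction
          (trans (sym e) (∧-intro is-edge (∧-intro (positive⁻ (subst (λ y → F y ≢ 0) (sym eXV) (proj₁ knownXV))) (cong not ew))))
          λ ()

  relaxed-extends : ∀ {i u x v F D F′ D′} → Extends F D F′ D′ → Relaxed i u x v F D → Relaxed i u x v F′ D′
  relaxed-extends {u = u} {v = v} ext r e p le = ext u v _ (r e p le)

  progress-extends : ∀ {i F D F′ D′} → Extends F D F′ D′ → Progress i F D → Progress i F′ D′
  progress-extends ext pr {u} {v} p le = ext u v _ (pr p le)

  -- `R` collects the triples relaxed so far. Entries only improve, so a triple relaxed early stays
  -- relaxed, and the nested loops enlarge `R` one coordinate at a time.
  Round : ℕ → (Fin n → Fin n → Fin n → Set) → State → State → Set
  Round i R σ τ = Sound (τ nat FL) (τ rat Dm)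
                × Extends (σ nat FL) (σ rat Dm) (τ nat FL) (τ rat Dm)
                × (∀ u x v → R u x v → Relaxed i u x v (τ nat FL) (τ rat Dm))

  round-start : ∀ {i R} σ → Sound (σ nat FL) (σ rat Dm) → (∀ u x v → ¬ R u x v) → Round i R σ σ
  round-start σ s none = s , (λ _ _ _ known → known) , λ u x v r → contradiction r (none u x v)

  round-compose : ∀ {i R R′ R″} σ τ ρ → (∀ u x v → R″ u x v → R u x v ⊎ R′ u x v) →
                  Round i R σ τ → Round i R′ τ ρ → Round i R″ σ ρ
  round-compose σ τ ρ split (_ , ext , r) (s , ext′ , r′) =
    s , (λ u v q known → ext′ u v q (ext u v q known)) ,
    λ u x v r″ → Data.Sum.[ (λ a → relaxed-extends {F = τ nat FL} {τ rat Dm} {ρ nat FL} {ρ rat Dm} ext′ (r u x v a)) , r′ u x v ] (split u x v r″)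

  round-loop : ∀ {i} (R : ℕ → Fin n → Fin n → Fin n → Set) (R′ : Fin n → Fin n → Fin n → Fin n → Set) y p →
               writesTo p nat y ≡ false → (y ≡ᵇ FL) ≡ false →
               (∀ u x v → ¬ R 0 u x v) → (∀ j u x v → R (suc (toℕ j)) u x v → R (toℕ j) u x v ⊎ R′ j u x v) →
               ∀ σ → σ nat 0 0 ≡ n → Sound (σ nat FL) (σ rat Dm) → Progress i (σ nat FL) (σ rat Dm) →
               (∀ (j : Fin n) τ → τ nat y 0 ≡ toℕ j → Agree (for y 0 p) σ τ →
                  Sound (τ nat FL) (τ rat Dm) → Progress i (τ nat FL) (τ rat Dm) → Round i (R′ j) τ (run p τ)) →
               Round i (R n) σ (run (for y 0 p) σ)
  round-loop {i} R R′ y p fr y≢ none split σ en sound progress body =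
    for-each y p (λ m τ → Round i (R m) σ τ) fr stable σ en (round-start σ sound none)
      (λ j τ e ag (s , ext , r) → round-compose σ τ (run p τ) (split j) (s , ext , r)
         (body j τ e ag s (progress-extends {i} {σ nat FL} {σ rat Dm} {τ nat FL} {τ rat Dm} ext progress)))
    where
    stable : ∀ m τ v → Round i (R m) σ τ → Round i (R m) σ (update τ nat y 0 v)
    stable m τ v (s , ext , r) = sound′ , ext′ , r′
      where
      τ′ = update τ nat y 0 v
      eF : ∀ j → τ′ nat FL j ≡ τ nat FL j
      eF j rewrite y≢ = refl
      known′ : ∀ a b q → Known (τ nat FL) (τ rat Dm) a b q → Known (τ′ nat FL) (τ′ rat Dm) a b q
      known′ a b q (k , l) rewrite eF (cell a b) = k , l
      sound′ : Sound (τ′ nat FL) (τ′ rat Dm)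
      sound′ a b rewrite eF (cell a b) = s a b
      ext′ : Extends (σ nat FL) (σ rat Dm) (τ′ nat FL) (τ′ rat Dm)
      ext′ a b q known = known′ a b q (ext a b q known)
      r′ : ∀ u x v → R m u x v → Relaxed i u x v (τ′ nat FL) (τ′ rat Dm)
      r′ u x v a e p′ le = known′ u v _ (r u x v a e p′ le)

  split-< : ∀ {a b} {A : Set} → a < suc b → (a ≡ b → A) → a < b ⊎ A
  split-< lt h with m≤n⇒m<n∨m≡n (s≤s⁻¹ lt)
  ... | inj₁ a<b = inj₁ a<b
  ... | inj₂ e   = inj₂ (h e)

  round-weaken : ∀ {i R R′} σ τ → (∀ u x v → R′ u x v → R u x v) → Round i R σ τ → Round i R′ σ τ
  round-weaken σ τ incl (s , ext , r) = s , ext , λ u x v r′ → r u x v (incl u x v r′)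

  relaxV-run : ∀ {i} σ (u x : Fin n) → Setting σ → σ nat Uv 0 ≡ toℕ u → σ nat Xv 0 ≡ toℕ x →
               Sound (σ nat FL) (σ rat Dm) → Progress i (σ nat FL) (σ rat Dm) →
               Round i (λ a b _ → a ≡ u × b ≡ x) σ (run relaxV σ)
  relaxV-run {i} σ u x st eU eX sound progress =
    round-weaken σ (run relaxV σ) (λ { a b c (ea , eb) → ea , eb , toℕ<n c })
      (round-loop (λ m a b c → a ≡ u × b ≡ x × toℕ c < m) (λ j a b c → a ≡ u × b ≡ x × c ≡ j) Vv relaxP refl refl
         (λ { _ _ _ (_ , _ , ()) })
         (λ { j a b c (ea , eb , lt) → Data.Sum.map₁ (λ lt′ → ea , eb , lt′)
                (split-< lt (λ e → ea , eb , toℕ-injective e)) })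
         σ (proj₁ st) sound progress
         (λ j τ e ag s pr → single τ (run relaxP τ) j (relax-run τ u x j (setting-frame relaxV σ τ ag refl refl refl st)
            (trans (ag nat Uv 0 refl) eU) (trans (ag nat Xv 0 refl) eX) e s pr)))
    where
    single : ∀ τ ρ j → Sound (ρ nat FL) (ρ rat Dm) × Extends (τ nat FL) (τ rat Dm) (ρ nat FL) (ρ rat Dm)
                       × Relaxed i u x j (ρ nat FL) (ρ rat Dm) →
             Round i (λ a b c → a ≡ u × b ≡ x × c ≡ j) τ ρ
    single τ ρ j (s , ext , r) = s , ext , λ { _ _ _ (refl , refl , refl) → r }

  relaxX-run : ∀ {i} σ (u : Fin n) → Setting σ → σ nat Uv 0 ≡ toℕ u →
               Sound (σ nat FL) (σ rat Dm) → Progress i (σ nat FL) (σ rat Dm) →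
               Round i (λ a _ _ → a ≡ u) σ (run relaxX σ)
  relaxX-run σ u st eU sound progress =
    round-weaken σ (run relaxX σ) (λ a b c ea → ea , toℕ<n b)
      (round-loop (λ m a b c → a ≡ u × toℕ b < m) (λ j a b c → a ≡ u × b ≡ j) Xv relaxV refl refl
         (λ { _ _ _ (_ , ()) })
         (λ { j a b c (ea , lt) → Data.Sum.map₁ (λ lt′ → ea , lt′) (split-< lt (λ e → ea , toℕ-injective e)) })
         σ (proj₁ st) sound progress
         (λ j τ e ag s pr → relaxV-run τ u j (setting-frame relaxX σ τ ag refl refl refl st)
            (trans (ag nat Uv 0 refl) eU) e s pr))

  relaxU-run : ∀ {i} σ → Setting σ → Sound (σ nat FL) (σ rat Dm) → Progress i (σ nat FL) (σ rat Dm) →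
               Round i (λ _ _ _ → ⊤) σ (run relaxU σ)
  relaxU-run σ st sound progress =
    round-weaken σ (run relaxU σ) (λ a b c _ → toℕ<n a)
      (round-loop (λ m a b c → toℕ a < m) (λ j a b c → a ≡ j) Uv relaxX refl refl
         (λ { _ _ _ () })
         (λ j a b c lt → split-< lt toℕ-injective)
         σ (proj₁ st) sound progress
         (λ j τ e ag s pr → relaxX-run τ j (setting-frame relaxU σ τ ag refl refl refl st) e s pr))

  -- Limits simple paths to fewer than `n` edges, so that `n` rounds reach a shortest one.
  unique-length : (xs : List.List (Fin n)) → Unique xs → List.length xs ≤ n
  unique-length xs un = injective⇒≤ (lookup-injective xs un)
    where
    lookup-injective : (xs : List.List (Fin n)) → Unique xs → ∀ {i j} → List.lookup xs i ≡ List.lookup xs j → i ≡ j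
    lookup-injective (x List.∷ xs) _        {fzero}  {fzero}  _ = refl
    lookup-injective (x List.∷ xs) (x∉ ∷ _) {fzero}  {fsuc j} e = contradiction e (All.lookup x∉ (∈-lookup j))
    lookup-injective (x List.∷ xs) (x∉ ∷ _) {fsuc i} {fzero}  e = contradiction (sym e) (All.lookup x∉ (∈-lookup i))
    lookup-injective (x List.∷ xs) (_ ∷ un) {fsuc i} {fsuc j} e = cong fsuc (lookup-injective xs un e)

  visited-length : ∀ {u v} (p : Star (Edge G) u v) → List.length (visited p) ≡ suc (hops p)
  visited-length ε       = refl
  visited-length (_ ◅ p) = cong suc (visited-length p)

  Distances : State → Set
  Distances σ = ∀ u v → σ rat Dm (cell u v) ≡ d u v

  rounds-run : ∀ σ → Setting σ → Sound (σ nat FL) (σ rat Dm) → Progress 0 (σ nat FL) (σ rat Dm) →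
               Distances (run roundsP σ)
  rounds-run σ st sound progress = exact (run roundsP σ)
    (for-each Tv relaxU (λ i τ → Sound (τ nat FL) (τ rat Dm) × Progress i (τ nat FL) (τ rat Dm))
       refl (λ _ _ _ inv → inv) σ (proj₁ st) (sound , progress)
       (λ i τ _ ag (s , pr) → advance τ (run relaxU τ) pr
          (relaxU-run τ (setting-frame roundsP σ τ ag refl refl refl st) s pr)))
    where
    advance : ∀ {i} τ ρ → Progress i (τ nat FL) (τ rat Dm) → Round i (λ _ _ _ → ⊤) τ ρ →
              Sound (ρ nat FL) (ρ rat Dm) × Progress (suc i) (ρ nat FL) (ρ rat Dm)
    advance {i} τ ρ pr (s , ext , r) = s , further
      where
      further : Progress (suc i) (ρ nat FL) (ρ rat Dm)
      further {u} ε le = ext u u _ (pr {u} ε z≤n)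
      further (e ◅ p) le = r _ _ _ _ e p (s≤s⁻¹ le)
    exact : ∀ τ → Sound (τ nat FL) (τ rat Dm) × Progress n (τ nat FL) (τ rat Dm) → Distances τ
    exact τ (s , pr) u v with proj₁ (ind u v)
    ... | p , e with pr (walk p) (≤-trans (n≤1+n _) (≤-trans (≤-reflexive (sym (visited-length (walk p))))
                                                            (unique-length _ (simple p))))
    ...   | known , le = ℚ.≤-antisym (ℚ.≤-trans le (ℚ.≤-reflexive e)) (s u v known)

  self-run : ∀ σ → Setting σ → (∀ y → σ nat FL y ≡ 0) → (∀ y → σ rat Dm y ≡ 0ℚ) →
             Sound (run selfP σ nat FL) (run selfP σ rat Dm) × Progress 0 (run selfP σ nat FL) (run selfP σ rat Dm)
  self-run σ st zF zD = finish (run selfP σ) (run-frame selfP σ)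
    (for-each Uv knowP Inv refl (λ _ _ _ i → i) σ (proj₁ st) ((λ y ne → contradiction (zF y) ne) , λ _ ()) body)
    where
    Inv : ℕ → State → Set
    Inv m τ = (∀ y → τ nat FL y ≢ 0 → ∃ λ u → y ≡ cell u u) × (∀ u → toℕ u < m → τ nat FL (cell u u) ≢ 0)
    body : ∀ u τ → τ nat Uv 0 ≡ toℕ u → Agree selfP σ τ → Inv (toℕ u) τ → Inv (suc (toℕ u)) (run knowP τ)
    body u τ e ag (only , all) = only′ , all′
      where
      addr = pair-eval τ (setting-frame selfP σ τ ag refl refl refl st) {u = u} {u} e e
      only′ : ∀ y → run knowP τ nat FL y ≢ 0 → ∃ λ v → y ≡ cell v v
      only′ y ne with y Data.Nat.≟ cell u u
      ... | yes e′ = u , e′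
      ... | no ne′ = only y (subst (_≢ 0) (update-miss τ nat FL 1 (λ e′ → ne′ (trans (sym e′) addr))) ne)
      all′ : ∀ v → toℕ v < suc (toℕ u) → run knowP τ nat FL (cell v v) ≢ 0
      all′ v lt z with cell v v Data.Nat.≟ cell u u
      ... | yes e′ = contradiction (trans (sym (update-hit τ nat FL 1 (trans addr (sym e′)))) z) λ ()
      ... | no ne′ with m≤n⇒m<n∨m≡n (s≤s⁻¹ lt)
      ...   | inj₁ v<u = all v v<u (trans (sym (update-miss τ nat FL 1 (λ e′ → ne′ (trans (sym e′) addr)))) z)
      ...   | inj₂ v≡u = ne′ (cong (λ x → cell x x) (toℕ-injective v≡u))
    finish : ∀ τ → Agree selfP σ τ → Inv n τ → Sound (τ nat FL) (τ rat Dm) × Progress 0 (τ nat FL) (τ rat Dm)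
    finish τ ag (only , all) = sound , progress
      where
      zero-dist : ∀ y → τ rat Dm y ≡ 0ℚ
      zero-dist y = trans (ag rat Dm y refl) (zD y)
      sound : Sound (τ nat FL) (τ rat Dm)
      sound u v ne with only _ ne
      ... | x , e with cell-injective {u} {v} {x} {x} e
      ...   | refl , refl = ℚ.≤-reflexive (trans (M.≈⇒0 refl) (sym (zero-dist _)))
      progress : Progress 0 (τ nat FL) (τ rat Dm)
      progress {u} ε _ = all u (toℕ<n u) , ℚ.≤-reflexive (zero-dist _)

-- Ranking the vertices by their distance from an end.

fill-toℕ : ∀ {A : Set} {m} (a : A) (f : Fin m → A) i → fill a f (toℕ i) ≡ f i
fill-toℕ {m = m} a f i with toℕ i <? m
... | yes p = cong f (fromℕ<-toℕ i p)
... | no ≮  = contradiction (toℕ<n i) ≮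

count : (ℕ → Bool) → ℕ → ℕ
count f zero    = 0
count f (suc m) = if f m then suc (count f m) else count f m

count-sum : ∀ f m → count f m ≡ ℕΣ.sum {m} (λ j → flag (f (toℕ j)))
count-sum f zero    = refl
count-sum f (suc m) = trans last-flag (trans (cong (_+ flag (f m)) (count-sum f m))
  (sym (SumLast.sum-last +-0-commutativeMonoid (flag ∘ f) m)))
  where
  last-flag : count f (suc m) ≡ count f m + flag (f m)
  last-flag with f m
  ... | true  = +-comm 1 (count f m)
  ... | false = sym (+-identityʳ _)

count-below : ∀ x m → count (_<ᵇ x) m ≡ m ⊓ x
count-below x zero    = refl
count-below x (suc m) with <-≤-connex m x
... | inj₁ m<x rewrite <ᵇ-true m<x | count-below x m | m≤n⇒m⊓n≡m (<⇒≤ m<x) = sym (m≤n⇒m⊓n≡m m<x)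
... | inj₂ x≤m rewrite <ᵇ-false x≤m | count-below x m | m≥n⇒m⊓n≡n x≤m = sym (m≥n⇒m⊓n≡n (m≤n⇒m≤1+n x≤m))

-- Reindexing the sum by `ρ` turns it into a count of positions, of which exactly `x` lie below `x`.
count-rank : ∀ {n} (ρ : Permutation′ n) u →
             count (fill false (λ v → toℕ (ρ ⟨$⟩ʳ v) <ᵇ toℕ (ρ ⟨$⟩ʳ u))) n ≡ toℕ (ρ ⟨$⟩ʳ u)
count-rank {n} ρ u = begin
  count (fill false (λ v → toℕ (ρ ⟨$⟩ʳ v) <ᵇ x)) n
    ≡⟨ count-sum _ n ⟩
  ℕΣ.sum {n} (λ v → flag (fill false (λ v → toℕ (ρ ⟨$⟩ʳ v) <ᵇ x) (toℕ v)))
    ≡⟨ ℕΣ.sum-cong-≗ {n} (λ v → cong flag (fill-toℕ false (λ v → toℕ (ρ ⟨$⟩ʳ v) <ᵇ x) v)) ⟩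
  ℕΣ.sum {n} (λ v → flag (toℕ (ρ ⟨$⟩ʳ v) <ᵇ x))
    ≡⟨ ℕΣ.sum-permute {n} {n} (λ i → flag (toℕ i <ᵇ x)) ρ ⟨
  ℕΣ.sum {n} (λ i → flag (toℕ i <ᵇ x))
    ≡⟨ count-sum (_<ᵇ x) n ⟨
  count (_<ᵇ x) n
    ≡⟨ count-below x n ⟩
  n ⊓ x
    ≡⟨ m≥n⇒m⊓n≡n (<⇒≤ (toℕ<n (ρ ⟨$⟩ʳ u))) ⟩
  x ∎
  where
  open ≡-Reasoning
  x = toℕ (ρ ⟨$⟩ʳ u)

module Order {n : ℕ} (G : Graph n) {d : DistanceFunction (Fin n)}
             (isMetric : IsMetric _≡_ d) (ind : Induces G d) (r : Fin n) where

  open Shortest G isMetric ind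

  Measured : State → Set
  Measured σ = Setting σ × Distances σ × σ nat 0 2 ≡ toℕ r

  measured-frame : ∀ p σ τ → Agree p σ τ → writesTo p nat 0 ≡ false → writesTo p nat MN ≡ false →
                   writesTo p rat 0 ≡ false → writesTo p rat Dm ≡ false → Measured σ → Measured τ
  measured-frame p σ τ ag a b c e (s , dist , er) =
    setting-frame p σ τ ag a b c s , (λ u v → trans (ag rat Dm _ e) (dist u v)) , trans (ag nat 0 2 a) er

  read-distance : ∀ σ → Measured σ → ∀ {x y u v} → x ≡ toℕ u → y ≡ toℕ v → σ rat Dm (σ nat MN x + y) ≡ d u v
  read-distance σ (s , dist , _) {u = u} {v} ex ey = trans (cong (σ rat Dm) (pair-eval σ s {u = u} {v} ex ey)) (dist u v)

  Farthest : ℕ → ℕ → Set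
  Farthest m e = ∃ λ x → e ≡ toℕ x × (∀ v → toℕ v < m → d r v ℚ.≤ d r x)

  far-test : Test
  far-test = less {rat} (read Dm (add (read MN (read 0 (const 2))) (var Ev)))
                        (read Dm (add (read MN (read 0 (const 2))) (var Vv)))

  end-run : ∀ σ → Measured σ → Farthest n (run endP σ nat Ev 0)
  end-run σ ms = looping (run startE σ) (run-frame startE σ) (proj₂ (proj₂ ms))
    where
    looping : ∀ τ → Agree startE σ τ → τ nat Ev 0 ≡ toℕ r → Farthest n (run farLoop τ nat Ev 0)
    looping τ ag eE = for-each Vv farP (λ m ρ → Farthest m (ρ nat Ev 0)) refl (λ _ _ _ i → i) τ
        (proj₁ (proj₁ mτ)) (r , eE , λ _ ()) body
      where
      mτ = measured-frame startE σ τ ag refl refl refl refl ms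
      body : ∀ v ρ → ρ nat Vv 0 ≡ toℕ v → Agree farLoop τ ρ → Farthest (toℕ v) (ρ nat Ev 0) →
             Farthest (suc (toℕ v)) (run farP ρ nat Ev 0)
      body v ρ eV ag′ (x , ex , far) =
        cond-rule (λ ρ′ → Farthest (suc (toℕ v)) (ρ′ nat Ev 0)) far-test (asg nat Ev (const 0) (var Vv)) nop ρ
          (λ lt → v , eV , extend (λ u u<v → ℚ.≤-trans (far u u<v) (closer (ℚ.<⇒≤ (less⇒< {ρ rat Dm _} lt)))) ℚ.≤-refl)
          (λ ge → x , ex , extend far (subst₂ ℚ._≤_ dv dx (¬less⇒≥ {ρ rat Dm _} ge)))
        where
        mρ = measured-frame farLoop τ ρ ag′ refl refl refl refl mτ
        dx : ρ rat Dm (ρ nat MN (ρ nat 0 2) + ρ nat Ev 0) ≡ d r x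
        dx = read-distance ρ mρ (proj₂ (proj₂ mρ)) ex
        dv : ρ rat Dm (ρ nat MN (ρ nat 0 2) + ρ nat Vv 0) ≡ d r v
        dv = read-distance ρ mρ (proj₂ (proj₂ mρ)) eV
        closer : ρ rat Dm (ρ nat MN (ρ nat 0 2) + ρ nat Ev 0) ℚ.≤ ρ rat Dm (ρ nat MN (ρ nat 0 2) + ρ nat Vv 0) →
                 d r x ℚ.≤ d r v
        closer = subst₂ ℚ._≤_ dx dv
        extend : ∀ {q} → (∀ u → toℕ u < toℕ v → d r u ℚ.≤ q) → d r v ℚ.≤ q →
                 ∀ u → toℕ u < suc (toℕ v) → d r u ℚ.≤ q
        extend old new u u≤v with m≤n⇒m<n∨m≡n (s≤s⁻¹ u≤v)
        ... | inj₁ u<v = old u u<v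
        ... | inj₂ e rewrite toℕ-injective e = new

  module _ (ρ : Permutation′ n) (line : Line isMetric ρ) (e : Fin n) (e0 : toℕ (ρ ⟨$⟩ʳ e) ≡ 0) where

    rank : Fin n → ℕ
    rank v = toℕ (ρ ⟨$⟩ʳ v)

    -- Seen from an end, distance increases strictly along the line, so comparing distances compares
    -- positions, without ties.
    closer-rank : ∀ v u → does (d e v ℚ.<? d e u) ≡ (rank v <ᵇ rank u)
    closer-rank v u with does (d e v ℚ.<? d e u) in eq
    ... | true  = sym (<ᵇ-true (from-end isMetric ρ line e0 (less⇒< {d e v} eq)))
    ... | false = sym (<ᵇ-false (≮⇒≥ λ lt →
                    ℚ.<-irrefl refl (ℚ.<-≤-trans (to-end isMetric ρ line e0 lt) (¬less⇒≥ {d e v} eq))))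

    count-test : Test
    count-test = less {rat} (read Dm (pair Ev Vv)) (read Dm (pair Ev Uv))

    count-run : ∀ σ u → Measured σ → σ nat Ev 0 ≡ toℕ e → σ nat Uv 0 ≡ toℕ u → σ nat Cv 0 ≡ 0 →
                run countLoop σ nat Cv 0 ≡ rank u
    count-run σ u ms eE eU eC = trans
      (for-each Vv countP (λ m τ → τ nat Cv 0 ≡ count f m) refl (λ _ _ _ i → i) σ (proj₁ (proj₁ ms)) eC body)
      (count-rank ρ u)
      where
      f : ℕ → Bool
      f = fill false (λ v → rank v <ᵇ rank u)
      body : ∀ v τ → τ nat Vv 0 ≡ toℕ v → Agree countLoop σ τ → τ nat Cv 0 ≡ count f (toℕ v) →
             run countP τ nat Cv 0 ≡ count f (suc (toℕ v))
      body v τ eV ag inv = cond-rule (λ τ′ → τ′ nat Cv 0 ≡ count f (suc (toℕ v))) count-test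
          (asg nat Cv (const 0) (incr Cv)) nop τ
          (λ t → trans (cong suc inv) (counted (trans (sym value) t)))
          (λ t → trans inv (uncounted (trans (sym value) t)))
        where
        mτ = measured-frame countLoop σ τ ag refl refl refl refl ms
        value : test τ count-test ≡ f (toℕ v)
        value = trans (cong₂ (λ p q → does (p ℚ.<? q))
                         (read-distance τ mτ (trans (ag nat Ev 0 refl) eE) eV)
                         (read-distance τ mτ (trans (ag nat Ev 0 refl) eE) (trans (ag nat Uv 0 refl) eU)))
                      (trans (closer-rank v u) (sym (fill-toℕ false (λ v → rank v <ᵇ rank u) v)))
        counted : f (toℕ v) ≡ true → suc (count f (toℕ v)) ≡ count f (suc (toℕ v))
        counted t rewrite t = refl
        uncounted : f (toℕ v) ≡ false → count f (toℕ v) ≡ count f (suc (toℕ v))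
        uncounted t rewrite t = refl

    Placed : ℕ → State → Set
    Placed m τ = ∀ u → toℕ u < m → τ nat PO (suc (rank u)) ≡ toℕ u

    rank-run : ∀ σ u → Measured σ → σ nat Ev 0 ≡ toℕ e → σ nat Uv 0 ≡ toℕ u → Placed (toℕ u) σ →
               Placed (suc (toℕ u)) (run rankP σ)
    rank-run σ u ms eE eU placed = counting (run clearCount σ) (run-frame clearCount σ) refl
      where
      counting : ∀ τ → Agree clearCount σ τ → τ nat Cv 0 ≡ 0 → Placed (suc (toℕ u)) (run (countLoop ∙ placeP) τ)
      counting τ ag eC = placing (run countLoop τ) (run-frame countLoop τ)
          (count-run τ u (measured-frame clearCount σ τ ag refl refl refl refl ms)
             (trans (ag nat Ev 0 refl) eE) (trans (ag nat Uv 0 refl) eU) eC)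
        where
        placing : ∀ τ₁ → Agree countLoop τ τ₁ → τ₁ nat Cv 0 ≡ rank u → Placed (suc (toℕ u)) (run placeP τ₁)
        placing τ₁ ag₁ eR v v≤u with m≤n⇒m<n∨m≡n (s≤s⁻¹ v≤u)
        ... | inj₂ ev rewrite toℕ-injective ev =
          trans (update-hit τ₁ nat PO (τ₁ nat Uv 0) (cong suc eR)) (trans (ag₁ nat Uv 0 refl) (trans (ag nat Uv 0 refl) eU))
        ... | inj₁ v<u =
          trans (update-miss τ₁ nat PO (τ₁ nat Uv 0) (λ e′ → <-irrefl
                  (cong toℕ (permutation-injective isMetric ρ (sym (trans (sym eR) (suc-injective e′))))) v<u))
                (trans (ag₁ nat PO _ refl) (trans (ag nat PO _ refl) (placed v v<u)))

    module _ (X : Subset n) (k : ℕ) where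
      open Positions isMetric ρ line X r k using (vertex; vertex-inner; vertex-last)

      order-run : ∀ σ → Measured σ → σ nat Ev 0 ≡ toℕ e → ∀ i → i < suc (suc n) → run orderP σ nat PO i ≡ toℕ (vertex i)
      order-run σ ms eE = rooting (run ranksP σ) (run-frame ranksP σ)
        (for-each Uv rankP Placed refl (λ _ _ _ i → i) σ (proj₁ (proj₁ ms)) (λ _ ())
          (λ u τ eU ag → rank-run τ u (measured-frame ranksP σ τ ag refl refl refl refl ms)
             (trans (ag nat Ev 0 refl) eE) eU))
        where
        rooting : ∀ τ → Agree ranksP σ τ → Placed n τ → ∀ i → i < suc (suc n) → run rootsP τ nat PO i ≡ toℕ (vertex i)
        rooting τ ag placed = cases
          where
          mτ = measured-frame ranksP σ τ ag refl refl refl refl ms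
          τ₁ : State
          τ₁ = run (asg nat PO (const 0) (read 0 (const 2))) τ
          en : suc (τ nat 0 0) ≡ suc n
          en = cong suc (proj₁ (proj₁ mτ))
          cases : ∀ i → i < suc (suc n) → run rootsP τ nat PO i ≡ toℕ (vertex i)
          cases zero _ = trans (update-miss τ₁ nat PO {suc (τ nat 0 0)} {0} (τ nat 0 2) (λ ())) (proj₂ (proj₂ mτ))
          cases (suc j) lt with m≤n⇒m<n∨m≡n (s≤s⁻¹ (s≤s⁻¹ lt))
          ... | inj₂ refl = trans (update-hit τ₁ nat PO (τ nat 0 2) en)
                                  (trans (proj₂ (proj₂ mτ)) (cong toℕ (sym vertex-last)))
          ... | inj₁ j<n = trans (update-miss τ₁ nat PO (τ nat 0 2) (λ e′ → <-irrefl (suc-injective (trans (sym e′) en)) j<n))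
              (trans (subst (λ i → τ nat PO (suc i) ≡ toℕ u) rank-u (placed u (toℕ<n u)))
                     (cong toℕ (sym (vertex-inner j<n))))
            where
            u = ρ ⟨$⟩ˡ fromℕ< j<n
            rank-u : rank u ≡ j
            rank-u = trans (cong toℕ (inverseʳ ρ)) (toℕ-fromℕ< j<n)

-- Writing out the tree.

PV : ℕ
PV = 13

eqT : Expr nat → Expr nat → Test
eqT a b = conj (neg (less a b)) (neg (less b a))

orT : Test → Test → Test
orT a b = neg (conj (neg a) (neg b))

eqT-test : ∀ σ a b → test σ (eqT a b) ≡ (eval σ a ≡ᵇ eval σ b)
eqT-test σ a b = compare (eval σ a) (eval σ b)
  where
  compare : ∀ m n → not (m <ᵇ n) ∧ not (n <ᵇ m) ≡ (m ≡ᵇ n)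
  compare zero    zero    = refl
  compare zero    (suc n) = refl
  compare (suc m) zero    = refl
  compare (suc m) (suc n) = compare m n

orT-test : ∀ σ a b → test σ (orT a b) ≡ test σ a ∨ test σ b
orT-test σ a b with test σ a | test σ b
... | true  | _     = refl
... | false | true  = refl
... | false | false = refl

≡ᵇ-toℕ : ∀ {n} (u v : Fin n) → (toℕ u ≡ᵇ toℕ v) ≡ does (u ≟ᶠ v)
≡ᵇ-toℕ u v with u ≟ᶠ v
... | yes refl = ≡ᵇ-refl (toℕ u)
... | no ne    = ≡ᵇ-≢ (λ e → ne (toℕ-injective e))

rootE hereE linkE : Expr nat
rootE = read 0 (const 2)
hereE = read PO (incr Iv)
-- The plan of the interval `(0 , n + 1)`, that is, of the whole line; vertices occupy the positions
-- from 1 on, hence `incr Iv`.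
linkE = read PG (at (at (const 0) (incr 0)) (incr Iv))

noParent someParent chooseParent parentP parentsP : Prog
noParent     = asg nat PV hereE (const 0)
someParent   = asg nat PV hereE (add (const 1) (read PO (sub linkE (const 1))))
chooseParent = cond (less (const 0) linkE) someParent noParent
parentP      = cond (eqT hereE rootE) noParent chooseParent
parentsP     = for Iv 0 parentP

presentT linkedT : Test
presentT = orT (eqT (var Uv) rootE) (less (const 0) (read PV (var Uv)))
linkedT  = orT (eqT (read PV (var Uv)) (incr Vv)) (eqT (read PV (var Vv)) (incr Uv))

vertexP verticesP edgeP edgeRow edgesP outputP : Prog
vertexP   = cond presentT (asg nat 2 (var Uv) (const 1)) (asg nat 2 (var Uv) (const 0))
verticesP = for Uv 0 vertexP
edgeP     = cond linkedT (asg nat 3 (pair Uv Vv) (const 1)) (asg nat 3 (pair Uv Vv) (const 0))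
edgeRow   = for Vv 0 edgeP
edgesP    = for Uv 0 edgeRow
outputP   = parentsP ∙ verticesP ∙ edgesP

flag-run : ∀ (P : State → Set) b A i σ {c} → test σ b ≡ c → P (update σ nat A (eval σ i) (flag c)) →
           P (run (cond b (asg nat A i (const 1)) (asg nat A i (const 0))) σ)
flag-run P b A i σ refl h with test σ b
... | true  = h
... | false = h

fill-step : ∀ {n} τ A (cell : Fin n → ℕ) (h : Fin n → ℕ) u {i x} →
            (∀ {v} → cell v ≡ cell u → v ≡ u) →
            i ≡ cell u → x ≡ h u → (∀ v → toℕ v < toℕ u → τ nat A (cell v) ≡ h v) →
            ∀ v → toℕ v < suc (toℕ u) → update τ nat A i x nat A (cell v) ≡ h v
fill-step τ A cell h u inj refl refl old v v≤u with m≤n⇒m<n∨m≡n (s≤s⁻¹ v≤u)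
... | inj₂ e rewrite toℕ-injective e = update-hit τ nat A (h u) refl
... | inj₁ v<u = trans (update-miss τ nat A (h u) (λ e → <-irrefl (cong toℕ (inj (sym e))) v<u)) (old v v<u)

module Emit {n : ℕ} (G : Graph n) {d : DistanceFunction (Fin n)} (isMetric : IsMetric _≡_ d) (ind : Induces G d)
            (ρ : Permutation′ n) (line : Line isMetric ρ) (X : Subset n) (r : Fin n) (k : ℕ) where

  open Positions isMetric ρ line X r k
  open Shortest G isMetric ind using (Setting; setting-frame; for-each; cell; cell-injective; pair-eval)
  open Correct N k δ terminal using (w; Static; static-frame; at-eval; <w⇒<ww)

  plan : State → ℕ → ℕ
  plan σ i = σ nat PG ((0 * w + N) * w + i)

  module _ (σ : State) {v : ℚ} (opt : Optimal 0 0 N v (plan σ)) (set : Setting σ) (st : Static σ)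
           (er : σ nat 0 2 ≡ toℕ r) (places : ∀ i → i < w → σ nat PO i ≡ toℕ (vertex i)) where

    f : ℕ → ℕ
    f = plan σ

    open ToTree f opt
    open Parents code using (linked)

    -- Read off the chain of `i`: its first step leads to a sentinel or to another inner position,
    -- so `PO` translates the parent into a vertex.
    parent-inside : ∀ {i x} → 0 < i → i < N → f i ≡ suc x → x < w
    parent-inside {i} 0<i i<N e with Served.reach (proj₁ opt) i 0<i i<N (inj₂ λ z → 0≢1+n (trans (sym z) e))
    ... | stop (_ , inj₁ refl) = contradiction 0<i (<-irrefl refl)
    ... | stop (_ , inj₂ refl) = contradiction i<N (<-irrefl refl)
    ... | step _ _ e′ p rewrite suc-injective (trans (sym e) e′) with p
    ...   | stop (_ , inj₁ refl) = s≤s z≤n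
    ...   | stop (_ , inj₂ refl) = ≤-refl
    ...   | step _ lt _ _        = m<n⇒m<1+n lt

    code-absent : ∀ u → f (suc (rank u)) ≡ 0 → code u ≡ 0
    code-absent u e with does (u ≟ᶠ r) | f (suc (rank u)) | e
    ... | true  | _    | _    = refl
    ... | false | zero | refl = refl

    code-parent : ∀ u {x} → u ≢ r → f (suc (rank u)) ≡ suc x → code u ≡ suc (toℕ (vertex x))
    code-parent u u≢r e rewrite dec-false (u ≟ᶠ r) u≢r | e = refl

    Coded : ℕ → State → Set
    Coded m τ = ∀ u → rank u < m → τ nat PV (toℕ u) ≡ code u

    parents-run : Coded n (run parentsP σ)
    parents-run = for-rule Iv 0 parentP Coded refl (λ _ _ _ i → i) σ (proj₁ set) (λ _ ()) body
      where
      body : ∀ m τ → m < n → τ nat Iv 0 ≡ m → Agree parentsP σ τ → Coded m τ → Coded (suc m) (run parentP τ)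
      body m τ m<n eI ag inv =
        cond-rule (Coded (suc m)) (eqT hereE rootE) noParent chooseParent τ
          (λ e → store 0 (trans (cong code (root⁺ e)) code-root))
          (λ e → cond-rule (Coded (suc m)) (less (const 0) linkE) someParent noParent τ
            (λ e′ → store _ (some (root⁻ e) (eval τ linkE) refl (<ᵇ-true⁻ e′)))
            (λ e′ → store 0 (code-absent u (trans (cong f (cong suc rank-u)) (trans (sym link-value) (n≤0⇒n≡0 (<ᵇ-false⁻ e′)))))))
        where
        u : Fin n
        u = vertex (suc m)
        sm<N : suc m < N
        sm<N = s≤s m<n
        rank-u : rank u ≡ m
        rank-u = suc-injective (rank-vertex (s≤s z≤n) sm<N)
        place : ∀ i → i < w → τ nat PO i ≡ toℕ (vertex i)
        place i lt = trans (ag nat PO i refl) (places i lt)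
        here-value : τ nat PO (suc (τ nat Iv 0)) ≡ toℕ u
        here-value = trans (cong (λ i → τ nat PO (suc i)) eI) (place (suc m) (m<n⇒m<1+n sm<N))
        st′ = static-frame parentsP σ τ ag refl st
        link-value : eval τ linkE ≡ f (suc m)
        link-value = trans (cong (τ nat PG) (at-eval τ st′ (0 * w + N) (suc m)
            (at-eval τ st′ 0 N refl (cong suc (trans (ag nat 0 0 refl) (proj₁ set))) (s≤s z≤n))
            (cong suc eI) (m≤m+n w (N * w))))
          (ag nat PG _ refl)
        root-test : test τ (eqT hereE rootE) ≡ does (u ≟ᶠ r)
        root-test = trans (eqT-test τ hereE rootE)
          (trans (cong₂ _≡ᵇ_ here-value (trans (ag nat 0 2 refl) er)) (≡ᵇ-toℕ u r))
        root⁺ : test τ (eqT hereE rootE) ≡ true → u ≡ r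
        root⁺ e = does-true (u ≟ᶠ r) (trans (sym root-test) e)
        root⁻ : test τ (eqT hereE rootE) ≡ false → u ≢ r
        root⁻ e = does-false (u ≟ᶠ r) (trans (sym root-test) e)
        some : u ≢ r → ∀ y → eval τ linkE ≡ y → 0 < y → code u ≡ suc (τ nat PO (eval τ linkE ∸ 1))
        some u≢r (suc x) e _ = trans (code-parent u u≢r (trans (cong f (cong suc rank-u)) f-x))
          (cong suc (sym (trans (cong (λ y → τ nat PO (y ∸ 1)) e) (place x (parent-inside (s≤s z≤n) sm<N f-x)))))
          where
          f-x : f (suc m) ≡ suc x
          f-x = trans (sym link-value) e
        store : ∀ x → code u ≡ x → Coded (suc m) (update τ nat PV (τ nat PO (suc (τ nat Iv 0))) x)
        store x ex y y≤m with m≤n⇒m<n∨m≡n (s≤s⁻¹ y≤m)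
        ... | inj₂ e = subst (λ z → update τ nat PV (τ nat PO (suc (τ nat Iv 0))) x nat PV (toℕ z) ≡ code z) u≡y
                         (trans (update-hit τ nat PV x here-value) (sym ex))
          where
          u≡y : u ≡ y
          u≡y = permutation-injective isMetric ρ (trans rank-u (sym e))
        ... | inj₁ y<m = trans (update-miss τ nat PV x (λ e → <-irrefl
                             (trans (cong rank (toℕ-injective (trans (sym e) here-value))) rank-u) y<m)) (inv y y<m)

    emit-run : Outputs (run outputP σ) tree
    emit-run = vertices-run (run parentsP σ) (run-frame parentsP σ) λ u → parents-run u (toℕ<n _)
      where
      vertices-run : ∀ τ → Agree parentsP σ τ → (∀ u → τ nat PV (toℕ u) ≡ code u) →
                     Outputs (run (verticesP ∙ edgesP) τ) tree
      vertices-run τ ag coded = edges-run (run verticesP τ) (run-frame verticesP τ)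
          (λ u → for-each Uv vertexP (λ m τ′ → ∀ v → toℕ v < m → τ′ nat 2 (toℕ v) ≡ flag (present v))
             refl (λ _ _ _ i → i) τ (proj₁ set₁) (λ _ ()) body u (toℕ<n u))
        where
        set₁ = setting-frame parentsP σ τ ag refl refl refl set
        body : ∀ u τ′ → τ′ nat Uv 0 ≡ toℕ u → Agree verticesP τ τ′ →
               (∀ v → toℕ v < toℕ u → τ′ nat 2 (toℕ v) ≡ flag (present v)) →
               ∀ v → toℕ v < suc (toℕ u) → run vertexP τ′ nat 2 (toℕ v) ≡ flag (present v)
        body u τ′ eU ag′ inv = flag-run (λ τ″ → ∀ v → toℕ v < suc (toℕ u) → τ″ nat 2 (toℕ v) ≡ flag (present v))
            presentT 2 (var Uv) τ′ value
            (fill-step τ′ 2 toℕ (λ v → flag (present v)) u toℕ-injective eU refl inv)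
          where
          value : test τ′ presentT ≡ present u
          value = trans (orT-test τ′ (eqT (var Uv) rootE) (less (const 0) (read PV (var Uv)))) (cong₂ _∨_
            (trans (eqT-test τ′ (var Uv) rootE)
               (trans (cong₂ _≡ᵇ_ eU (trans (ag′ nat 0 2 refl) (trans (ag nat 0 2 refl) er))) (≡ᵇ-toℕ u r)))
            (cong (0 <ᵇ_) (trans (cong (τ′ nat PV) eU) (trans (ag′ nat PV _ refl) (coded u)))))
        edges-run : ∀ τ₁ → Agree verticesP τ τ₁ → (∀ v → τ₁ nat 2 (toℕ v) ≡ flag (present v)) →
                    Outputs (run edgesP τ₁) tree
        edges-run τ₁ ag₁ verts =
          (λ v → trans (run-frame edgesP τ₁ nat 2 (toℕ v) refl)
                       (trans (verts v) (cong flag (sym (lookup∘tabulate present v))))) ,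
          (λ u v → trans (cong (run edgesP τ₁ nat 3) (trans (toℕ-combine u v) (cong (_+ toℕ v) (*-comm n (toℕ u)))))
                         (rows u (toℕ<n u) v))
          where
          set₂ = setting-frame verticesP τ τ₁ ag₁ refl refl refl set₁
          Row : Fin n → State → Set
          Row u τ′ = ∀ v → τ′ nat 3 (cell u v) ≡ flag (linked u v)
          rows : ∀ u → toℕ u < n → Row u (run edgesP τ₁)
          rows = for-each Uv edgeRow (λ m τ′ → ∀ u → toℕ u < m → Row u τ′) refl (λ _ _ _ i → i) τ₁ (proj₁ set₂) (λ _ ())
            (λ u τ′ eU ag′ inv → row u τ′ eU ag′ inv)
            where
            row : ∀ u τ′ → τ′ nat Uv 0 ≡ toℕ u → Agree edgesP τ₁ τ′ → (∀ a → toℕ a < toℕ u → Row a τ′) →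
                  ∀ a → toℕ a < suc (toℕ u) → Row a (run edgeRow τ′)
            row u τ′ eU ag′ inv a a≤u = conclude
                (for-each Vv edgeP Inv refl (λ _ _ _ i → i) τ′ (proj₁ set₃) (inv , λ _ ()) body′)
              where
              set₃ = setting-frame edgesP τ₁ τ′ ag′ refl refl refl set₂
              Inv : ℕ → State → Set
              Inv m τ″ = (∀ b → toℕ b < toℕ u → Row b τ″)
                       × (∀ v → toℕ v < m → τ″ nat 3 (cell u v) ≡ flag (linked u v))
              conclude : Inv n (run edgeRow τ′) → Row a (run edgeRow τ′)
              conclude (before , now) with m≤n⇒m<n∨m≡n (s≤s⁻¹ a≤u)
              ... | inj₁ a<u = before a a<u
              ... | inj₂ e rewrite toℕ-injective e = λ v → now v (toℕ<n v)
              body′ : ∀ v τ″ → τ″ nat Vv 0 ≡ toℕ v → Agree edgeRow τ′ τ″ → Inv (toℕ v) τ″ →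
                      Inv (suc (toℕ v)) (run edgeP τ″)
              body′ v τ″ eV ag″ (before , now) = flag-run (Inv (suc (toℕ v))) linkedT 3 (pair Uv Vv) τ″ value
                  ((λ b b<u c → trans (update-miss τ″ nat 3 _ (λ e → <-irrefl (cong toℕ (sym (proj₁
                       (cell-injective {u} {v} {b} {c} (trans (sym addr) e))))) b<u)) (before b b<u c)) ,
                   fill-step τ″ 3 (cell u) (λ c → flag (linked u c)) v
                     (λ {c} e → proj₂ (cell-injective {u} {c} {u} {v} e)) addr refl now)
                where
                eU″ = trans (ag″ nat Uv 0 refl) eU
                addr : τ″ nat MN (τ″ nat Uv 0) + τ″ nat Vv 0 ≡ cell u v
                addr = pair-eval τ″ (setting-frame edgeRow τ′ τ″ ag″ refl refl refl set₃) {u = u} {v} eU″ eV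
                coded″ : ∀ {x} c → x ≡ toℕ c → τ″ nat PV x ≡ code c
                coded″ c refl = trans (ag″ nat PV _ refl) (trans (ag′ nat PV _ refl) (trans (ag₁ nat PV _ refl) (coded c)))
                value : test τ″ linkedT ≡ linked u v
                value = trans (orT-test τ″ (eqT (read PV (var Uv)) (incr Vv)) (eqT (read PV (var Vv)) (incr Uv)))
                  (cong₂ _∨_
                    (trans (eqT-test τ″ (read PV (var Uv)) (incr Vv)) (cong₂ _≡ᵇ_ (coded″ u eU″) (cong suc eV)))
                    (trans (eqT-test τ″ (read PV (var Vv)) (incr Uv)) (cong₂ _≡ᵇ_ (coded″ v eV) (cong suc eU″))))

-- The time bound, and assembly of the whole program.

depth : Prog → ℕ
depth (asg _ _ _ _) = 0
depth (p ∙ q)       = depth p ⊔ depth q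
depth (cond _ p q)  = depth p ⊔ depth q
depth (for _ _ p)   = suc (depth p)
depth nop           = 0

-- Each level of nesting contributes one factor of at most `suc a`, so the exponent is read off the
-- syntax.
mono≤ : ∀ prot a p σ → T (wf prot p) → (∀ A → T (prot A) → suc (σ nat A 0) ≤ suc a) →
        ∀ e → depth p ≤ e → mono p σ ≤ suc a ^ e
mono≤ prot a (asg s A i x) σ w h e le = m^n>0 (suc a) e
mono≤ prot a (p ∙ q) σ w h e le = ⊔-lub
  (mono≤ prot a p σ (proj₁ (T-∧⁻ w)) h e (≤-trans (m≤m⊔n _ _) le))
  (mono≤ prot a q σ (proj₂ (T-∧⁻ {wf prot p} w)) h e (≤-trans (m≤n⊔m (depth p) _) le))
mono≤ prot a (cond b p q) σ w h e le = ⊔-lub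
  (mono≤ prot a p σ (proj₁ (T-∧⁻ w)) h e (≤-trans (m≤m⊔n _ _) le))
  (mono≤ prot a q σ (proj₂ (T-∧⁻ {wf prot p} w)) h e (≤-trans (m≤n⊔m (depth p) _) le))
mono≤ prot a (for x y p) σ w h (suc e) (s≤s le) with wf-for prot x y p w
... | wy , _ , _ , wp = *-mono-≤ (h y wy) (mono≤ prot a p σ wp h e le)
mono≤ prot a nop σ w h e le = m^n>0 (suc a) e

^-distribʳ-* : ∀ m n e → (m * n) ^ e ≡ m ^ e * n ^ e
^-distribʳ-* m n zero    = refl
^-distribʳ-* m n (suc e) =
  trans (cong (m * n *_) (^-distribʳ-* m n e)) ([m*n]*[o*p]≡[m*o]*[n*p] m n (m ^ e) (n ^ e))

fromBase fromOrder fromEnd mainP wholeP : Prog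
fromBase  = baseP ∙ layersP ∙ outputP
fromOrder = orderP ∙ fromBase
fromEnd   = endP ∙ fromOrder
mainP     = tableP ∙ selfP ∙ roundsP ∙ fromEnd
wholeP    = sizesP ∙ mainP

-- `sizesP` has no loops and writes `W` and `K₁`, so nothing is protected there. `sizes` omits `K₁`,
-- whose value is not bounded in terms of `n`; it limits only the loop over the layers.
none sizes bounds : ℕ → Bool
none   _ = false
sizes  A = (A ≡ᵇ 0) ∨ (A ≡ᵇ W)
bounds A = sizes A ∨ (A ≡ᵇ K₁)

runs-seq : ∀ {c₁ c₂ σ τ ρ} s₁ s₂ {m₁ m₂ b} → Runs c₁ σ τ (s₁ * m₁) → Runs c₂ τ ρ (s₂ * m₂) →
           m₁ ≤ 256 * b → m₂ ≤ 256 * b → Runs (c₁ ⨾ c₂) σ ρ (((s₁ + s₂) * 256) * b)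
runs-seq s₁ s₂ {m₁} {m₂} {b} (t₁ , ex₁ , le₁) (t₂ , ex₂ , le₂) l₁ l₂ = _ , ex₁ ⨾ ex₂ , (begin
  t₁ + t₂                           ≤⟨ +-mono-≤ le₁ le₂ ⟩
  s₁ * m₁ + s₂ * m₂                 ≤⟨ +-mono-≤ (*-monoʳ-≤ s₁ l₁) (*-monoʳ-≤ s₂ l₂) ⟩
  s₁ * (256 * b) + s₂ * (256 * b)   ≡⟨ *-distribʳ-+ (256 * b) s₁ s₂ ⟨
  (s₁ + s₂) * (256 * b)             ≡⟨ *-assoc (s₁ + s₂) 256 b ⟨
  ((s₁ + s₂) * 256) * b             ∎)
  where open ≤-Reasoning

module Assembly {n : ℕ} (d : DistanceFunction (Fin n)) (pm : IsPathMetric d) (G : Graph n) (ind : Induces G d)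
                (X : Subset n) (r : Fin n) (k₁ : ℕ) where

  k : ℕ
  k = suc k₁

  open IsPathMetric pm using (isMetric; induced)
  open Shortest G isMetric ind
  open Order G isMetric ind r

  n>0 : 1 ≤ n
  n>0 = ≤-trans (s≤s z≤n) (toℕ<n r)

  σ₀ : State
  σ₀ = run sizesP (input G X r k)

  Goal : State → Set
  Goal τ = ∃ λ S → Outputs τ S × IsMinimumKHopSteinerTree d X r k S

  weights : ∀ u v → σ₀ rat 0 (cell u v) ≡ fromMaybe 0ℚ (weight G u v)
  weights u v = trans (cong (fill 0ℚ entry) (sym (trans (toℕ-combine u v) (cong (_+ toℕ v) (*-comm n (toℕ u))))))
    (trans (fill-toℕ 0ℚ entry (combine u v)) (cong (λ uv → fromMaybe 0ℚ (uncurry (weight G) uv)) (remQuot-combine u v)))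
    where
    entry : Fin (n * n) → ℚ
    entry uv = fromMaybe 0ℚ (uncurry (weight G) (remQuot {n} n uv))

  terminals : ∀ v → σ₀ nat 1 (toℕ v) ≡ flag (lookup X v)
  terminals = fill-toℕ 0 (λ v → flag (lookup X v))

  record Ready (τ : State) : Set where
    field
      width    : τ nat W 0 ≡ w
      layers   : τ nat K₁ 0 ≡ k₁
      rows     : ∀ x → x < w * w → τ nat MW x ≡ x * w
      marks    : ∀ v → τ nat 1 (toℕ v) ≡ flag (lookup X v)

  ready-frame : ∀ p σ τ → Agree p σ τ → writesTo p nat W ≡ false → writesTo p nat K₁ ≡ false →
                writesTo p nat MW ≡ false → writesTo p nat 1 ≡ false → Ready σ → Ready τ
  ready-frame p σ τ ag a b c e s = record
    { width  = trans (ag nat W 0 a) (s .width)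
    ; layers = trans (ag nat K₁ 0 b) (s .layers)
    ; rows   = λ x lt → trans (ag nat MW x c) (s .rows x lt)
    ; marks  = λ v → trans (ag nat 1 _ e) (s .marks v)
    }
    where open Ready

  n<ww : ∀ {i} → i < n → i < w * w
  n<ww lt = <-≤-trans lt (≤-trans (≤-trans (n≤1+n n) (n≤1+n (suc n))) (m≤m*n w w))

  module _ (ρ : Permutation′ n) (line : Line isMetric ρ) where

    open Positions isMetric ρ line X r k
    open Correct N k δ terminal using (Static; Table; base-run; layers-run; static-frame)
    open Emit G isMetric ind ρ line X r k

    finished : ∀ τ₅ → Setting τ₅ → τ₅ nat 0 2 ≡ toℕ r → (∀ i → i < w → τ₅ nat PO i ≡ toℕ (vertex i)) →
               Static τ₅ → τ₅ nat K₁ 0 ≡ k₁ → Goal (run fromBase τ₅)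
    finished τ₅ set er places st eK = based (run baseP τ₅) (run-frame baseP τ₅) (base-run τ₅ refl st)
      where
      based : ∀ τ₆ → Agree baseP τ₅ τ₆ → Table k₁ (τ₆ rat GV) (τ₆ nat PG) → Goal (run (layersP ∙ outputP) τ₆)
      based τ₆ ag₆ table₆ = solved (run layersP τ₆) (run-frame layersP τ₆)
          (layers-run τ₆ refl st₆ (trans (ag₆ nat K₁ 0 refl) eK) table₆)
        where
        st₆ = static-frame baseP τ₅ τ₆ ag₆ refl st
        solved : ∀ τ₇ → Agree layersP τ₆ τ₇ → Table 0 (τ₇ rat GV) (τ₇ nat PG) → Goal (run outputP τ₇)
        solved τ₇ ag₇ table₇ =
          ToTree.tree (plan τ₇) opt , emit-run τ₇ opt
            (setting-frame layersP τ₆ τ₇ ag₇ refl refl refl (setting-frame baseP τ₅ τ₆ ag₆ refl refl refl set))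
            (static-frame layersP τ₆ τ₇ ag₇ refl st₆)
            (trans (ag₇ nat 0 2 refl) (trans (ag₆ nat 0 2 refl) er))
            (λ i lt → trans (ag₇ nat PO i refl) (trans (ag₆ nat PO i refl) (places i lt))) ,
          ToTree.minimum (plan τ₇) opt (s≤s z≤n)
          where
          opt : Optimal 0 0 N (τ₇ rat GV (0 * w + N)) (plan τ₇)
          opt = table₇ 0 N (s≤s z≤n) ≤-refl

  correct : Goal (run mainP σ₀)
  correct = tabled (run tableP σ₀) (run-frame tableP σ₀)
      (Tables.tables-run n σ₀ refl refl record { index = refl ; accw = refl ; accn = refl ; rows = λ _ () ; cols = λ _ () })
    where
    measured : ∀ τ₃ → Measured τ₃ → Ready τ₃ → Goal (run fromEnd τ₃)
    measured τ₃ ms₃ ready₃ = ended (run endP τ₃) (run-frame endP τ₃) (end-run τ₃ ms₃)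
      where
      ended : ∀ τ₄ → Agree endP τ₃ τ₄ → Farthest n (τ₄ nat Ev 0) → Goal (run fromOrder τ₄)
      ended τ₄ ag₄ (e , ee , far)
        with farthest-end isMetric (proj₁ (proj₁ (proj₂ induced)))
               (path-line isMetric (proj₁ induced) (proj₁ (proj₂ induced)) (proj₂ (proj₂ induced)))
               r e (λ v → far v (toℕ<n v))
      ... | ρ , line , e0 = ordered (run orderP τ₄) (run-frame orderP τ₄) (order-run ρ line e e0 X k τ₄ ms₄ ee)
        where
        open Positions isMetric ρ line X r k using (vertex; N; δ; terminal)
        open Correct N k δ terminal using (Static)
        ms₄ = measured-frame endP τ₃ τ₄ ag₄ refl refl refl refl ms₃
        ready₄ = ready-frame endP τ₃ τ₄ ag₄ refl refl refl refl ready₃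
        ordered : ∀ τ₅ → Agree orderP τ₄ τ₅ → (∀ i → i < w → τ₅ nat PO i ≡ toℕ (vertex i)) →
                  Goal (run fromBase τ₅)
        ordered τ₅ ag₅ places = finished ρ line τ₅ (proj₁ ms₅) (proj₂ (proj₂ ms₅)) places
          (Ready.width ready₅ , Ready.rows ready₅ ,
           (λ i j li lj → read-distance τ₅ ms₅ (places i li) (places j lj)) ,
           (λ i li → trans (cong (τ₅ nat 1) (places i li)) (Ready.marks ready₅ (vertex i))))
          (Ready.layers ready₅)
          where
          ms₅ = measured-frame orderP τ₄ τ₅ ag₅ refl refl refl refl ms₄
          ready₅ = ready-frame orderP τ₄ τ₅ ag₅ refl refl refl refl ready₄

    tabled : ∀ τ₁ → Agree tableP σ₀ τ₁ → Tables.Tabled n (w * w) τ₁ →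
             Goal (run (selfP ∙ roundsP ∙ fromEnd) τ₁)
    tabled τ₁ ag₁ t = selfed (run selfP τ₁) (run-frame selfP τ₁)
        (self-run τ₁ set₁ (λ y → ag₁ nat FL y refl) (λ y → ag₁ rat Dm y refl))
      where
      set₁ : Setting τ₁
      set₁ = ag₁ nat 0 0 refl , (λ u → Tables.Multiples.cols t (toℕ u) (n<ww (toℕ<n u))) ,
             (λ u v → trans (ag₁ rat 0 _ refl) (weights u v))
      ready₁ : Ready τ₁
      ready₁ = record
        { width = ag₁ nat W 0 refl ; layers = ag₁ nat K₁ 0 refl
        ; rows = Tables.Multiples.rows t ; marks = λ v → trans (ag₁ nat 1 _ refl) (terminals v) }
      selfed : ∀ τ₂ → Agree selfP τ₁ τ₂ →
               Sound (τ₂ nat FL) (τ₂ rat Dm) × Progress 0 (τ₂ nat FL) (τ₂ rat Dm) →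
               Goal (run (roundsP ∙ fromEnd) τ₂)
      selfed τ₂ ag₂ (sound , progress) = rounded (run roundsP τ₂) (run-frame roundsP τ₂) (rounds-run τ₂ set₂ sound progress)
        where
        set₂ = setting-frame selfP τ₁ τ₂ ag₂ refl refl refl set₁
        rounded : ∀ τ₃ → Agree roundsP τ₂ τ₃ → Distances τ₃ → Goal (run fromEnd τ₃)
        rounded τ₃ ag₃ dist = measured τ₃
          (setting-frame roundsP τ₂ τ₃ ag₃ refl refl refl set₂ , dist ,
           trans (ag₃ nat 0 2 refl) (trans (ag₂ nat 0 2 refl) (ag₁ nat 0 2 refl)))
          (ready-frame roundsP τ₂ τ₃ ag₃ refl refl refl refl
             (ready-frame selfP τ₁ τ₂ ag₂ refl refl refl refl ready₁))

  -- `suc w` is `n + 3`, which is at most `4 * n` because the root makes `n` positive; 256 is the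
  -- fourth power of 4.
  power-bound : suc w ^ 4 ≤ 256 * n ^ 5
  power-bound = begin
    suc w ^ 4        ≤⟨ ^-monoˡ-≤ 4 width≤ ⟩
    (4 * n) ^ 4      ≡⟨ ^-distribʳ-* 4 n 4 ⟩
    256 * n ^ 4      ≤⟨ *-monoʳ-≤ 256 (^-monoʳ-≤ n {{>-nonZero n>0}} (n≤1+n 4)) ⟩
    256 * n ^ 5      ∎
    where
    open ≤-Reasoning
    width≤ : suc w ≤ 4 * n
    width≤ = ≤-trans (≤-reflexive (+-comm 3 n)) (+-monoʳ-≤ n (*-monoʳ-≤ 3 n>0))

  protected : ∀ A → T (sizes A) → suc (σ₀ nat A 0) ≤ suc w
  protected A t with Data.Bool.Properties.T-∨ {A ≡ᵇ 0}
  ... | eq with Function.Equivalence.to eq t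
  ...   | inj₁ e rewrite ≡ᵇ⇒≡ A 0 e = s≤s (≤-trans (n≤1+n n) (n≤1+n (suc n)))
  ...   | inj₂ e rewrite ≡ᵇ⇒≡ A W e = ≤-refl

  mono-piece : ∀ p → T (wf sizes p) → T (depth p ≤ᵇ 4) → mono p σ₀ ≤ suc w ^ 4
  mono-piece p wp dp = mono≤ sizes w p σ₀ wp protected 4 (≤ᵇ⇒≤ (depth p) 4 dp)

  -- One layer nests the loops over `Lv`, `Rc`, `Bv` and `Av`, as deep as the relaxation rounds; no
  -- other part is deeper. Only `layersP` has a fifth loop, whose factor `suc k₁` is `k` itself.
  mono-main : mono mainP σ₀ ≤ k * suc w ^ 4
  mono-main = ⊔-lub (once tableP tt tt) (⊔-lub (once selfP tt tt) (⊔-lub (once roundsP tt tt)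
    (⊔-lub (once endP tt tt) (⊔-lub (once orderP tt tt) (⊔-lub (once baseP tt tt)
    (⊔-lub (*-monoʳ-≤ k (mono-piece layerBody tt tt)) (once outputP tt tt)))))))
    where
    once : ∀ p → T (wf sizes p) → T (depth p ≤ᵇ 4) → mono p σ₀ ≤ k * suc w ^ 4
    once p wp dp = ≤-trans (mono-piece p wp dp) (m≤n*m (suc w ^ 4) k)

  budget : k * suc w ^ 4 ≤ 256 * (suc k₁ * n ^ 5)
  budget = begin
    k * suc w ^ 4             ≤⟨ *-monoʳ-≤ k power-bound ⟩
    k * (256 * n ^ 5)         ≡⟨ *-assoc k 256 (n ^ 5) ⟨
    k * 256 * n ^ 5           ≡⟨ cong (_* n ^ 5) (*-comm k 256) ⟩
    256 * suc k₁ * n ^ 5      ≡⟨ *-assoc 256 (suc k₁) (n ^ 5) ⟩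
    256 * (suc k₁ * n ^ 5)    ∎
    where open ≤-Reasoning

  nonempty : 1 ≤ 256 * (suc k₁ * n ^ 5)
  nonempty = *-mono-≤ {1} {256} {1} (s≤s z≤n) (*-mono-≤ {1} {suc k₁} {1} (s≤s z≤n) (m^n>0 n {{>-nonZero n>0}} 5))

  mainRun : Runs (compile mainP) σ₀ (run mainP σ₀) (size mainP * mono mainP σ₀)
  mainRun = exec bounds mainP σ₀ tt

  sizesRun : Runs (compile sizesP) (input G X r k) σ₀ (size sizesP * mono sizesP (input G X r k))
  sizesRun = exec none sizesP (input G X r k) tt

  whole-run : Runs (compile wholeP) (input G X r k) (run mainP σ₀) ((size sizesP + size mainP) * 256 * (suc k₁ * n ^ 5))
  whole-run = runs-seq {compile sizesP} {compile mainP} {input G X r k} {σ₀} {run mainP σ₀} (size sizesP) (size mainP)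
    {mono sizesP (input G X r k)} {mono mainP σ₀} {suc k₁ * n ^ 5} sizesRun mainRun nonempty (≤-trans mono-main budget)

theorem3p1 : ∃ λ (program : Cmd) →
    ∃ λ (C : ℕ) →
    ∀ (n : ℕ) (d : DistanceFunction (Fin n)) → IsPathMetric d →
    ∀ (G : Graph n) → Induces G d →
    ∀ (X : Subset n) (r : Fin n) → r ∈ X →
    ∀ (k : ℕ) → 1 ≤ k →
    ∃ λ (σ : State) →
    ∃ λ (t : ℕ) →
    ∃ λ (S : Subgraph n) →
    Exec program (input G X r k) σ t
    × t ≤ C * (k * n ^ 5)
    × Outputs σ S
    × IsMinimumKHopSteinerTree d X r k S
theorem3p1 = compile wholeP , (size sizesP + size mainP) * 256 , solve
  where
  solve : ∀ n (d : DistanceFunction (Fin n)) → IsPathMetric d → ∀ (G : Graph n) → Induces G d →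
          ∀ (X : Subset n) (r : Fin n) → r ∈ X → ∀ k → 1 ≤ k →
          ∃ λ σ → ∃ λ t → ∃ λ S → Exec (compile wholeP) (input G X r k) σ t × t ≤ (size sizesP + size mainP) * 256 * (k * n ^ 5)
                                × Outputs σ S × IsMinimumKHopSteinerTree d X r k S
  solve n d pm G ind X r _ (suc k₁) _ =
    run mainP A.σ₀ , proj₁ A.whole-run , proj₁ A.correct , proj₁ (proj₂ A.whole-run) ,
    proj₂ (proj₂ A.whole-run) , proj₂ A.correct
    where module A = Assembly d pm G ind X r k₁
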